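{- Let $\lambda\vdash n$, let $i$ be a part of $\lambda$, and let $r\ge 1$. For $\pi\in\mathcal{C}_{\lambda,i}$, the number of sequences $(\tau_1,\dots,\tau_r)$ of star transpositions with $\tau_1\tau_2\cdots\tau_r=\pi$ is \[ [K_{\lambda,i}]J_n^r = \sum_{\substack{\mu\vdash n\\ j\in\mu}}\frac{d_\mu}{n!}\,\gamma^{\mu,j}_{\lambda,i}\,c_{\mu,j}^{\,r}, \] where the sum is over all $\mu\vdash n$ and distinct parts $j$ of $\mu$.
   Context: $\mathfrak{S}_n$ is the symmetric group on $\{1,\dots,n\}$ (products read right to left), $\mathbb{C}[\mathfrak{S}_n]$ its group algebra, and $Z_1(n)$ the set of elements commuting with every element of the subgroup $\mathfrak{S}_{n-1}$ fixing $n$. A star transposition is a transposition $(j,n)$ with $1\le j\le n-1$; $J_n=\sum_{1\le j<n}(j,n)$. For a part $i$ of $\lambda\vdash n$, $\mathcal{C}_{\lambda,i}$ is the set of permutations of cycle type $\lambda$ in which $n$ lies on a cycle of length $i$, and $K_{\lambda,i}$ is the sum of its elements; these form a basis of $Z_1(n)$ and $[K_{\lambda,i}]g$ denotes the coefficient. $d_\mu$ is the number of standard Young tableaux of shape $\mu$. $c_{\mu,j}:=j-\sum_{k\ge j}m_k(\mu)$, where $m_k(\mu)$ is the multiplicity of $k$ as a part of $\mu$ (the content, column minus row, of the cell containing $n$ when $n$ sits at the end of a row of length $j$). $e_T$ is Young's seminormal unit of a standard Young tableau $T$; $\mathrm{SYT}_{\mu,j}$ is the set of standard Young tableaux of shape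 $\mu$ with $n$ at the end of a row of length $j$; $\Gamma^{\mu,j}=\sum_{T\in\mathrm{SYT}_{\mu,j}}e_T\in Z_1(n)$. Generalized characters: $\gamma^{\mu,j}_{\lambda,i}:=\frac{n!}{d_\mu}[K_{\lambda,i}]\Gamma^{\mu,j}$. -}

module Defs where

open import Data.Bool using (Bool; true; false; if_then_else_; _∧_; _∨_)
open import Data.Nat as ℕ using (ℕ; zero; suc; _∸_; _⊓_; _≤ᵇ_; _<ᵇ_; _≡ᵇ_)
open import Data.Nat.Properties using () renaming (_≟_ to _≟ℕ_)
open import Data.Integer as ℤ using (ℤ; +_; -[1+_])
open import Data.Fin as Fin using (Fin; toℕ; fromℕ; inject₁)
open import Data.Vec as Vec using (Vec; lookup; tabulate)
open import Data.Vec.Properties using (≡-dec)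
open import Data.List as List
  using (List; []; _∷_; _++_; [_]; map; concatMap; filterᵇ; length; upTo; foldl; deduplicate)
open import Data.Nat.ListAction using (sum)
open import Data.List.Relation.Unary.All using (All)
open import Data.List.Relation.Unary.Unique.Propositional using (Unique)
open import Data.List.Relation.Unary.Linked using (Linked)
open import Data.Rational as ℚ using (ℚ; 0ℚ; 1ℚ)
open import Data.Product using (_×_)
open import Relation.Nullary using (does)
open import Relation.Binary.PropositionalEquality using (_≡_)

Σℚ : List ℚ → ℚ
Σℚ = List.foldr ℚ._+_ 0ℚ

_^ℚ_ : ℚ → ℕ → ℚ
q ^ℚ zero  = 1ℚ
q ^ℚ suc k = q ℚ.* (q ^ℚ k)

-- reciprocal of an integer (convention 1/0 = 0; only ever used on nonzero values)
invℤ : ℤ → ℚ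
invℤ (+ zero)  = 0ℚ
invℤ (+ suc k) = (+ 1) ℚ./ suc k
invℤ -[1+ k ]  = -[1+ 0 ] ℚ./ suc k

fromℕℚ : ℕ → ℚ
fromℕℚ k = (+ k) ℚ./ 1

fromℤℚ : ℤ → ℚ
fromℤℚ z = z ℚ./ 1

_! : ℕ → ℕ
zero !  = 1
suc k ! = suc k ℕ.* (k !)

-- Permutations of Fin n in one-line notation: σ is the vector (σ 0, …, σ (n-1)).
-- The points 1,…,n of the paper are Fin n = {0,…,n-1}; the paper's point n is
-- the last element of Fin n.

Perm : ℕ → Set
Perm n = Vec (Fin n) n

IsPerm : ∀ {n} → Perm n → Set
IsPerm σ = Unique (Vec.toList σ)

_≟ᴾ_ : ∀ {n} (σ τ : Perm n) → Bool
σ ≟ᴾ τ = does (≡-dec Fin._≟_ σ τ)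

idᴾ : ∀ {n} → Perm n
idᴾ {n} = Vec.allFin n

_∘ᴾ_ : ∀ {n} → Perm n → Perm n → Perm n
σ ∘ᴾ τ = tabulate (λ x → lookup σ (lookup τ x))

transp : ∀ {n} → Fin n → Fin n → Perm n
transp a b = tabulate (λ x → if does (x Fin.≟ a) then b else (if does (x Fin.≟ b) then a else x))

allVecs : ∀ {n} (k : ℕ) → List (Vec (Fin n) k)
allVecs zero = Vec.[] ∷ []
allVecs {n} (suc k) = concatMap (λ x → map (x Vec.∷_) (allVecs k)) (List.allFin n)

allᵇ : {A : Set} → (A → Bool) → List A → Bool
allᵇ p [] = true
allᵇ p (x ∷ xs) = p x ∧ allᵇ p xs

uniqueᵇ : ∀ {n} → List (Fin n) → Bool
uniqueᵇ [] = true
uniqueᵇ (x ∷ xs) = allᵇ (λ y → Data.Bool.not (does (x Fin.≟ y))) xs ∧ uniqueᵇ xs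

allPerms : ∀ n → List (Perm n)
allPerms n = filterᵇ (λ σ → uniqueᵇ (Vec.toList σ)) (allVecs n)

-- The group algebra (coefficients in ℚ ⊂ ℂ): an element is its coefficient function.

GA : ℕ → Set
GA n = Perm n → ℚ

δ : ∀ {n} → Perm n → GA n
δ σ π = if σ ≟ᴾ π then 1ℚ else 0ℚ

_+ᴬ_ : ∀ {n} → GA n → GA n → GA n
(f +ᴬ g) π = f π ℚ.+ g π

_·ᴬ_ : ∀ {n} → ℚ → GA n → GA n
(q ·ᴬ f) π = q ℚ.* f π

0ᴬ : ∀ {n} → GA n
0ᴬ _ = 0ℚ

1ᴬ : ∀ {n} → GA n
1ᴬ = δ idᴾ

ΣA : ∀ {n} → List (GA n) → GA n
ΣA = List.foldr _+ᴬ_ 0ᴬ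

_*ᴬ_ : ∀ {n} → GA n → GA n → GA n
_*ᴬ_ {n} f g π =
  Σℚ (concatMap (λ σ → map (λ ρ → if (σ ∘ᴾ ρ) ≟ᴾ π then f σ ℚ.* g ρ else 0ℚ) (allPerms n)) (allPerms n))

_^ᴬ_ : ∀ {n} → GA n → ℕ → GA n
f ^ᴬ zero  = 1ᴬ
f ^ᴬ suc k = f *ᴬ (f ^ᴬ k)

ΠA : ∀ {n} → List (GA n) → GA n
ΠA = List.foldr _*ᴬ_ 1ᴬ

JM : ∀ {n} → Fin n → GA n
JM {n} k = ΣA (map (λ j → δ (transp j k)) (filterᵇ (λ j → toℕ j <ᵇ toℕ k) (List.allFin n)))

Jn : ∀ m → GA (suc m)
Jn m = JM (fromℕ m)

starTranspositions : ∀ m → List (Perm (suc m))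
starTranspositions m = map (λ j → transp (inject₁ j) (fromℕ m)) (List.allFin m)

seqs : ∀ {A : Set} → ℕ → List A → List (List A)
seqs zero xs = [] ∷ []
seqs (suc r) xs = concatMap (λ x → map (x ∷_) (seqs r xs)) xs

prodᴾ : ∀ {n} → List (Perm n) → Perm n
prodᴾ [] = idᴾ
prodᴾ (τ ∷ τs) = τ ∘ᴾ prodᴾ τs

#starFactorizations : ∀ m → ℕ → Perm (suc m) → ℕ
#starFactorizations m r π = length (filterᵇ (λ s → prodᴾ s ≟ᴾ π) (seqs r (starTranspositions m)))

iter : ∀ {n} → Perm n → ℕ → Fin n → Fin n
iter σ zero x = x
iter σ (suc k) x = lookup σ (iter σ k x)

cycleLength : ∀ {n} → Perm n → Fin n → ℕ
cycleLength {n} σ x = go (map suc (upTo n))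
  where
  go : List ℕ → ℕ
  go [] = 0
  go (k ∷ ks) = if does (iter σ k x Fin.≟ x) then k else go ks

isCycleRep : ∀ {n} → Perm n → Fin n → Bool
isCycleRep {n} σ x = allᵇ (λ k → toℕ x ≤ᵇ toℕ (iter σ k x)) (upTo n)

insertDesc : ℕ → List ℕ → List ℕ
insertDesc a [] = a ∷ []
insertDesc a (b ∷ bs) = if b ≤ᵇ a then a ∷ b ∷ bs else b ∷ insertDesc a bs

sortDesc : List ℕ → List ℕ
sortDesc = List.foldr insertDesc []

cycleType : ∀ {n} → Perm n → List ℕ
cycleType {n} σ = sortDesc (map (cycleLength σ) (filterᵇ (isCycleRep σ) (List.allFin n)))

IsPartition : ℕ → List ℕ → Set
IsPartition n lam = (sum lam ≡ n) × All (λ p → 1 ℕ.≤ p) lam × Linked ℕ._≥_ lam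

partsB : ℕ → ℕ → ℕ → List (List ℕ)
partsB _ zero _ = [] ∷ []
partsB zero (suc _) _ = []
partsB (suc f) (suc n) k =
  concatMap (λ p → map (p ∷_) (partsB f (suc n ∸ p) p)) (map suc (upTo (k ⊓ suc n)))

partitions : ℕ → List (List ℕ)
partitions n = partsB n n n

distinctParts : List ℕ → List ℕ
distinctParts = deduplicate _≟ℕ_

inC : ∀ m → List ℕ → ℕ → Perm (suc m) → Bool
inC m lam i π = (cycleType π ≟L lam) ∧ (cycleLength π (fromℕ m) ≡ᵇ i)
  where
  _≟L_ : List ℕ → List ℕ → Bool
  [] ≟L [] = true
  (a ∷ as) ≟L (b ∷ bs) = (a ≡ᵇ b) ∧ (as ≟L bs)
  _ ≟L _ = false

InC : ∀ m → List ℕ → ℕ → Perm (suc m) → Set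
InC m lam i π = IsPerm π × (cycleType π ≡ lam) × (cycleLength π (fromℕ m) ≡ i)

Cset : ∀ m → List ℕ → ℕ → List (Perm (suc m))
Cset m lam i = filterᵇ (inC m lam i) (allPerms (suc m))

-- [K_{λ,i}] g  for g ∈ Z₁(n): the common coefficient of g on 𝒞_{λ,i}, computed as the
-- average of the coefficients of g over 𝒞_{λ,i}
coeffK : ∀ m → List ℕ → ℕ → GA (suc m) → ℚ
coeffK m lam i g = Σℚ (map g (Cset m lam i)) ℚ.* invℤ (+ length (Cset m lam i))

-- Standard Young tableaux, encoded by Yamanouchi words:
-- a tableau T with n cells is the list (w₁,…,w_n) where w_k is the (0-based) row
-- containing k.  Shapes are lists of row lengths.

addToRow : ℕ → List ℕ → List ℕ
addToRow zero [] = 1 ∷ []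
addToRow zero (a ∷ as) = suc a ∷ as
addToRow (suc r) [] = 1 ∷ []          -- never used for valid tableaux
addToRow (suc r) (a ∷ as) = a ∷ addToRow r as

shapeOf : List ℕ → List ℕ
shapeOf = foldl (λ ν r → addToRow r ν) []

rowLen : List ℕ → ℕ → ℕ
rowLen [] _ = 0
rowLen (a ∷ as) zero = a
rowLen (a ∷ as) (suc r) = rowLen as r

addableRows : List ℕ → List ℕ
addableRows ν = filterᵇ ok (upTo (suc (length ν)))
  where
  ok : ℕ → Bool
  ok zero = true
  ok (suc r) = rowLen ν (suc r) <ᵇ rowLen ν r

addContent : List ℕ → ℕ → ℤ
addContent ν r = (+ rowLen ν r) ℤ.- (+ r)

SYTs : ℕ → List (List ℕ)
SYTs zero = [] ∷ []
SYTs (suc k) = concatMap (λ w → map (λ r → w ++ [ r ]) (addableRows (shapeOf w))) (SYTs k)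

_≟Lᵇ_ : List ℕ → List ℕ → Bool
[] ≟Lᵇ [] = true
(a ∷ as) ≟Lᵇ (b ∷ bs) = (a ≡ᵇ b) ∧ (as ≟Lᵇ bs)
_ ≟Lᵇ _ = false

SYTshape : ℕ → List ℕ → List (List ℕ)
SYTshape n μ = filterᵇ (λ w → shapeOf w ≟Lᵇ μ) (SYTs n)

dim : ℕ → List ℕ → ℕ
dim n μ = length (SYTshape n μ)

lastRow : List ℕ → ℕ
lastRow [] = 0
lastRow (r ∷ []) = r
lastRow (_ ∷ r ∷ rs) = lastRow (r ∷ rs)

SYTshapeRow : ℕ → List ℕ → ℕ → List (List ℕ)
SYTshapeRow n μ j = filterᵇ (λ w → rowLen μ (lastRow w) ≡ᵇ j) (SYTshape n μ)

JMℕ : ∀ {n} → ℕ → GA n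
JMℕ {n} k = ΣA (concatMap (λ b → if toℕ b ≡ᵇ k
                                   then map (λ j → δ (transp j b)) (filterᵇ (λ j → toℕ j <ᵇ k) (List.allFin n))
                                   else [])
                          (List.allFin n))

-- Young's seminormal unit (Murphy's formula):
-- e_T = Π_{k=1}^{n} Π_{c} (J_k − c)/(c_T(k) − c), c ranging over the contents of the
-- addable cells of shape(T|_{k−1}) other than the cell of k.
-- (The J_k commute, so the order of the factors is irrelevant.)
seminormal : ∀ {n} → List ℕ → GA n
seminormal {n} w = go 0 [] w
  where
  go : ℕ → List ℕ → List ℕ → GA n
  go _ _ [] = 1ᴬ
  go k ν (r ∷ rs) = factor *ᴬ go (suc k) (addToRow r ν) rs
    where
    cT : ℤ
    cT = addContent ν r
    factor : GA n
    factor = ΠA (map (λ r′ → let c = addContent ν r′ in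
                              invℤ (cT ℤ.- c) ·ᴬ (JMℕ k +ᴬ (fromℤℚ (ℤ.- c) ·ᴬ 1ᴬ)))
                     (filterᵇ (λ r′ → Data.Bool.not (r′ ≡ᵇ r)) (addableRows ν)))

Γ : ∀ {n} → List ℕ → ℕ → GA n
Γ {n} μ j = ΣA (map seminormal (SYTshapeRow n μ j))

mult : ℕ → List ℕ → ℕ
mult k μ = length (filterᵇ (λ p → p ≡ᵇ k) μ)

-- c_{μ,j} = j − Σ_{k ≥ j} m_k(μ)   (parts of μ ⊢ n are ≤ n, so k ranges over j,…,n)
cont : ℕ → List ℕ → ℕ → ℤ
cont n μ j = (+ j) ℤ.- (+ sum (map (λ k → mult k μ) (map (j ℕ.+_) (upTo (suc n ∸ j)))))

γ : ∀ m → List ℕ → ℕ → List ℕ → ℕ → ℚ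
γ m μ j lam i = (fromℕℚ (suc m !) ℚ.* invℤ (+ dim (suc m) μ)) ℚ.* coeffK m lam i (Γ μ j)

characterSum : ∀ m → List ℕ → ℕ → ℕ → ℚ
characterSum m lam i r =
  Σℚ (concatMap (λ μ → map (λ j → ((fromℕℚ (dim (suc m) μ) ℚ.* invℤ (+ (suc m !)))
                                      ℚ.* γ m μ j lam i)
                                     ℚ.* (fromℤℚ (cont (suc m) μ j) ^ℚ r))
                           (distinctParts μ))
                (partitions (suc m)))

{-# OPTIONS --safe #-}

-- Everything is done with the left multiplications X_k by the Jucys–Murphy elements and S_k by
-- the adjacent transpositions, which satisfy S_k X_k + 1 = X_{k+1} S_k and the Coxeter relations.
--
-- Spectrum.  Let u be a joint eigenvector with eigenvalues (…, b, d, …) in places k, k+1.  Then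
-- (b − d) S_k u + u has b and d exchanged, and it is nonzero when b − d ≠ ±1.  Equal neighbours
-- b = d force u = 0 because X_k is self-adjoint, and (b, b ± 1, b) forces u = 0 by the braid
-- relation.  If v has the contents of a tableau of shape ν, then S_k v splits, by induction, into
-- eigenvectors of X_k for the contents of the addable cells of the smaller shape; this shows that
-- v splits into eigenvectors of X_{k+1} for those contents other than a and for a ± 1, where a is
-- the last content of v.  A value a ± 1 that is not the content of an addable cell of ν is the
-- content of a removable corner; moving that corner to the end produces (b, a, b) and kills it.
--
-- Hence the Lagrange factors of Murphy's formula are the projections of this splitting, so the e_T
-- sum to 1 and J_n e_T = c_T(n) e_T, that is J_n^r = Σ_T c_T(n)^r e_T.  Grouping the T by shape and
-- by the row of n gives the character sum.
--
-- The coefficient of π in J_n^r counts the factorizations; it is constant on 𝒞_{λ,i} because two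
-- of its elements are conjugate by a permutation fixing n, matching cycles of equal length.
module Submission where

open import Defs
open import Algebra.Properties.CommutativeSemigroup using (x∙yz≈y∙xz)
open import Data.Bool using (Bool; true; false; if_then_else_; not; T; _∧_)
open import Data.Bool.Properties using (T?; T-∧)
open import Data.Empty using (⊥-elim)
open import Data.Fin as Fin using (Fin; toℕ; fromℕ; inject₁)
import Data.Fin.Properties as FinP
open import Data.Integer as ℤ using (ℤ; -[1+_])
import Data.Integer.Properties as ℤP
open import Data.Integer.Tactic.RingSolver using () renaming (solve-∀ to ℤ-solve-∀)
open import Data.List as List using (List; []; _∷_; _++_; [_]; map; concatMap; filterᵇ; length; foldl; upTo; applyUpTo; allFin)
open import Data.List.Membership.Propositional using (_∈_; _∉_; find; lose)
open import Data.List.Membership.Propositional.Properties using (∈-map⁺; ∈-map⁻; ∈-concatMap⁺; ∈-concatMap⁻; ∈-filter⁺; ∈-filter⁻; ∈-upTo⁺; ∈-upTo⁻; ∈-allFin; ∈-∃++; ∈-deduplicate⁺)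
open import Data.List.Membership.Propositional.Properties.WithK using (unique∧set⇒bag)
import Data.List.Properties as LP
open import Data.List.Relation.Binary.BagAndSetEquality using (∼bag⇒↭)
open import Data.List.Relation.Binary.Permutation.Propositional as ↭ using (_↭_; ↭-refl; ↭-sym; ↭-trans; ↭⇒↭ₛ)
open import Data.List.Relation.Binary.Permutation.Propositional.Properties using (shift; drop-∷; ↭-map-inv; ∈-resp-↭; map⁺)
import Data.List.Relation.Binary.Permutation.Setoid.Properties as SetoidPerm
open import Data.List.Relation.Unary.All as All using (All; []; _∷_)
open import Data.List.Relation.Unary.AllPairs using (AllPairs; []; _∷_)
import Data.List.Relation.Unary.AllPairs.Properties as AllPairs
open import Data.List.Relation.Unary.Any using (here; there)
open import Data.List.Relation.Unary.Unique.DecPropositional.Properties using (deduplicate-!)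
open import Data.List.Relation.Unary.Unique.Propositional using (Unique)
import Data.List.Relation.Unary.Unique.Propositional.Properties as Unique
open import Data.Nat as ℕ using (ℕ; zero; suc; _<_; _≤_; s≤s; z≤n; _≡ᵇ_; _<ᵇ_; _≤ᵇ_; _∸_; _⊓_; NonZero)
open import Data.Nat.DivMod using (_%_; _/_; m≡m%n+[m/n]*n; m%n<n)
open import Data.Nat.Induction using (<-wellFounded)
open import Data.Nat.ListAction using (sum)
import Data.Nat.Properties as ℕP
open import Data.Product using (Σ; _×_; _,_; proj₁; proj₂)
open import Data.Rational as ℚ using (ℚ; 0ℚ; 1ℚ; ½; _+_; _*_; -_; _-_)
import Data.Rational.Properties as ℚP
import Data.Rational.Unnormalised as ℚᵘ
import Data.Rational.Unnormalised.Properties as ℚᵘP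
open import Data.Sum using (_⊎_; inj₁; inj₂)
open import Data.Unit using (tt)
open import Data.Vec as Vec using (Vec; []; _∷_; lookup; tabulate)
import Data.Vec.Membership.Propositional.Properties as VM
import Data.Vec.Properties as VecP
open import Function using (_∘_; mk⇔; Equivalence)
open import Induction.WellFounded using (Acc; acc)
open import Relation.Binary.Definitions using (tri<; tri≈; tri>)
open import Relation.Binary.PropositionalEquality as ≡ using (_≡_; _≢_; refl; sym; trans; cong; cong₂; subst; subst₂; module ≡-Reasoning)
open import Relation.Nullary using (yes; no; does)
open import Relation.Nullary.Decidable using (dec-true; dec-false; dec⇒maybe)
open import Tactic.RingSolver using (solve-∀)
open import Tactic.RingSolver.Core.AlmostCommutativeRing using (AlmostCommutativeRing; fromCommutativeRing)

-- Rationals and finite sums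

-- Vectors are functions on all of `Perm n`, including the lists that are not permutations. Left
-- multiplication by a transposition relabels values, so the operator relations and self-adjointness
-- carry no permutation hypothesis; `IsPerm` enters with `*ᴬ`, whose sums run over permutations
-- only. The splitting of v, with X_k v = a v, comes from a quadratic equation. Write S_k v as the
-- sum of its X_k-eigenvectors z_c, and let P be the Lagrange projection to the eigenvalue a. Then v
-- = P S_k S_k v = t + G, where t = P S_k z_a and G is the sum of the P S_k z_c with c ≠ a; the
-- exchange of eigenvalues makes each of the latter an X_{k+1}-eigenvector for c. For D = X_{k+1} -
-- a the relation between S_k and the X's gives D z_a = v and D t = z_a, hence D² t = t + G. Since D
-- acts by c - a ≠ ±1 on the parts of G, the equation (D² - 1) H = G has a solution in their span.
-- The difference t - H is then fixed by D² and falls into two halves with D = ±1: these are the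
-- eigenvalues a ± 1.

ℚ-ring : AlmostCommutativeRing _ _
ℚ-ring = fromCommutativeRing ℚP.+-*-commutativeRing (λ x → dec⇒maybe (0ℚ ℚ.≟ x))

fromℤℚ-+ : ∀ a b → fromℤℚ (a ℤ.+ b) ≡ fromℤℚ a + fromℤℚ b
fromℤℚ-+ a b = ℚP.toℚᵘ-injective (begin
  ℚ.toℚᵘ (fromℤℚ (a ℤ.+ b))                 ≈⟨ ℚP.toℚᵘ-fromℚᵘ (ℚᵘ.mkℚᵘ (a ℤ.+ b) 0) ⟩
  ℚᵘ.mkℚᵘ (a ℤ.+ b) 0                       ≈⟨ ℚᵘ.*≡* (cong (ℤ._* ℤ.+ 1) (cong₂ ℤ._+_ (sym (ℤP.*-identityʳ a)) (sym (ℤP.*-identityʳ b)))) ⟩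
  ℚᵘ.mkℚᵘ a 0 ℚᵘ.+ ℚᵘ.mkℚᵘ b 0              ≈⟨ ℚᵘP.+-cong (ℚP.toℚᵘ-fromℚᵘ (ℚᵘ.mkℚᵘ a 0)) (ℚP.toℚᵘ-fromℚᵘ (ℚᵘ.mkℚᵘ b 0)) ⟨
  ℚ.toℚᵘ (fromℤℚ a) ℚᵘ.+ ℚ.toℚᵘ (fromℤℚ b)  ≈⟨ ℚP.toℚᵘ-homo-+ (fromℤℚ a) (fromℤℚ b) ⟨
  ℚ.toℚᵘ (fromℤℚ a + fromℤℚ b)              ∎)
  where open ℚᵘP.≃-Reasoning

fromℤℚ-neg : ∀ a → fromℤℚ (ℤ.- a) ≡ - fromℤℚ a
fromℤℚ-neg a = ℚP.toℚᵘ-injective (begin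
  ℚ.toℚᵘ (fromℤℚ (ℤ.- a))   ≈⟨ ℚP.toℚᵘ-fromℚᵘ (ℚᵘ.mkℚᵘ (ℤ.- a) 0) ⟩
  ℚᵘ.- ℚᵘ.mkℚᵘ a 0          ≈⟨ ℚᵘP.-‿cong (ℚP.toℚᵘ-fromℚᵘ (ℚᵘ.mkℚᵘ a 0)) ⟨
  ℚᵘ.- ℚ.toℚᵘ (fromℤℚ a)    ≈⟨ ℚP.toℚᵘ-homo‿- (fromℤℚ a) ⟨
  ℚ.toℚᵘ (- fromℤℚ a)       ∎)
  where open ℚᵘP.≃-Reasoning

fromℤℚ-− : ∀ a b → fromℤℚ (a ℤ.- b) ≡ fromℤℚ a - fromℤℚ b
fromℤℚ-− a b = trans (fromℤℚ-+ a (ℤ.- b)) (cong (fromℤℚ a +_) (fromℤℚ-neg b))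

fromℤℚ-* : ∀ a b → fromℤℚ (a ℤ.* b) ≡ fromℤℚ a * fromℤℚ b
fromℤℚ-* a b = ℚP.toℚᵘ-injective (begin
  ℚ.toℚᵘ (fromℤℚ (a ℤ.* b))                 ≈⟨ ℚP.toℚᵘ-fromℚᵘ (ℚᵘ.mkℚᵘ (a ℤ.* b) 0) ⟩
  ℚᵘ.mkℚᵘ a 0 ℚᵘ.* ℚᵘ.mkℚᵘ b 0              ≈⟨ ℚᵘP.*-cong (ℚP.toℚᵘ-fromℚᵘ (ℚᵘ.mkℚᵘ a 0)) (ℚP.toℚᵘ-fromℚᵘ (ℚᵘ.mkℚᵘ b 0)) ⟨
  ℚ.toℚᵘ (fromℤℚ a) ℚᵘ.* ℚ.toℚᵘ (fromℤℚ b)  ≈⟨ ℚP.toℚᵘ-homo-* (fromℤℚ a) (fromℤℚ b) ⟨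
  ℚ.toℚᵘ (fromℤℚ a * fromℤℚ b)              ∎)
  where open ℚᵘP.≃-Reasoning

fromℤℚ-injective : ∀ {a b} → fromℤℚ a ≡ fromℤℚ b → a ≡ b
fromℤℚ-injective {a} {b} eq with ℚP.fromℚᵘ-injective {ℚᵘ.mkℚᵘ a 0} {ℚᵘ.mkℚᵘ b 0} eq
... | ℚᵘ.*≡* e = trans (sym (ℤP.*-identityʳ a)) (trans e (ℤP.*-identityʳ b))

invℤ-inverse : ∀ z → z ≢ ℤ.+ 0 → invℤ z * fromℤℚ z ≡ 1ℚ
invℤ-inverse (ℤ.+ zero) z≢0 = ⊥-elim (z≢0 refl)
invℤ-inverse z@(ℤ.+ suc k) _ = ℚP.toℚᵘ-injective (begin
  ℚ.toℚᵘ (invℤ z * fromℤℚ z)              ≈⟨ ℚP.toℚᵘ-homo-* (invℤ z) (fromℤℚ z) ⟩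
  ℚ.toℚᵘ (invℤ z) ℚᵘ.* ℚ.toℚᵘ (fromℤℚ z)  ≈⟨ ℚᵘP.*-cong (ℚP.toℚᵘ-fromℚᵘ (ℚᵘ.mkℚᵘ (ℤ.+ 1) k)) (ℚP.toℚᵘ-fromℚᵘ (ℚᵘ.mkℚᵘ z 0)) ⟩
  ℚᵘ.mkℚᵘ (ℤ.+ 1) k ℚᵘ.* ℚᵘ.mkℚᵘ z 0        ≈⟨ ℚᵘ.*≡* (trans (ℤP.*-identityʳ _) (cong (λ j → ℤ.+ 1 ℤ.* ℤ.+ j) (sym (ℕP.*-identityʳ (suc k))))) ⟩
  ℚᵘ.1ℚᵘ                                  ∎)
  where open ℚᵘP.≃-Reasoning
invℤ-inverse z@(-[1+ k ]) _ = ℚP.toℚᵘ-injective (begin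
  ℚ.toℚᵘ (invℤ z * fromℤℚ z)              ≈⟨ ℚP.toℚᵘ-homo-* (invℤ z) (fromℤℚ z) ⟩
  ℚ.toℚᵘ (invℤ z) ℚᵘ.* ℚ.toℚᵘ (fromℤℚ z)  ≈⟨ ℚᵘP.*-cong (ℚP.toℚᵘ-fromℚᵘ (ℚᵘ.mkℚᵘ (-[1+ 0 ]) k)) (ℚP.toℚᵘ-fromℚᵘ (ℚᵘ.mkℚᵘ z 0)) ⟩
  ℚᵘ.mkℚᵘ (-[1+ 0 ]) k ℚᵘ.* ℚᵘ.mkℚᵘ z 0   ≈⟨ ℚᵘ.*≡* (trans (ℤP.*-identityʳ _) (trans (ℤP.-1*i≡-i z)
                                              (trans (sym (ℤP.*-identityˡ _)) (cong (λ j → ℤ.+ 1 ℤ.* ℤ.+ j) (sym (ℕP.*-identityʳ (suc k))))))) ⟩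
  ℚᵘ.1ℚᵘ                                  ∎)
  where open ℚᵘP.≃-Reasoning

q*p≡0⇒p≡0 : ∀ q p → q ≢ 0ℚ → q * p ≡ 0ℚ → p ≡ 0ℚ
q*p≡0⇒p≡0 q p q≢0 eq = begin
  p                ≡⟨ ℚP.*-identityˡ p ⟨
  1ℚ * p           ≡⟨ cong (_* p) (ℚP.*-inverseˡ q) ⟨
  (ℚ.1/ q * q) * p ≡⟨ ℚP.*-assoc (ℚ.1/ q) q p ⟩
  ℚ.1/ q * (q * p) ≡⟨ cong (ℚ.1/ q *_) eq ⟩
  ℚ.1/ q * 0ℚ      ≡⟨ ℚP.*-zeroʳ (ℚ.1/ q) ⟩
  0ℚ               ∎
  where
  open ≡-Reasoning
  instance nz = ℚ.≢-nonZero q≢0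

∑ : ∀ {A : Set} → List A → (A → ℚ) → ℚ
∑ xs f = Σℚ (map f xs)

∑-cong : ∀ {A : Set} (xs : List A) {f g : A → ℚ} → (∀ {x} → x ∈ xs → f x ≡ g x) → ∑ xs f ≡ ∑ xs g
∑-cong []       eq = refl
∑-cong (x ∷ xs) eq = cong₂ _+_ (eq (here refl)) (∑-cong xs (eq ∘ there))

∑-zero : ∀ {A : Set} (xs : List A) {f : A → ℚ} → (∀ {x} → x ∈ xs → f x ≡ 0ℚ) → ∑ xs f ≡ 0ℚ
∑-zero []       eq = refl
∑-zero (x ∷ xs) eq = cong₂ _+_ (eq (here refl)) (∑-zero xs (eq ∘ there))

+-interchange : ∀ a b c d → (a + b) + (c + d) ≡ (a + c) + (b + d)
+-interchange = solve-∀ ℚ-ring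

∑-+ : ∀ {A : Set} (xs : List A) (f g : A → ℚ) → ∑ xs (λ x → f x + g x) ≡ ∑ xs f + ∑ xs g
∑-+ []       f g = refl
∑-+ (x ∷ xs) f g = trans (cong ((f x + g x) +_) (∑-+ xs f g)) (+-interchange (f x) (g x) (∑ xs f) (∑ xs g))

∑-*ˡ : ∀ {A : Set} (xs : List A) q (f : A → ℚ) → ∑ xs (λ x → q * f x) ≡ q * ∑ xs f
∑-*ˡ []       q f = sym (ℚP.*-zeroʳ q)
∑-*ˡ (x ∷ xs) q f = trans (cong (q * f x +_) (∑-*ˡ xs q f)) (sym (ℚP.*-distribˡ-+ q (f x) (∑ xs f)))

∑-*ʳ : ∀ {A : Set} (xs : List A) (f : A → ℚ) q → ∑ xs (λ x → f x * q) ≡ ∑ xs f * q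
∑-*ʳ xs f q = trans (∑-cong xs (λ {x} _ → ℚP.*-comm (f x) q)) (trans (∑-*ˡ xs q f) (ℚP.*-comm q (∑ xs f)))

∑-swap : ∀ {A B : Set} (xs : List A) (ys : List B) (f : A → B → ℚ) →
         ∑ xs (λ x → ∑ ys (f x)) ≡ ∑ ys (λ y → ∑ xs (λ x → f x y))
∑-swap []       ys f = sym (∑-zero ys (λ _ → refl))
∑-swap (x ∷ xs) ys f = trans (cong (∑ ys (f x) +_) (∑-swap xs ys f)) (sym (∑-+ ys (f x) _))

∑-++ : ∀ {A : Set} (xs ys : List A) (f : A → ℚ) → ∑ (xs ++ ys) f ≡ ∑ xs f + ∑ ys f
∑-++ []       ys f = sym (ℚP.+-identityˡ _)
∑-++ (x ∷ xs) ys f = trans (cong (f x +_) (∑-++ xs ys f)) (sym (ℚP.+-assoc (f x) _ _))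

∑-map : ∀ {A B : Set} (h : A → B) (xs : List A) (f : B → ℚ) → ∑ (map h xs) f ≡ ∑ xs (f ∘ h)
∑-map h []       f = refl
∑-map h (x ∷ xs) f = cong (f (h x) +_) (∑-map h xs f)

∑-concatMap : ∀ {A B : Set} (h : A → List B) (xs : List A) (f : B → ℚ) →
              ∑ (concatMap h xs) f ≡ ∑ xs (λ x → ∑ (h x) f)
∑-concatMap h []       f = refl
∑-concatMap h (x ∷ xs) f = trans (∑-++ (h x) _ f) (cong (∑ (h x) f +_) (∑-concatMap h xs f))

Σℚ≡∑ : ∀ (qs : List ℚ) → Σℚ qs ≡ ∑ qs (λ q → q)
Σℚ≡∑ []       = refl
Σℚ≡∑ (q ∷ qs) = cong (q +_) (Σℚ≡∑ qs)

-- Both `*ᴬ` and `characterSum` are a single `Σℚ` of a flattened list; this recovers the iterated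
-- sum.
Σℚ-concatMap : ∀ {A B : Set} (h : A → List B) (f : A → B → ℚ) (xs : List A) →
               Σℚ (concatMap (λ x → map (f x) (h x)) xs) ≡ ∑ xs (λ x → ∑ (h x) (f x))
Σℚ-concatMap h f xs = begin
  Σℚ (concatMap (λ x → map (f x) (h x)) xs)   ≡⟨ Σℚ≡∑ (concatMap (λ x → map (f x) (h x)) xs) ⟩
  ∑ (concatMap (λ x → map (f x) (h x)) xs) _  ≡⟨ ∑-concatMap _ xs _ ⟩
  ∑ xs (λ x → ∑ (map (f x) (h x)) (λ q → q))  ≡⟨ ∑-cong xs (λ {x} _ → sym (Σℚ≡∑ (map (f x) (h x)))) ⟩
  ∑ xs (λ x → ∑ (h x) (f x))                  ∎
  where open ≡-Reasoning

∑-filterᵇ : ∀ {A : Set} (p : A → Bool) (xs : List A) (f : A → ℚ) →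
            ∑ (filterᵇ p xs) f ≡ ∑ xs (λ x → if p x then f x else 0ℚ)
∑-filterᵇ p []       f = refl
∑-filterᵇ p (x ∷ xs) f with p x
... | true  = cong (f x +_) (∑-filterᵇ p xs f)
... | false = trans (∑-filterᵇ p xs f) (sym (ℚP.+-identityˡ _))

∑-single : ∀ {A : Set} {xs : List A} {y} (f : A → ℚ) → Unique xs → y ∈ xs →
           (∀ {x} → x ∈ xs → x ≢ y → f x ≡ 0ℚ) → ∑ xs f ≡ f y
∑-single {xs = x ∷ xs} f (x∉ ∷ u) (here refl) z =
  trans (cong (f x +_) (∑-zero xs (λ {x′} x′∈ → z (there x′∈) (λ eq → All.lookup x∉ x′∈ (sym eq))))) (ℚP.+-identityʳ (f x))
∑-single {xs = x ∷ xs} {y} f (x∉ ∷ u) (there y∈) z =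
  trans (cong₂ _+_ (z (here refl) (All.lookup x∉ y∈)) (∑-single f u y∈ (z ∘ there))) (ℚP.+-identityˡ (f y))

∑-↭ : ∀ {A : Set} {xs ys : List A} (f : A → ℚ) → xs ↭ ys → ∑ xs f ≡ ∑ ys f
∑-↭ f ↭.refl = refl
∑-↭ f (↭.prep x p) = cong (f x +_) (∑-↭ f p)
∑-↭ f (↭.swap {xs} {ys} x y p) = trans (cong (λ s → f x + (f y + s)) (∑-↭ f p)) (flip+ (f x) (f y) (∑ ys f))
  where
  flip+ : ∀ a b c → a + (b + c) ≡ b + (a + c)
  flip+ = solve-∀ ℚ-ring
∑-↭ f (↭.trans p q) = trans (∑-↭ f p) (∑-↭ f q)

-- Joint eigenvectors of the Jucys–Murphy operators

module _ {I : Set} where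

  Vect : Set
  Vect = I → ℚ

  infix 4 _≈_
  _≈_ : Vect → Vect → Set
  u ≈ v = ∀ π → u π ≡ v π

  lin : ℚ → Vect → ℚ → Vect → Vect
  lin a u b v π = a * u π + b * v π

  record Linear (F : Vect → Vect) : Set where
    field
      respects : ∀ {u v} → u ≈ v → F u ≈ F v
      on-lin   : ∀ a u b v → F (lin a u b v) ≈ lin a (F u) b (F v)

    on-0 : ∀ {u} → (∀ π → u π ≡ 0ℚ) → ∀ π → F u π ≡ 0ℚ
    on-0 {u} z π = trans (respects (λ ρ → trans (z ρ) (sym (0-lin (u ρ) (u ρ)))) π)
                         (trans (on-lin 0ℚ u 0ℚ u π) (0-lin (F u π) (F u π)))
      where
      0-lin : ∀ p q → 0ℚ * p + 0ℚ * q ≡ 0ℚ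
      0-lin = solve-∀ ℚ-ring

    on-+ : ∀ u v {w} → (∀ π → w π ≡ u π + v π) → ∀ π → F w π ≡ F u π + F v π
    on-+ u v w≡ π = trans (respects (λ ρ → trans (w≡ ρ) (1-lin (u ρ) (v ρ))) π)
                          (trans (on-lin 1ℚ u 1ℚ v π) (sym (1-lin (F u π) (F v π))))
      where
      1-lin : ∀ p q → p + q ≡ 1ℚ * p + 1ℚ * q
      1-lin = solve-∀ ℚ-ring

    on-scalar : ∀ q u {w} → (∀ π → w π ≡ q * u π) → ∀ π → F w π ≡ q * F u π
    on-scalar q u w≡ π = trans (respects (λ ρ → trans (w≡ ρ) (q-lin q (u ρ))) π)
                               (trans (on-lin q u 0ℚ u π) (sym (q-lin q (F u π))))
      where
      q-lin : ∀ q p → q * p ≡ q * p + 0ℚ * p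
      q-lin = solve-∀ ℚ-ring

    on-∑ : ∀ {A : Set} (xs : List A) (f : A → Vect) π →
           F (λ ρ → ∑ xs (λ x → f x ρ)) π ≡ ∑ xs (λ x → F (f x) π)
    on-∑ []       f π = on-0 (λ _ → refl) π
    on-∑ (x ∷ xs) f π = trans (on-+ (f x) (λ ρ → ∑ xs (λ x → f x ρ)) (λ _ → refl) π)
                              (cong (F (f x) π +_) (on-∑ xs f π))

  open Linear public

  ∘-linear : ∀ {F G} → Linear F → Linear G → Linear (F ∘ G)
  ∘-linear F G = record
    { respects = respects F ∘ respects G
    ; on-lin = λ a u b v π → trans (respects F (on-lin G a u b v) π) (on-lin F a _ b _ π) }

  lin-linear : ∀ p {F} q {G} → Linear F → Linear G → Linear (λ u → lin p (F u) q (G u))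
  lin-linear p {F} q {G} lF lG = record
    { respects = λ eq π → cong₂ (λ x y → p * x + q * y) (respects lF eq π) (respects lG eq π)
    ; on-lin = λ a u b v π → trans (cong₂ (λ x y → p * x + q * y) (on-lin lF a u b v π) (on-lin lG a u b v π))
                                   (exchange p q a b (F u π) (F v π) (G u π) (G v π)) }
    where
    exchange : ∀ p q a b x y z w →
               p * (a * x + b * y) + q * (a * z + b * w) ≡ a * (p * x + q * z) + b * (p * y + q * w)
    exchange = solve-∀ ℚ-ring

  id-linear : Linear (λ u → u)
  id-linear = record { respects = λ eq → eq ; on-lin = λ _ _ _ _ _ → refl }

  -- The eigenvalue analysis sees the operators through these relations alone. `X-S` and `S-S`
  -- determine `X (suc k)` from `X k`. `semisimple` is the form in which self-adjointness is used: a
  -- vector killed by the square of `X k − b` is killed by `X k − b`.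
  record JucysMurphy (n : ℕ) (X S : ℕ → Vect → Vect) : Set where
    field
      X-linear : ∀ k → Linear (X k)
      S-linear : ∀ k → Linear (S k)
      X-zero   : ∀ u π → X 0 u π ≡ 0ℚ
      S-S      : ∀ {k} → suc k < n → ∀ u → S k (S k u) ≈ u
      X-S      : ∀ {k} → suc k < n → ∀ u π → X (suc k) (S k u) π ≡ S k (X k u) π + u π
      S-X      : ∀ {k j} → suc k < n → j < n → j ≢ k → j ≢ suc k → ∀ u → S k (X j u) ≈ X j (S k u)
      braid    : ∀ {k} → suc (suc k) < n → ∀ u →
                 S k (S (suc k) (S k u)) ≈ S (suc k) (S k (S (suc k) u))
      semisimple : ∀ {k} → k < n → ∀ b u → X k (lin 1ℚ (X k u) (- b) u) ≈ (λ π → b * lin 1ℚ (X k u) (- b) u π) →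
                   ∀ π → X k u π ≡ b * u π

  module JM {n : ℕ} {X S : ℕ → Vect → Vect} (jm : JucysMurphy n X S) where
    open JucysMurphy jm public

    Commutes : (F G : Vect → Vect) → Set
    Commutes F G = ∀ u → F (G u) ≈ G (F u)

    X-suc : ∀ {k} → suc k < n → ∀ u π → X (suc k) u π ≡ S k (X k (S k u)) π + S k u π
    X-suc {k} k< u π = trans (respects (X-linear (suc k)) (λ ρ → sym (S-S k< u ρ)) π) (X-S k< (S k u) π)

    S-Xsuc : ∀ {k} → suc k < n → ∀ u π → S k (X (suc k) u) π ≡ X k (S k u) π + u π
    S-Xsuc {k} k< u π = trans (on-+ (S-linear k) (S k (X k (S k u))) (S k u) (X-suc k< u) π)
                              (cong₂ _+_ (S-S k< (X k (S k u)) π) (S-S k< u π))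

    -- Induction on `i`: by `X-suc`, `X (suc i)` is built from `X i` and `S i`, and `S i` commutes
    -- with `X j` because `j` is neither `i` nor `suc i`.
    X-X-< : ∀ {i j} → i < j → j < n → Commutes (X i) (X j)
    X-X-< {zero} {j} i<j j<n u π = trans (X-zero _ π) (sym (on-0 (X-linear j) (X-zero u) π))
    X-X-< {suc i} {j} i<j j<n u π = begin
      X (suc i) (X j u) π                              ≡⟨ X-suc si<n (X j u) π ⟩
      S i (X i (S i (X j u))) π + S i (X j u) π        ≡⟨ cong₂ _+_ (trans (respects (S-linear i) (λ ρ → trans (respects (X-linear i) (sx u) ρ) (X-X-< (ℕP.<-trans (ℕP.n<1+n i) i<j) j<n (S i u) ρ)) π) (sx (X i (S i u)) π)) (sx u π) ⟩
      X j (S i (X i (S i u))) π + X j (S i u) π        ≡⟨ on-+ (X-linear j) _ _ (X-suc si<n u) π ⟨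
      X j (X (suc i) u) π                              ∎
      where
      open ≡-Reasoning
      si<n : suc i < n
      si<n = ℕP.<-trans i<j j<n
      sx : ∀ w → S i (X j w) ≈ X j (S i w)
      sx = S-X si<n j<n (λ e → ℕP.<⇒≢ (ℕP.<-trans (ℕP.n<1+n i) i<j) (sym e)) (λ e → ℕP.<⇒≢ i<j (sym e))

    X-X : ∀ {i j} → i < n → j < n → Commutes (X i) (X j)
    X-X {i} {j} i<n j<n u π with ℕP.<-cmp i j
    ... | tri< i<j _ _  = X-X-< i<j j<n u π
    ... | tri≈ _ refl _ = refl
    ... | tri> _ _ j<i  = sym (X-X-< j<i i<n u π)

    record Eig (k : ℕ) (c : ℤ) (u : Vect) : Set where
      constructor eig
      field at : ∀ π → X k u π ≡ fromℤℚ c * u π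

    open Eig public

    Eig-resp : ∀ {k c u v} → u ≈ v → Eig k c u → Eig k c v
    Eig-resp {k} {c} eq e = eig λ π →
      trans (respects (X-linear k) (λ ρ → sym (eq ρ)) π) (trans (at e π) (cong (fromℤℚ c *_) (eq π)))

    Eig-op : ∀ {k c F u} → Linear F → (∀ v → F (X k v) ≈ X k (F v)) → Eig k c u → Eig k c (F u)
    Eig-op {k} {c} {F} {u} lF comm e = eig λ π → trans (sym (comm u π)) (on-scalar lF (fromℤℚ c) u (at e) π)

    Eig-lin : ∀ {k c u v} a b → Eig k c u → Eig k c v → Eig k c (lin a u b v)
    Eig-lin {k} {c} {u} {v} a b eu ev = eig λ π →
      trans (on-lin (X-linear k) a u b v π)
            (trans (cong₂ (λ x y → a * x + b * y) (at eu π) (at ev π)) (pull a b (fromℤℚ c) (u π) (v π)))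
      where
      pull : ∀ a b c x y → a * (c * x) + b * (c * y) ≡ c * (a * x + b * y)
      pull = solve-∀ ℚ-ring

    -- Joint eigenvectors of X k, X (suc k), … with the listed eigenvalues.
    data JE (k : ℕ) : List ℤ → Vect → Set where
      []  : ∀ {u} → JE k [] u
      _∷_ : ∀ {c cs u} → Eig k c u → JE (suc k) cs u → JE k (c ∷ cs) u

    JE-resp : ∀ {k} cs {u v} → u ≈ v → JE k cs u → JE k cs v
    JE-resp []       eq []       = []
    JE-resp (c ∷ cs) eq (e ∷ es) = Eig-resp eq e ∷ JE-resp cs eq es

    JE-lin : ∀ {k} cs {u v} a b → JE k cs u → JE k cs v → JE k cs (lin a u b v)
    JE-lin []       a b []       []       = []
    JE-lin (c ∷ cs) a b (e ∷ es) (f ∷ fs) = Eig-lin a b e f ∷ JE-lin cs a b es fs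

    JE-op : ∀ {k} cs {F u} → Linear F →
            (∀ j → k ≤ j → j < k ℕ.+ length cs → ∀ v → F (X j v) ≈ X j (F v)) → JE k cs u → JE k cs (F u)
    JE-op []           lF comm []       = []
    JE-op {k} (c ∷ cs) lF comm (e ∷ es) =
      Eig-op lF (comm k ℕP.≤-refl (subst (k <_) (sym (ℕP.+-suc k (length cs))) (s≤s (ℕP.m≤m+n k (length cs))))) e ∷
      JE-op cs lF (λ j sk≤j j< → comm j (ℕP.≤-trans (ℕP.n≤1+n k) sk≤j) (subst (j <_) (sym (ℕP.+-suc k (length cs))) j<)) es

    JE-++⁻ : ∀ {k} α {β u} → JE k (α ++ β) u → JE k α u × JE (k ℕ.+ length α) β u
    JE-++⁻ {k} []      {β} {u} es       = [] , subst (λ j → JE j β u) (sym (ℕP.+-identityʳ k)) es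
    JE-++⁻ {k} (c ∷ α) {β} {u} (e ∷ es) with JE-++⁻ α es
    ... | es₁ , es₂ = (e ∷ es₁) , subst (λ j → JE j β u) (sym (ℕP.+-suc k (length α))) es₂

    JE-++⁺ : ∀ {k} α {β u} → JE k α u → JE (k ℕ.+ length α) β u → JE k (α ++ β) u
    JE-++⁺ {k} []      {β} {u} []       fs = subst (λ j → JE j β u) (ℕP.+-identityʳ k) fs
    JE-++⁺ {k} (c ∷ α) {β} {u} (e ∷ es) fs = e ∷ JE-++⁺ α es (subst (λ j → JE j β u) (ℕP.+-suc k (length α)) fs)

    -- The intertwiner `S_k (X_k − X_{k+1}) + 1` of the degenerate affine Hecke algebra, with the
    -- eigenvalues of `u` already substituted for the two operators.
    intertwine : ℕ → ℤ → ℤ → Vect → Vect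
    intertwine k b d u = lin (fromℤℚ b - fromℤℚ d) (S k u) 1ℚ u

    module _ {k b d u} (k< : suc k < n) (eb : Eig k b u) (ed : Eig (suc k) d u) where
      private
        B = fromℤℚ b
        D = fromℤℚ d

      X-on-S : ∀ π → X k (S k u) π ≡ D * S k u π - u π
      X-on-S π = begin
        X k (S k u) π                      ≡⟨ cancel (X k (S k u) π) (u π) ⟩
        (X k (S k u) π + u π) - u π        ≡⟨ cong (_- u π) (S-Xsuc k< u π) ⟨
        S k (X (suc k) u) π - u π          ≡⟨ cong (_- u π) (on-scalar (S-linear k) D u (at ed) π) ⟩
        D * S k u π - u π                  ∎
        where
        open ≡-Reasoning
        cancel : ∀ p q → p ≡ (p + q) - q
        cancel = solve-∀ ℚ-ring

      intertwine-Eig : Eig k d (intertwine k b d u)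
      intertwine-Eig = eig λ π →
        trans (on-lin (X-linear k) (B - D) (S k u) 1ℚ u π)
              (trans (cong₂ (λ x y → (B - D) * x + 1ℚ * y) (X-on-S π) (at eb π)) (ident B D (S k u π) (u π)))
        where
        ident : ∀ b d s u → (b - d) * (d * s - u) + 1ℚ * (b * u) ≡ d * ((b - d) * s + 1ℚ * u)
        ident = solve-∀ ℚ-ring

      intertwine-Eig′ : Eig (suc k) b (intertwine k b d u)
      intertwine-Eig′ = eig λ π →
        trans (on-lin (X-linear (suc k)) (B - D) (S k u) 1ℚ u π)
              (trans (cong₂ (λ x y → (B - D) * x + 1ℚ * y) (trans (X-S k< u π) (cong (_+ u π) (on-scalar (S-linear k) B u (at eb) π))) (at ed π))
                     (ident B D (S k u π) (u π)))
        where
        ident : ∀ b d s u → (b - d) * (b * s + u) + 1ℚ * (d * u) ≡ b * ((b - d) * s + 1ℚ * u)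
        ident = solve-∀ ℚ-ring

    length-split : ∀ (α : List ℤ) {b d β} → length (α ++ b ∷ d ∷ β) ≡ suc (suc (length α)) ℕ.+ length β
    length-split α {β = β} = trans (LP.length-++ α) (trans (ℕP.+-suc (length α) (suc (length β))) (cong suc (ℕP.+-suc (length α) (length β))))

    1+k<n : ∀ (α : List ℤ) {b d β} → length (α ++ b ∷ d ∷ β) ≤ n → suc (length α) < n
    1+k<n α {β = β} len = ℕP.≤-trans (ℕP.m≤m+n (suc (suc (length α))) (length β)) (subst (_≤ n) (length-split α) len)

    -- Away from the places `k` and `suc k` every `X j` commutes with `S k`, so the eigenvalues in
    -- `α` and `β` survive.
    JE-swap : ∀ {k} α {b d β u} → length α ≡ k → length (α ++ b ∷ d ∷ β) ≤ n →
              JE 0 (α ++ b ∷ d ∷ β) u → JE 0 (α ++ d ∷ b ∷ β) (intertwine k b d u)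
    JE-swap α {b} {d} {β} {u} refl len es with JE-++⁻ α es
    ... | es₁ , eb ∷ ed ∷ es₂ =
      JE-++⁺ α (op α (λ j _ j<k → S-X k< (ℕP.<-trans j<k (ℕP.<-trans (ℕP.n<1+n _) k<)) (ℕP.<⇒≢ j<k) (ℕP.<⇒≢ (ℕP.<-trans j<k (ℕP.n<1+n _)))) es₁)
        (intertwine-Eig k< eb ed ∷ intertwine-Eig′ k< eb ed ∷
         op β (λ j k+2≤j j< → S-X k< (ℕP.<-≤-trans j< len′) (λ e → ℕP.<⇒≢ (ℕP.<-trans (ℕP.n<1+n _) k+2≤j) (sym e)) (λ e → ℕP.<⇒≢ k+2≤j (sym e))) es₂)
      where
      k = length α
      len′ : suc (suc k) ℕ.+ length β ≤ n
      len′ = subst (_≤ n) (length-split α) len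
      k< : suc k < n
      k< = 1+k<n α len
      op : ∀ {l} cs → (∀ j → l ≤ j → j < l ℕ.+ length cs → ∀ v → S k (X j v) ≈ X j (S k v)) →
           JE l cs u → JE l cs (intertwine k b d u)
      op cs comm es = JE-lin cs (fromℤℚ b - fromℤℚ d) 1ℚ (JE-op cs (S-linear k) comm es) es

    -- Eigenvalue lists that admit only the zero vector

    Vanishes : List ℤ → Set
    Vanishes cs = length cs ≤ n → ∀ u → JE 0 cs u → ∀ π → u π ≡ 0ℚ

    length-swap : ∀ (α : List ℤ) {b d b′ d′ β} → length (α ++ b ∷ d ∷ β) ≡ length (α ++ b′ ∷ d′ ∷ β)
    length-swap α = trans (length-split α) (sym (length-split α))

    -- With `e = b − d` one has `(e S_k − 1)(e S_k + 1) = e² − 1`, so a vector killed by the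
    -- intertwiner is itself zero as soon as `e² ≠ 1`.
    Vanishes-swap : ∀ α {b d β} → (b ℤ.- d) ℤ.* (b ℤ.- d) ≢ ℤ.+ 1 →
                    Vanishes (α ++ d ∷ b ∷ β) → Vanishes (α ++ b ∷ d ∷ β)
    Vanishes-swap α {b} {d} {β} e²≢1 van len u es π =
      q*p≡0⇒p≡0 (e * e - 1ℚ) (u π) e²-1≢0 (begin
        (e * e - 1ℚ) * u π                                    ≡⟨ ident e (S k u π) (u π) ⟩
        e * (e * u π + 1ℚ * S k u π) - (e * S k u π + 1ℚ * u π)   ≡⟨ cong₂ (λ x y → e * x - y) Szero (zero′ π) ⟩
        e * 0ℚ - 0ℚ                                           ≡⟨ z e ⟩
        0ℚ                                                    ∎)
      where
      open ≡-Reasoning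
      k = length α
      e = fromℤℚ b - fromℤℚ d
      zero′ : ∀ ρ → intertwine k b d u ρ ≡ 0ℚ
      zero′ = van (subst (_≤ n) (length-swap α) len) _ (JE-swap α refl len es)
      Szero : e * u π + 1ℚ * S k u π ≡ 0ℚ
      Szero = trans (cong (λ x → e * x + 1ℚ * S k u π) (sym (S-S (1+k<n α len) u π)))
                    (trans (sym (on-lin (S-linear k) e (S k u) 1ℚ u π)) (on-0 (S-linear k) zero′ π))
      ident : ∀ e s u → (e * e - 1ℚ) * u ≡ e * (e * u + 1ℚ * s) - (e * s + 1ℚ * u)
      ident = solve-∀ ℚ-ring
      z : ∀ e → e * 0ℚ - 0ℚ ≡ 0ℚ
      z = solve-∀ ℚ-ring
      unsub : ∀ x → x ≡ (x - 1ℚ) + 1ℚ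
      unsub = solve-∀ ℚ-ring
      e²-1≢0 : e * e - 1ℚ ≢ 0ℚ
      e²-1≢0 h = e²≢1 (fromℤℚ-injective (trans (fromℤℚ-* (b ℤ.- d) (b ℤ.- d))
                   (trans (cong₂ _*_ (fromℤℚ-− b d) (fromℤℚ-− b d)) (trans (unsub (e * e)) (cong (_+ 1ℚ) h)))))

    -- On such a vector (X k − b)² kills S k u but X k − b does not, against semisimplicity.
    Vanishes-equal : ∀ α {b β} → Vanishes (α ++ b ∷ b ∷ β)
    Vanishes-equal α {b} {β} len u es π with JE-++⁻ α es
    ... | _ , eb ∷ eb′ ∷ _ = begin
      u π                                    ≡⟨ ident B (S k u π) (u π) ⟩
      B * S k u π - (B * S k u π - u π)      ≡⟨ cong (λ x → B * S k u π - x) (trans (sym (XS π)) (semisimple k<n B (S k u) killed π)) ⟩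
      B * S k u π - B * S k u π              ≡⟨ ℚP.+-inverseʳ (B * S k u π) ⟩
      0ℚ                                     ∎
      where
      open ≡-Reasoning
      k = length α
      B = fromℤℚ b
      k< : suc k < n
      k< = 1+k<n α len
      k<n : k < n
      k<n = ℕP.<-trans (ℕP.n<1+n k) k<
      XS : ∀ ρ → X k (S k u) ρ ≡ B * S k u ρ - u ρ
      XS = X-on-S k< eb eb′
      ident : ∀ b s u → u ≡ b * s - (b * s - u)
      ident = solve-∀ ℚ-ring
      neg : ∀ ρ → lin 1ℚ (X k (S k u)) (- B) (S k u) ρ ≡ (- 1ℚ) * u ρ
      neg ρ = trans (cong (λ x → 1ℚ * x + (- B) * S k u ρ) (XS ρ)) (id₂ B (S k u ρ) (u ρ))
        where
        id₂ : ∀ b s u → 1ℚ * (b * s - u) + (- b) * s ≡ (- 1ℚ) * u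
        id₂ = solve-∀ ℚ-ring
      killed : ∀ ρ → X k (lin 1ℚ (X k (S k u)) (- B) (S k u)) ρ ≡ B * lin 1ℚ (X k (S k u)) (- B) (S k u) ρ
      killed ρ = trans (on-scalar (X-linear k) (- 1ℚ) u neg ρ)
                       (trans (cong ((- 1ℚ) *_) (at eb ρ)) (trans (flip′ B (u ρ)) (cong (B *_) (sym (neg ρ)))))
        where
        flip′ : ∀ b u → (- 1ℚ) * (b * u) ≡ b * ((- 1ℚ) * u)
        flip′ = solve-∀ ℚ-ring

    -- S k and S (suc k) act on such a vector by opposite signs, against the braid relation.
    Vanishes-braid : ∀ α {b a β} → (b ℤ.- a) ℤ.* (b ℤ.- a) ≡ ℤ.+ 1 → Vanishes (α ++ b ∷ a ∷ b ∷ β)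
    Vanishes-braid α {b} {a} {β} e²≡1 len u es π = begin
      u π                                  ≡⟨ double (u π) ⟩
      ½ * (1ℚ * u π + 1ℚ * u π)            ≡⟨ cong (λ x → ½ * (x * u π + x * u π)) ee ⟨
      ½ * ((e * e) * u π + (e * e) * u π)  ≡⟨ ident e (u π) ⟩
      ½ * e * (e * u π - (- e) * u π)      ≡⟨ cong₂ (λ x y → ½ * e * (x - y)) (sym lhs) (sym rhs) ⟩
      ½ * e * (S k (S (suc k) (S k u)) π - S (suc k) (S k (S (suc k) u)) π) ≡⟨ cong (λ x → ½ * e * (x - S (suc k) (S k (S (suc k) u)) π)) (braid k<< u π) ⟩
      ½ * e * (S (suc k) (S k (S (suc k) u)) π - S (suc k) (S k (S (suc k) u)) π) ≡⟨ z e (S (suc k) (S k (S (suc k) u)) π) ⟩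
      0ℚ ∎
      where
      open ≡-Reasoning
      k = length α
      e = fromℤℚ b - fromℤℚ a
      double : ∀ u → u ≡ ½ * (1ℚ * u + 1ℚ * u)
      double = solve-∀ ℚ-ring
      ident : ∀ e u → ½ * ((e * e) * u + (e * e) * u) ≡ ½ * e * (e * u - (- e) * u)
      ident = solve-∀ ℚ-ring
      z : ∀ e x → ½ * e * (x - x) ≡ 0ℚ
      z = solve-∀ ℚ-ring
      ee : e * e ≡ 1ℚ
      ee = trans (sym (trans (fromℤℚ-* (b ℤ.- a) (b ℤ.- a)) (cong₂ _*_ (fromℤℚ-− b a) (fromℤℚ-− b a)))) (cong fromℤℚ e²≡1)
      len-snoc : length (α ++ [ b ]) ≡ suc k
      len-snoc = trans (LP.length-++ α) (ℕP.+-comm k 1)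
      assoc : ∀ x γ → (α ++ [ x ]) ++ γ ≡ α ++ x ∷ γ
      assoc x γ = LP.++-assoc α [ x ] γ
      len₁ : length ((α ++ [ b ]) ++ a ∷ b ∷ β) ≤ n
      len₁ = subst (λ l → length l ≤ n) (sym (assoc b _)) len
      k<< : suc (suc k) < n
      k<< = subst (λ l → suc l < n) len-snoc (1+k<n (α ++ [ b ]) len₁)
      k< : suc k < n
      k< = ℕP.<-trans (ℕP.n<1+n _) k<<
      -- Exchanging the first two of `b`, `a`, `b` leaves the equal neighbours `b`, `b`; exchanging
      -- the last two, in `zero₂`, does the same.
      zero₁ : ∀ ρ → intertwine k b a u ρ ≡ 0ℚ
      zero₁ = Vanishes-equal (α ++ [ a ])
                (subst (λ l → length l ≤ n) (sym (assoc a _)) (subst (_≤ n) (length-swap α) len)) _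
                (subst (λ l → JE 0 l _) (sym (assoc a _)) (JE-swap α refl len es))
      zero₂ : ∀ ρ → intertwine (suc k) a b u ρ ≡ 0ℚ
      zero₂ = Vanishes-equal α {β = a ∷ β} (subst (λ l → length l ≤ n) (assoc b _) (subst (_≤ n) (length-swap (α ++ [ b ])) len₁)) _
                (subst (λ l → JE 0 l (intertwine (suc k) a b u)) (assoc b _)
                  (JE-swap (α ++ [ b ]) len-snoc len₁ (subst (λ l → JE 0 l u) (sym (assoc b _)) es)))
      S₁ : ∀ ρ → S k u ρ ≡ (- e) * u ρ
      S₁ ρ = begin
        S k u ρ                                       ≡⟨ i₁ (S k u ρ) ⟩
        1ℚ * S k u ρ                                  ≡⟨ cong (_* S k u ρ) ee ⟨
        (e * e) * S k u ρ                             ≡⟨ i₂ e (S k u ρ) (u ρ) ⟩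
        e * (e * S k u ρ + 1ℚ * u ρ) + (- e) * u ρ    ≡⟨ cong (λ x → e * x + (- e) * u ρ) (zero₁ ρ) ⟩
        e * 0ℚ + (- e) * u ρ                          ≡⟨ i₃ e (u ρ) ⟩
        (- e) * u ρ                                   ∎
        where
        i₁ : ∀ s → s ≡ 1ℚ * s
        i₁ = solve-∀ ℚ-ring
        i₂ : ∀ e s u → (e * e) * s ≡ e * (e * s + 1ℚ * u) + (- e) * u
        i₂ = solve-∀ ℚ-ring
        i₃ : ∀ e u → e * 0ℚ + (- e) * u ≡ (- e) * u
        i₃ = solve-∀ ℚ-ring
      S₂ : ∀ ρ → S (suc k) u ρ ≡ e * u ρ
      S₂ ρ = begin
        S (suc k) u ρ                                 ≡⟨ i₁ (S (suc k) u ρ) ⟩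
        1ℚ * S (suc k) u ρ                            ≡⟨ cong (_* S (suc k) u ρ) ee ⟨
        (e * e) * S (suc k) u ρ                       ≡⟨ i₂ (fromℤℚ b) (fromℤℚ a) (S (suc k) u ρ) (u ρ) ⟩
        (- e) * ((fromℤℚ a - fromℤℚ b) * S (suc k) u ρ + 1ℚ * u ρ) + e * u ρ ≡⟨ cong (λ x → (- e) * x + e * u ρ) (zero₂ ρ) ⟩
        (- e) * 0ℚ + e * u ρ                          ≡⟨ i₃ e (u ρ) ⟩
        e * u ρ                                       ∎
        where
        i₁ : ∀ s → s ≡ 1ℚ * s
        i₁ = solve-∀ ℚ-ring
        i₂ : ∀ b a s u → ((b - a) * (b - a)) * s ≡ (- (b - a)) * ((a - b) * s + 1ℚ * u) + (b - a) * u
        i₂ = solve-∀ ℚ-ring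
        i₃ : ∀ e u → (- e) * 0ℚ + e * u ≡ e * u
        i₃ = solve-∀ ℚ-ring
      lhs : S k (S (suc k) (S k u)) π ≡ e * u π
      lhs = begin
        S k (S (suc k) (S k u)) π    ≡⟨ respects (S-linear k) (on-scalar (S-linear (suc k)) (- e) u S₁) π ⟩
        S k (λ ρ → (- e) * S (suc k) u ρ) π ≡⟨ on-scalar (S-linear k) (- e) (S (suc k) u) (λ _ → refl) π ⟩
        (- e) * S k (S (suc k) u) π  ≡⟨ cong ((- e) *_) (on-scalar (S-linear k) e u S₂ π) ⟩
        (- e) * (e * S k u π)        ≡⟨ cong (λ x → (- e) * (e * x)) (S₁ π) ⟩
        (- e) * (e * ((- e) * u π))  ≡⟨ j₁ e (u π) ⟩
        (e * e) * (e * u π)          ≡⟨ cong (_* (e * u π)) ee ⟩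
        1ℚ * (e * u π)               ≡⟨ ℚP.*-identityˡ _ ⟩
        e * u π                      ∎
        where
        j₁ : ∀ e u → (- e) * (e * ((- e) * u)) ≡ (e * e) * (e * u)
        j₁ = solve-∀ ℚ-ring
      rhs : S (suc k) (S k (S (suc k) u)) π ≡ (- e) * u π
      rhs = begin
        S (suc k) (S k (S (suc k) u)) π     ≡⟨ respects (S-linear (suc k)) (on-scalar (S-linear k) e u S₂) π ⟩
        S (suc k) (λ ρ → e * S k u ρ) π     ≡⟨ on-scalar (S-linear (suc k)) e (S k u) (λ _ → refl) π ⟩
        e * S (suc k) (S k u) π             ≡⟨ cong (e *_) (on-scalar (S-linear (suc k)) (- e) u S₁ π) ⟩
        e * ((- e) * S (suc k) u π)         ≡⟨ cong (λ x → e * ((- e) * x)) (S₂ π) ⟩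
        e * ((- e) * (e * u π))             ≡⟨ j₁ e (u π) ⟩
        (e * e) * ((- e) * u π)             ≡⟨ cong (_* ((- e) * u π)) ee ⟩
        1ℚ * ((- e) * u π)                  ≡⟨ ℚP.*-identityˡ _ ⟩
        (- e) * u π                         ∎
        where
        j₁ : ∀ e u → e * ((- e) * (e * u)) ≡ (e * e) * ((- e) * u)
        j₁ = solve-∀ ℚ-ring

-- Lagrange projections and the splitting of an eigenvector

∈-filterᵇ⁺ : ∀ {A : Set} (p : A → Bool) {x xs} → x ∈ xs → T (p x) → x ∈ filterᵇ p xs
∈-filterᵇ⁺ p = ∈-filter⁺ (λ x → T? (p x))

∈-filterᵇ⁻ : ∀ {A : Set} (p : A → Bool) {x} xs → x ∈ filterᵇ p xs → x ∈ xs × T (p x)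
∈-filterᵇ⁻ p xs = ∈-filter⁻ (λ x → T? (p x)) {xs = xs}

≢⇒T-not-≡ᵇ : ∀ m n → m ≢ n → T (not (m ≡ᵇ n))
≢⇒T-not-≡ᵇ m n m≢n with m ≡ᵇ n in eq
... | true  = m≢n (ℕP.≡ᵇ⇒≡ m n (subst T (sym eq) tt))
... | false = tt

T-not-≡ᵇ⇒≢ : ∀ m n → T (not (m ≡ᵇ n)) → m ≢ n
T-not-≡ᵇ⇒≢ m n t refl with m ≡ᵇ m in eq
... | true  = t
... | false = subst T eq (ℕP.≡⇒≡ᵇ m m refl)

∑-split : ∀ {R : List ℕ} {r} (f : ℕ → ℚ) → Unique R → r ∈ R →
          ∑ R f ≡ f r + ∑ (filterᵇ (λ r′ → not (r′ ≡ᵇ r)) R) f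
∑-split {R} {r} f u r∈ = begin
  ∑ R f                                   ≡⟨ ∑-cong R (λ {x} _ → case x) ⟩
  ∑ R (λ x → is x + isn′t x)              ≡⟨ ∑-+ R is isn′t ⟩
  ∑ R is + ∑ R isn′t                      ≡⟨ cong₂ _+_ (trans (∑-single is u r∈ (λ {x} _ → off x)) diag) (sym (∑-filterᵇ (λ r′ → not (r′ ≡ᵇ r)) R f)) ⟩
  f r + ∑ (filterᵇ (λ r′ → not (r′ ≡ᵇ r)) R) f ∎
  where
  open ≡-Reasoning
  is isn′t : ℕ → ℚ
  is x = if x ≡ᵇ r then f x else 0ℚ
  isn′t x = if not (x ≡ᵇ r) then f x else 0ℚ
  case : ∀ x → f x ≡ is x + isn′t x
  case x with x ≡ᵇ r
  ... | true  = sym (ℚP.+-identityʳ (f x))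
  ... | false = sym (ℚP.+-identityˡ (f x))
  off : ∀ x → x ≢ r → is x ≡ 0ℚ
  off x x≢r with x ≡ᵇ r | ≢⇒T-not-≡ᵇ x r x≢r
  ... | false | _ = refl
  diag : is r ≡ f r
  diag with r ≡ᵇ r | ℕP.≡⇒≡ᵇ r r refl
  ... | true | _ = refl

module Lagrange {I : Set} {n : ℕ} {X S : ℕ → Vect {I} → Vect} (jm : JucysMurphy n X S) where
  open JM jm

  -- The Lagrange interpolation product of the operators `(X_k − c′)/(c − c′)` over the listed `c′`.
  lag : ℕ → ℤ → List ℤ → Vect → Vect
  lag k c []        u = u
  lag k c (c′ ∷ cs) u =
    lin (invℤ (c ℤ.- c′)) (X k (lag k c cs u)) (invℤ (c ℤ.- c′) * (- fromℤℚ c′)) (lag k c cs u)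

  lag-linear : ∀ k c cs → Linear (lag k c cs)
  lag-linear k c []        = id-linear
  lag-linear k c (c′ ∷ cs) = ∘-linear (lin-linear (invℤ (c ℤ.- c′)) (invℤ (c ℤ.- c′) * (- fromℤℚ c′)) (X-linear k) id-linear) (lag-linear k c cs)

  lag-comm : ∀ k c cs {F} → Linear F → (∀ v → F (X k v) ≈ X k (F v)) →
             ∀ u → F (lag k c cs u) ≈ lag k c cs (F u)
  lag-comm k c []        lF comm u π = refl
  lag-comm k c (c′ ∷ cs) {F} lF comm u π =
    trans (on-lin lF κ (X k (lag k c cs u)) (κ * (- fromℤℚ c′)) (lag k c cs u) π)
          (cong₂ (λ x y → κ * x + κ * (- fromℤℚ c′) * y)
                 (trans (comm (lag k c cs u) π) (respects (X-linear k) (lag-comm k c cs lF comm u) π))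
                 (lag-comm k c cs lF comm u π))
    where κ = invℤ (c ℤ.- c′)

  lag-same : ∀ {k c} cs {u} → Eig k c u → c ∉ cs → lag k c cs u ≈ u
  lag-same []        e c∉ π = refl
  lag-same {k} {c} (c′ ∷ cs) {u} e c∉ π = begin
    κ * X k (lag k c cs u) π + κ * (- fromℤℚ c′) * lag k c cs u π
      ≡⟨ cong₂ (λ x y → κ * x + κ * (- fromℤℚ c′) * y) (trans (respects (X-linear k) ih π) (at e π)) (ih π) ⟩
    κ * (fromℤℚ c * u π) + κ * (- fromℤℚ c′) * u π   ≡⟨ ident κ (fromℤℚ c) (fromℤℚ c′) (u π) ⟩
    (κ * (fromℤℚ c - fromℤℚ c′)) * u π               ≡⟨ cong (λ x → (κ * x) * u π) (fromℤℚ-− c c′) ⟨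
    (κ * fromℤℚ (c ℤ.- c′)) * u π                    ≡⟨ cong (_* u π) (invℤ-inverse (c ℤ.- c′) (λ z → c∉ (here (ℤP.i-j≡0⇒i≡j c c′ z)))) ⟩
    1ℚ * u π                                         ≡⟨ ℚP.*-identityˡ (u π) ⟩
    u π                                              ∎
    where
    open ≡-Reasoning
    κ = invℤ (c ℤ.- c′)
    ih : lag k c cs u ≈ u
    ih = lag-same cs e (c∉ ∘ there)
    ident : ∀ κ c c′ u → κ * (c * u) + κ * (- c′) * u ≡ (κ * (c - c′)) * u
    ident = solve-∀ ℚ-ring

  lag-Eig : ∀ {k c} j c₀ cs {u} → k < n → j < n → Eig k c u → Eig k c (lag j c₀ cs u)
  lag-Eig {k} j c₀ cs k<n j<n = Eig-op (lag-linear j c₀ cs) (λ v π → sym (lag-comm j c₀ cs (X-linear k) (X-X k<n j<n) v π))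

  lag-other : ∀ {k c c₁} cs {u} → k < n → Eig k c₁ u → c₁ ∈ cs → ∀ π → lag k c cs u π ≡ 0ℚ
  lag-other {k} {c} {c₁} (_ ∷ cs) {u} k<n e (here refl) π =
    trans (cong (λ x → κ * x + κ * (- fromℤℚ c₁) * lag k c cs u π) (at (lag-Eig k c cs k<n k<n e) π))
          (ident κ (fromℤℚ c₁) (lag k c cs u π))
    where
    κ = invℤ (c ℤ.- c₁)
    ident : ∀ κ c w → κ * (c * w) + κ * (- c) * w ≡ 0ℚ
    ident = solve-∀ ℚ-ring
  lag-other {k} {c} {c₁} (c′ ∷ cs) {u} k<n e (there c₁∈) π =
    trans (cong₂ (λ x y → κ * x + κ * (- fromℤℚ c′) * y) (on-0 (X-linear k) ih π) (ih π)) (ident κ (fromℤℚ c′))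
    where
    κ = invℤ (c ℤ.- c′)
    ih = lag-other {c = c} cs k<n e c₁∈
    ident : ∀ κ c → κ * 0ℚ + κ * (- c) * 0ℚ ≡ 0ℚ
    ident = solve-∀ ℚ-ring

  -- v is a sum of joint eigenvectors extending the eigenvalues cs by an eigenvalue of X k satisfying P.
  data Splits (k : ℕ) (cs : List ℤ) (P : ℤ → Set) (v : Vect) : Set where
    none : (∀ π → v π ≡ 0ℚ) → Splits k cs P v
    more : ∀ {c u w} → P c → JE 0 cs u → Eig k c u → Splits k cs P w → (∀ π → v π ≡ u π + w π) → Splits k cs P v

  module _ {k : ℕ} {cs : List ℤ} where

    Splits-JE : ∀ {P v} → Splits k cs P v → JE 0 cs v
    Splits-JE {v = v} (none z) = zeroJE cs
      where
      zeroJE : ∀ {l} cs → JE l cs v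
      zeroJE []       = []
      zeroJE {l} (c ∷ cs) = eig (λ π → trans (on-0 (X-linear l) z π) (sym (trans (cong (fromℤℚ c *_) (z π)) (ℚP.*-zeroʳ (fromℤℚ c))))) ∷ zeroJE cs
    Splits-JE (more {u = u} {w} _ es _ d eq) =
      JE-resp cs (λ π → sym (trans (eq π) (id₁ (u π) (w π)))) (JE-lin cs 1ℚ 1ℚ es (Splits-JE d))
      where
      id₁ : ∀ u w → u + w ≡ 1ℚ * u + 1ℚ * w
      id₁ = solve-∀ ℚ-ring

    Splits-+ : ∀ {P u v w} → Splits k cs P u → Splits k cs P v → (∀ π → w π ≡ u π + v π) → Splits k cs P w
    Splits-+ {v = v} (none z) (none z′) eq = none (λ π → trans (eq π) (cong₂ _+_ (z π) (z′ π)))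
    Splits-+ {v = v} (none z) (more p es e d eq′) eq =
      more p es e d (λ π → trans (eq π) (trans (cong (_+ v π) (z π)) (trans (ℚP.+-identityˡ (v π)) (eq′ π))))
    Splits-+ {v = v} (more {u = u₁} {w₁} p es e d eq′) dv eq =
      more p es e (Splits-+ d dv (λ _ → refl))
           (λ π → trans (eq π) (trans (cong (_+ v π) (eq′ π)) (ℚP.+-assoc (u₁ π) (w₁ π) (v π))))

    Splits-∑ : ∀ {P} {A : Set} (xs : List A) (f : A → Vect) → (∀ {x} → x ∈ xs → Splits k cs P (f x)) →
            Splits k cs P (λ π → ∑ xs (λ x → f x π))
    Splits-∑ []       f d = none (λ _ → refl)
    Splits-∑ (x ∷ xs) f d = Splits-+ (d (here refl)) (Splits-∑ xs f (d ∘ there)) (λ _ → refl)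

    Splits-refine : ∀ {P Q : ℤ → Set} {v} → (∀ {c} → P c → Q c ⊎ Vanishes (cs ++ [ c ])) → length cs ≡ k → k < n →
                 Splits k cs P v → Splits k cs Q v
    Splits-refine h len k<n (none z) = none z
    Splits-refine {v = v} h refl k<n (more {c} {u} {w} p es e d eq) with h p
    ... | inj₁ q   = more q es e (Splits-refine h refl k<n d) eq
    ... | inj₂ van = Splits-+ (none u≡0) (Splits-refine h refl k<n d) eq
      where
      u≡0 : ∀ π → u π ≡ 0ℚ
      u≡0 = van (subst (_≤ n) (sym (trans (LP.length-++ cs) (ℕP.+-comm (length cs) 1))) k<n) u (JE-++⁺ cs es (e ∷ []))

  -- Meant for `R` the addable rows of a shape and `con` their contents; `proj k r` is then the
  -- operator of one factor of Murphy's formula.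
  module Nodes (R : List ℕ) (con : ℕ → ℤ) (unique : Unique R)
               (con-injective : ∀ {r r′} → r ∈ R → r′ ∈ R → con r ≡ con r′ → r ≡ r′) where

    others : ℕ → List ℤ
    others r = map con (filterᵇ (λ r′ → not (r′ ≡ᵇ r)) R)

    ∉-others : ∀ {r} → r ∈ R → con r ∉ others r
    ∉-others {r} r∈ c∈ with ∈-map⁻ con c∈
    ... | r′ , r′∈ , eq with ∈-filterᵇ⁻ (λ r′ → not (r′ ≡ᵇ r)) R r′∈
    ... | r′∈R , r′≢r = T-not-≡ᵇ⇒≢ r′ r r′≢r (sym (con-injective r∈ r′∈R eq))

    ∈-others : ∀ {r r′} → r′ ∈ R → r′ ≢ r → con r′ ∈ others r
    ∈-others {r} {r′} r′∈ r′≢r = ∈-map⁺ con (∈-filterᵇ⁺ (λ r′ → not (r′ ≡ᵇ r)) r′∈ (≢⇒T-not-≡ᵇ r′ r r′≢r))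

    IsNode : ℤ → Set
    IsNode c = Σ ℕ λ r → r ∈ R × c ≡ con r

    proj : ℕ → ℕ → Vect → Vect
    proj k r = lag k (con r) (others r)

    proj-linear : ∀ k r → Linear (proj k r)
    proj-linear k r = lag-linear k (con r) (others r)

    module _ {k : ℕ} {cs : List ℤ} (k<n : k < n) where

      proj-same : ∀ {r u} → r ∈ R → Eig k (con r) u → proj k r u ≈ u
      proj-same {r} r∈ e = lag-same (others r) e (∉-others r∈)

      proj-other : ∀ {r r′ u} → r′ ∈ R → r′ ≢ r → Eig k (con r′) u → ∀ π → proj k r u π ≡ 0ℚ
      proj-other {r} r′∈ r′≢r e = lag-other {c = con r} (others r) k<n e (∈-others r′∈ r′≢r)

      proj-Eig : ∀ {r v} → r ∈ R → Splits k cs IsNode v → Eig k (con r) (proj k r v)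
      proj-Eig {r} r∈ (none z) = eig (λ π → trans (on-0 (X-linear k) pz π) (sym (trans (cong (fromℤℚ (con r) *_) (pz π)) (ℚP.*-zeroʳ (fromℤℚ (con r))))))
        where pz = on-0 (proj-linear k r) z
      proj-Eig {r} {v} r∈ (more {u = u} {w} (r′ , r′∈ , refl) _ e d eq) =
        Eig-resp (λ π → sym (trans (on-+ (proj-linear k r) u w eq π) (id₁ (proj k r u π) (proj k r w π)))) (Eig-lin 1ℚ 1ℚ eu (proj-Eig r∈ d))
        where
        id₁ : ∀ u w → u + w ≡ 1ℚ * u + 1ℚ * w
        id₁ = solve-∀ ℚ-ring
        eu : Eig k (con r) (proj k r u)
        eu with r′ ℕP.≟ r
        ... | yes refl = Eig-resp (λ π → sym (proj-same r∈ e π)) e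
        ... | no r′≢r  = eig (λ π → trans (on-0 (X-linear k) (proj-other r′∈ r′≢r e) π)
                                 (sym (trans (cong (fromℤℚ (con r) *_) (proj-other r′∈ r′≢r e π)) (ℚP.*-zeroʳ (fromℤℚ (con r))))))

      ∑-proj : ∀ {v} → Splits k cs IsNode v → ∀ π → ∑ R (λ r → proj k r v π) ≡ v π
      ∑-proj (none z) π = trans (∑-zero R (λ {r} _ → on-0 (proj-linear k r) z π)) (sym (z π))
      ∑-proj {v} (more {u = u} {w} (r′ , r′∈ , refl) _ e d eq) π = begin
        ∑ R (λ r → proj k r v π)                             ≡⟨ ∑-cong R (λ {r} _ → on-+ (proj-linear k r) u w eq π) ⟩
        ∑ R (λ r → proj k r u π + proj k r w π)              ≡⟨ ∑-+ R _ _ ⟩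
        ∑ R (λ r → proj k r u π) + ∑ R (λ r → proj k r w π)  ≡⟨ cong₂ _+_ single (∑-proj d π) ⟩
        u π + w π                                            ≡⟨ eq π ⟨
        v π                                                  ∎
        where
        open ≡-Reasoning
        single : ∑ R (λ r → proj k r u π) ≡ u π
        single = trans (∑-single _ unique r′∈ (λ {r} _ r≢r′ → proj-other r′∈ (λ eq → r≢r′ (sym eq)) e π)) (proj-same r′∈ e π)

      proj-JE : ∀ {r v} l cs → l ℕ.+ length cs ≤ n → JE l cs v → JE l cs (proj k r v)
      proj-JE {r} l cs len = JE-op cs (proj-linear k r)
        (λ j l≤j j< v π → sym (lag-comm k (con r) (others r) (X-linear j) (X-X (ℕP.<-≤-trans j< len) k<n) v π))

    -- `cs` stands for the contents of a smaller tableau and `con r` for that of the cell just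
    -- added. The induction hypothesis `decompose` covers every vector with eigenvalues `cs` because
    -- it is applied to `S k v` and again to each `S k (z r′)`.
    module Step {k : ℕ} {cs : List ℤ} (len : length cs ≡ k) (k< : suc k < n) (r : ℕ) (r∈ : r ∈ R)
                (gap : ∀ {r′} → r′ ∈ R → r′ ≢ r → (con r′ ℤ.- con r) ℤ.* (con r′ ℤ.- con r) ≢ ℤ.+ 1)
                (decompose : ∀ z → JE 0 cs z → Splits k cs IsNode z) where

      private
        k<n : k < n
        k<n = ℕP.<-trans (ℕP.n<1+n k) k<
        a : ℤ
        a = con r
        A : ℚ
        A = fromℤℚ a
        cs≤ : length cs ≤ n
        cs≤ = subst (_≤ n) (sym len) (ℕP.<⇒≤ k<n)

      Far Next : ℤ → Set
      Far c = Σ ℕ λ r′ → r′ ∈ R × r′ ≢ r × c ≡ con r′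
      Next c = Far c ⊎ (c ≡ a ℤ.+ ℤ.+ 1) ⊎ (c ≡ a ℤ.- ℤ.+ 1)

      S-JE : ∀ {v} → JE 0 cs v → JE 0 cs (S k v)
      S-JE = JE-op cs (S-linear k) (λ j _ j< → S-X k< (ℕP.<-≤-trans j< cs≤) (ℕP.<⇒≢ (lt j<)) (ℕP.<⇒≢ (ℕP.<-trans (lt j<) (ℕP.n<1+n k))))
        where
        lt : ∀ {j} → j < length cs → j < k
        lt = subst (_ <_) len

      -- Subtracting `a` places the two exceptional eigenvalues at `1` and `−1`.
      D : Vect → Vect
      D u = lin 1ℚ (X (suc k) u) (- A) u

      D-linear : Linear D
      D-linear = lin-linear 1ℚ (- A) (X-linear (suc k)) id-linear

      D-comm : ∀ {j} → j < n → ∀ v → D (X j v) ≈ X j (D v)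
      D-comm {j} j<n v π = trans (cong (λ x → 1ℚ * x + (- A) * X j v π) (X-X k< j<n v π))
                                 (sym (on-lin (X-linear j) 1ℚ (X (suc k) v) (- A) v π))

      D-Eig : ∀ {c u} → Eig (suc k) c u → ∀ π → D u π ≡ (fromℤℚ c - A) * u π
      D-Eig {c} {u} e π = trans (cong (λ x → 1ℚ * x + (- A) * u π) (at e π)) (ident (fromℤℚ c) A (u π))
        where
        ident : ∀ c a u → 1ℚ * (c * u) + (- a) * u ≡ (c - a) * u
        ident = solve-∀ ℚ-ring

      Eig-D : ∀ {u} c → (∀ π → D u π ≡ (fromℤℚ c - A) * u π) → Eig (suc k) c u
      Eig-D {u} c h = eig λ π → trans (i₁ (X (suc k) u π) A (u π)) (trans (cong (_+ A * u π) (h π)) (i₂ (fromℤℚ c) A (u π)))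
        where
        i₁ : ∀ x a u → x ≡ (1ℚ * x + (- a) * u) + a * u
        i₁ = solve-∀ ℚ-ring
        i₂ : ∀ c a u → (c - a) * u + a * u ≡ c * u
        i₂ = solve-∀ ℚ-ring

      -- D² − 1 is invertible on the span of the eigenvectors whose eigenvalue is Far.
      solve-D²-1 : ∀ {G} → Splits (suc k) (cs ++ [ a ]) Far G →
                   Σ Vect λ H → Splits (suc k) (cs ++ [ a ]) Far H × (∀ π → D (D H) π ≡ H π + G π)
      solve-D²-1 (none z) = (λ _ → 0ℚ) , none (λ _ → refl) ,
        λ π → trans (on-0 D-linear (on-0 D-linear (λ _ → refl)) π) (sym (trans (ℚP.+-identityˡ _) (z π)))
      solve-D²-1 {G} (more {c} {u} {w} p@(r′ , r′∈ , r′≢r , refl) es e d eq) with solve-D²-1 d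
      ... | H , dH , hH = H′ , more p (JE-resp (cs ++ [ a ]) q0 (JE-lin (cs ++ [ a ]) q 0ℚ es es)) (Eig-resp q0 (Eig-lin q 0ℚ e e)) dH (λ _ → refl) , check
        where
        open ≡-Reasoning
        f : ℤ
        f = con r′ ℤ.- a
        -- The value of `D² − 1` on the component `u`, nonzero by `gap`; `H′` therefore takes `u`
        -- with coefficient `1/g`.
        g : ℤ
        g = f ℤ.* f ℤ.- ℤ.+ 1
        q : ℚ
        q = invℤ g
        E : ℚ
        E = fromℤℚ c - A
        H′ : Vect
        H′ π = q * u π + H π
        q0 : lin q u 0ℚ u ≈ (λ π → q * u π)
        q0 π = ident q (u π)
          where
          ident : ∀ q u → q * u + 0ℚ * u ≡ q * u
          ident = solve-∀ ℚ-ring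
        gE : fromℤℚ g ≡ E * E - 1ℚ
        gE = trans (fromℤℚ-− (f ℤ.* f) (ℤ.+ 1)) (cong (_- 1ℚ) (trans (fromℤℚ-* f f) (cong₂ _*_ (fromℤℚ-− (con r′) a) (fromℤℚ-− (con r′) a))))
        DD : ∀ π → D (D u) π ≡ E * (E * u π)
        DD π = trans (on-scalar D-linear E u (D-Eig e) π) (cong (E *_) (D-Eig e π))
        check : ∀ π → D (D H′) π ≡ H′ π + G π
        check π = begin
          D (D H′) π                                 ≡⟨ on-+ D-linear (D (λ ρ → q * u ρ)) (D H) (on-+ D-linear (λ ρ → q * u ρ) H (λ _ → refl)) π ⟩
          D (D (λ ρ → q * u ρ)) π + D (D H) π        ≡⟨ cong₂ _+_ (trans (on-scalar D-linear q (D u) (on-scalar D-linear q u (λ _ → refl)) π) (cong (q *_) (DD π))) (hH π) ⟩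
          q * (E * (E * u π)) + (H π + w π)          ≡⟨ ident q E (u π) (H π) (w π) ⟩
          (q * (E * E - 1ℚ)) * u π + (q * u π + H π) + w π ≡⟨ cong (λ x → x * u π + (q * u π + H π) + w π) (trans (cong (q *_) (sym gE)) (invℤ-inverse g (λ z → gap r′∈ r′≢r (ℤP.i-j≡0⇒i≡j (f ℤ.* f) (ℤ.+ 1) z)))) ⟩
          1ℚ * u π + (q * u π + H π) + w π           ≡⟨ ident₂ (u π) (q * u π + H π) (w π) ⟩
          (q * u π + H π) + (u π + w π)              ≡⟨ cong (H′ π +_) (eq π) ⟨
          H′ π + G π                                 ∎
          where
          ident : ∀ q e u h w → q * (e * (e * u)) + (h + w) ≡ (q * (e * e - 1ℚ)) * u + (q * u + h) + w
          ident = solve-∀ ℚ-ring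
          ident₂ : ∀ u h w → 1ℚ * u + h + w ≡ h + (u + w)
          ident₂ = solve-∀ ℚ-ring

      module _ (v : Vect) (esv : JE 0 (cs ++ [ a ]) v) where
        private
          es : JE 0 cs v
          es = proj₁ (JE-++⁻ cs esv)
          ev : Eig k a v
          ev with JE-++⁻ cs esv
          ... | _ , e ∷ [] = subst (λ j → Eig j a v) len e

          z : ℕ → Vect
          z r′ = proj k r′ (S k v)
          dS : Splits k cs IsNode (S k v)
          dS = decompose (S k v) (S-JE es)
          z-JE : ∀ r′ → JE 0 cs (z r′)
          z-JE r′ = proj-JE {cs = cs} k<n 0 cs cs≤ (S-JE es)
          z-Eig : ∀ {r′} → r′ ∈ R → Eig k (con r′) (z r′)
          z-Eig r′∈ = proj-Eig k<n r′∈ dS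

          -- `X (suc k)` commutes with the projection, so the relation `X_{k+1} S_k v = a S_k v + v`
          -- can be projected to each eigenvalue of `X k`.
          Yz : ∀ r′ π → X (suc k) (z r′) π ≡ A * z r′ π + proj k r′ v π
          Yz r′ π = begin
            X (suc k) (z r′) π                         ≡⟨ lag-comm k (con r′) (others r′) (X-linear (suc k)) (X-X k< k<n) (S k v) π ⟩
            proj k r′ (X (suc k) (S k v)) π            ≡⟨ on-+ (proj-linear k r′) (λ ρ → A * S k v ρ) v (λ ρ → trans (X-S k< v ρ) (cong (_+ v ρ) (on-scalar (S-linear k) A v (at ev) ρ))) π ⟩
            proj k r′ (λ ρ → A * S k v ρ) π + proj k r′ v π ≡⟨ cong (_+ proj k r′ v π) (on-scalar (proj-linear k r′) A (S k v) (λ _ → refl) π) ⟩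
            A * z r′ π + proj k r′ v π                 ∎
            where open ≡-Reasoning

          g : ℕ → Vect
          g r′ = proj k r (S k (z r′))
          g-JE : ∀ r′ → JE 0 (cs ++ [ a ]) (g r′)
          g-JE r′ = JE-++⁺ cs (proj-JE {cs = cs} k<n 0 cs cs≤ (S-JE (z-JE r′)))
                      (subst (λ j → Eig j a (g r′)) (sym len) (proj-Eig k<n r∈ (decompose (S k (z r′)) (S-JE (z-JE r′)))) ∷ [])

          -- For `r′ ≢ r` the projection of `v` to `con r′` is zero, so by `Yz` the vector `z r′`
          -- has eigenvalues `con r′`, `a` in places `k`, `suc k`. Its image `u′` under the
          -- intertwiner has them exchanged and is fixed by `proj k r`; computing that projection
          -- gives a nonzero multiple of `g r′`.
          g-Eig : ∀ {r′} → r′ ∈ R → r′ ≢ r → Eig (suc k) (con r′) (g r′)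
          g-Eig {r′} r′∈ r′≢r = eig λ π → p-q≡0⇒p≡q _ _ (q*p≡0⇒p≡0 E _ E≢0 (begin
            E * (X (suc k) (g r′) π - B * g r′ π)                ≡⟨ i₁ E (X (suc k) (g r′) π) B (g r′ π) ⟩
            E * X (suc k) (g r′) π - B * (E * g r′ π)            ≡⟨ cong₂ (λ x y → x - B * y) (sym (on-scalar (X-linear (suc k)) E (g r′) u′≡ π)) (sym (u′≡ π)) ⟩
            X (suc k) u′ π - B * u′ π                            ≡⟨ cong (_- B * u′ π) (at (intertwine-Eig′ k< (z-Eig r′∈) Yz′) π) ⟩
            B * u′ π - B * u′ π                                  ≡⟨ ℚP.+-inverseʳ (B * u′ π) ⟩
            0ℚ                                                   ∎))
            where
            open ≡-Reasoning
            B E : ℚ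
            B = fromℤℚ (con r′)
            E = B - A
            Yz′ : Eig (suc k) a (z r′)
            Yz′ = eig λ π → trans (Yz r′ π) (trans (cong (A * z r′ π +_) (proj-other {cs = cs} k<n r∈ (λ e → r′≢r (sym e)) ev π)) (ℚP.+-identityʳ _))
            u′ : Vect
            u′ = intertwine k (con r′) a (z r′)
            u′≡ : ∀ π → u′ π ≡ E * g r′ π
            u′≡ π = begin
              u′ π                                           ≡⟨ proj-same {cs = cs} k<n r∈ (intertwine-Eig k< (z-Eig r′∈) Yz′) π ⟨
              proj k r u′ π                                  ≡⟨ on-lin (proj-linear k r) E (S k (z r′)) 1ℚ (z r′) π ⟩
              E * g r′ π + 1ℚ * proj k r (z r′) π            ≡⟨ cong (λ x → E * g r′ π + 1ℚ * x) (proj-other {cs = cs} k<n r′∈ r′≢r (z-Eig r′∈) π) ⟩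
              E * g r′ π + 1ℚ * 0ℚ                           ≡⟨ ℚP.+-identityʳ _ ⟩
              E * g r′ π                                     ∎
            i₁ : ∀ e x b g → e * (x - b * g) ≡ e * x - b * (e * g)
            i₁ = solve-∀ ℚ-ring
            p-q≡0⇒p≡q : ∀ p q → p - q ≡ 0ℚ → p ≡ q
            p-q≡0⇒p≡q p q h = trans (i₂ p q) (trans (cong (_+ q) h) (ℚP.+-identityˡ q))
              where
              i₂ : ∀ p q → p ≡ (p - q) + q
              i₂ = solve-∀ ℚ-ring
            E≢0 : E ≢ 0ℚ
            E≢0 h = r′≢r (con-injective r′∈ r∈ (fromℤℚ-injective (p-q≡0⇒p≡q B A h)))

          rest : List ℕ
          rest = filterᵇ (λ r′ → not (r′ ≡ᵇ r)) R
          G : Vect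
          G π = ∑ rest (λ r′ → g r′ π)
          dG : Splits (suc k) (cs ++ [ a ]) Far G
          dG = Splits-∑ rest g λ {r′} r′∈ →
            let r′∈R , t = ∈-filterᵇ⁻ (λ r′ → not (r′ ≡ᵇ r)) R r′∈
                r′≢r = T-not-≡ᵇ⇒≢ r′ r t
            in more (r′ , r′∈R , r′≢r , refl) (g-JE r′) (g-Eig r′∈R r′≢r) (none (λ _ → refl)) (λ _ → sym (ℚP.+-identityʳ _))

          t : Vect
          t = g r

          v≡t+G : ∀ π → v π ≡ t π + G π
          v≡t+G π = begin
            v π                                              ≡⟨ proj-same {cs = cs} k<n r∈ ev π ⟨
            proj k r v π                                     ≡⟨ respects (proj-linear k r) (λ ρ → sym (S-S k< v ρ)) π ⟩
            proj k r (S k (S k v)) π                         ≡⟨ respects PS (λ ρ → sym (∑-proj k<n dS ρ)) π ⟩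
            proj k r (S k (λ ρ → ∑ R (λ r′ → z r′ ρ))) π     ≡⟨ on-∑ PS R z π ⟩
            ∑ R (λ r′ → g r′ π)                              ≡⟨ ∑-split (λ r′ → g r′ π) unique r∈ ⟩
            t π + G π                                        ∎
            where
            open ≡-Reasoning
            PS : Linear (proj k r ∘ S k)
            PS = ∘-linear (proj-linear k r) (S-linear k)

          Dz : ∀ π → D (z r) π ≡ v π
          Dz π = trans (cong (λ x → 1ℚ * x + (- A) * z r π) (trans (Yz r π) (cong (A * z r π +_) (proj-same {cs = cs} k<n r∈ ev π)))) (ident A (z r π) (v π))
            where
            ident : ∀ a z v → 1ℚ * (a * z + v) + (- a) * z ≡ v
            ident = solve-∀ ℚ-ring

          Dt : ∀ π → D t π ≡ z r π
          Dt π = begin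
            D t π                                                       ≡⟨ lag-comm k (con r) (others r) D-linear (D-comm k<n) (S k (z r)) π ⟩
            proj k r (D (S k (z r))) π                                  ≡⟨ respects (proj-linear k r) DS π ⟩
            proj k r (z r) π                                            ≡⟨ proj-same {cs = cs} k<n r∈ (z-Eig r∈) π ⟩
            z r π                                                       ∎
            where
            open ≡-Reasoning
            DS : ∀ ρ → D (S k (z r)) ρ ≡ z r ρ
            DS ρ = trans (cong (λ x → 1ℚ * x + (- A) * S k (z r) ρ) (trans (X-S k< (z r) ρ) (cong (_+ z r ρ) (on-scalar (S-linear k) A (z r) (at (z-Eig r∈)) ρ))))
                         (ident A (S k (z r) ρ) (z r ρ))
              where
              ident : ∀ a s z → 1ℚ * (a * s + z) + (- a) * s ≡ z
              ident = solve-∀ ℚ-ring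

        decompose-next : Splits (suc k) (cs ++ [ a ]) Next v
        decompose-next =
          more {c = a ℤ.+ ℤ.+ 1} {u = p} (inj₂ (inj₁ refl)) p-JE (Eig-D (a ℤ.+ ℤ.+ 1) Dp)
            (more {c = a ℤ.- ℤ.+ 1} {u = m} (inj₂ (inj₂ refl)) m-JE (Eig-D (a ℤ.- ℤ.+ 1) Dm)
              (Splits-+ (Splits-refine inj (len-snoc) k< dH) (Splits-refine inj len-snoc k< dG) (λ _ → refl))
              (λ _ → refl))
            (λ π → trans (v≡t+G π) (total (t π) (H π) (G π) (D t′ π)))
          where
          open ≡-Reasoning
          sol = solve-D²-1 dG
          H = proj₁ sol
          dH = proj₁ (proj₂ sol)
          hH = proj₂ (proj₂ sol)
          len-snoc : length (cs ++ [ a ]) ≡ suc k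
          len-snoc = trans (LP.length-++ cs) (trans (ℕP.+-comm (length cs) 1) (cong suc len))
          inj : ∀ {c} → Far c → Next c ⊎ Vanishes ((cs ++ [ a ]) ++ [ c ])
          inj f = inj₁ (inj₁ f)
          -- `t′` is fixed by `D²`; `p` and `m` are its parts on which `D` acts by `1` and by `−1`.
          t′ p m : Vect
          t′ = lin 1ℚ t (- 1ℚ) H
          p = lin ½ (D t′) ½ t′
          m = lin ½ t′ (- ½) (D t′)
          total : ∀ t h g d → t + g ≡ (½ * d + ½ * (1ℚ * t + (- 1ℚ) * h)) + ((½ * (1ℚ * t + (- 1ℚ) * h) + (- ½) * d) + (h + g))
          total = solve-∀ ℚ-ring
          t′-JE : JE 0 (cs ++ [ a ]) t′
          t′-JE = JE-lin (cs ++ [ a ]) 1ℚ (- 1ℚ) (g-JE r) (Splits-JE dH)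
          Dt′-JE : JE 0 (cs ++ [ a ]) (D t′)
          Dt′-JE = JE-op (cs ++ [ a ]) D-linear (λ j _ j< → D-comm (ℕP.<-trans (subst (j <_) len-snoc j<) k<)) t′-JE
          p-JE = JE-lin (cs ++ [ a ]) ½ ½ Dt′-JE t′-JE
          m-JE = JE-lin (cs ++ [ a ]) ½ (- ½) t′-JE Dt′-JE
          DDt′ : ∀ π → D (D t′) π ≡ t′ π
          DDt′ π = begin
            D (D t′) π                         ≡⟨ on-lin (∘-linear D-linear D-linear) 1ℚ t (- 1ℚ) H π ⟩
            1ℚ * D (D t) π + (- 1ℚ) * D (D H) π ≡⟨ cong₂ (λ x y → 1ℚ * x + (- 1ℚ) * y) (trans (respects D-linear Dt π) (trans (Dz π) (v≡t+G π))) (hH π) ⟩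
            1ℚ * (t π + G π) + (- 1ℚ) * (H π + G π) ≡⟨ ident (t π) (G π) (H π) ⟩
            t′ π                               ∎
            where
            ident : ∀ t g h → 1ℚ * (t + g) + (- 1ℚ) * (h + g) ≡ 1ℚ * t + (- 1ℚ) * h
            ident = solve-∀ ℚ-ring
          Dp : ∀ π → D p π ≡ (fromℤℚ (a ℤ.+ ℤ.+ 1) - A) * p π
          Dp π = begin
            D p π                              ≡⟨ on-lin D-linear ½ (D t′) ½ t′ π ⟩
            ½ * D (D t′) π + ½ * D t′ π        ≡⟨ cong (λ x → ½ * x + ½ * D t′ π) (DDt′ π) ⟩
            ½ * t′ π + ½ * D t′ π              ≡⟨ ident A (t′ π) (D t′ π) ⟩
            ((A + 1ℚ) - A) * p π               ≡⟨ cong (λ x → (x - A) * p π) (fromℤℚ-+ a (ℤ.+ 1)) ⟨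
            (fromℤℚ (a ℤ.+ ℤ.+ 1) - A) * p π   ∎
            where
            ident : ∀ a t d → ½ * t + ½ * d ≡ ((a + 1ℚ) - a) * (½ * d + ½ * t)
            ident = solve-∀ ℚ-ring
          Dm : ∀ π → D m π ≡ (fromℤℚ (a ℤ.- ℤ.+ 1) - A) * m π
          Dm π = begin
            D m π                              ≡⟨ on-lin D-linear ½ t′ (- ½) (D t′) π ⟩
            ½ * D t′ π + (- ½) * D (D t′) π    ≡⟨ cong (λ x → ½ * D t′ π + (- ½) * x) (DDt′ π) ⟩
            ½ * D t′ π + (- ½) * t′ π          ≡⟨ ident A (t′ π) (D t′ π) ⟩
            ((A - 1ℚ) - A) * m π               ≡⟨ cong (λ x → (x - A) * m π) (fromℤℚ-− a (ℤ.+ 1)) ⟨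
            (fromℤℚ (a ℤ.- ℤ.+ 1) - A) * m π   ∎
            where
            ident : ∀ a t d → ½ * d + (- ½) * t ≡ ((a - 1ℚ) - a) * (½ * t + (- ½) * d)
            ident = solve-∀ ℚ-ring

-- Standard tableaux and the spectrum

rowLen-pos : ∀ ν r {l} → l < rowLen ν r → r < length ν
rowLen-pos (a ∷ ν) zero    _  = s≤s z≤n
rowLen-pos (a ∷ ν) (suc r) l< = s≤s (rowLen-pos ν r l<)

rowLen-add : ∀ r ν → r ≤ length ν → rowLen (addToRow r ν) r ≡ suc (rowLen ν r)
rowLen-add zero    []      _       = refl
rowLen-add zero    (a ∷ ν) _       = refl
rowLen-add (suc r) (a ∷ ν) (s≤s h) = rowLen-add r ν h

rowLen-other : ∀ r ν r′ → r ≤ length ν → r′ ≢ r → rowLen (addToRow r ν) r′ ≡ rowLen ν r′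
rowLen-other zero    ν       zero     _       r′≢r = ⊥-elim (r′≢r refl)
rowLen-other zero    []      (suc r′) _       _    = refl
rowLen-other zero    (a ∷ ν) (suc r′) _       _    = refl
rowLen-other (suc r) (a ∷ ν) zero     _       _    = refl
rowLen-other (suc r) (a ∷ ν) (suc r′) (s≤s h) r′≢r = rowLen-other r ν r′ h (r′≢r ∘ cong suc)

-- The local predicate ok of addableRows has no name outside Defs; unification supplies it.
mutual
  addableᵇ : List ℕ → ℕ → Bool
  addableᵇ = _

  addableRows-tail : ∀ ν → addableRows ν ≡ 0 ∷ filterᵇ (addableᵇ ν) (applyUpTo suc (length ν))
  addableRows-tail ν = refl

addable-≤ : ∀ ν {r} → r ∈ addableRows ν → r ≤ length ν
addable-≤ ν r∈ = ℕP.≤-pred (∈-upTo⁻ (proj₁ (∈-filterᵇ⁻ (addableᵇ ν) (upTo (suc (length ν))) r∈)))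

addable⁻ : ∀ ν {r} → suc r ∈ addableRows ν → rowLen ν (suc r) < rowLen ν r
addable⁻ ν r∈ = ℕP.<ᵇ⇒< _ _ (proj₂ (∈-filterᵇ⁻ (addableᵇ ν) (upTo (suc (length ν))) r∈))

addable-zero : ∀ ν → 0 ∈ addableRows ν
addable-zero ν = here refl

addable⁺ : ∀ ν {r} → rowLen ν (suc r) < rowLen ν r → suc r ∈ addableRows ν
addable⁺ ν {r} h = ∈-filterᵇ⁺ (addableᵇ ν) (∈-upTo⁺ (s≤s (rowLen-pos ν r h))) (ℕP.<⇒<ᵇ h)

addable-unique : ∀ ν → Unique (addableRows ν)
addable-unique ν = Unique.filter⁺ (λ r → T? (addableᵇ ν r)) (Unique.upTo⁺ (suc (length ν)))

Antitone : List ℕ → Set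
Antitone ν = ∀ r → rowLen ν (suc r) ≤ rowLen ν r

antitone-≤ : ∀ ν → Antitone ν → ∀ {r r′} → r ≤ r′ → rowLen ν r′ ≤ rowLen ν r
antitone-≤ ν anti {r} {r′} r≤r′ with ℕP.m≤n⇒∃[o]m+o≡n r≤r′
... | d , refl = go d
  where
  go : ∀ d → rowLen ν (r ℕ.+ d) ≤ rowLen ν r
  go zero    = ℕP.≤-reflexive (cong (rowLen ν) (ℕP.+-identityʳ r))
  go (suc d) = ℕP.≤-trans (ℕP.≤-reflexive (cong (rowLen ν) (ℕP.+-suc r d))) (ℕP.≤-trans (anti (r ℕ.+ d)) (go d))

antitone-add : ∀ ν {r} → Antitone ν → r ∈ addableRows ν → Antitone (addToRow r ν)
antitone-add ν {r} anti r∈ q with suc q ℕP.≟ r | q ℕP.≟ r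
... | yes refl | _ = subst₂ _≤_ (sym (rowLen-add r ν (addable-≤ ν r∈))) (sym (rowLen-other r ν q (addable-≤ ν r∈) (ℕP.<⇒≢ (ℕP.n<1+n q)))) (addable⁻ ν r∈)
... | no sq≢r | yes refl = subst₂ _≤_ (sym (rowLen-other r ν (suc q) (addable-≤ ν r∈) sq≢r)) (sym (rowLen-add r ν (addable-≤ ν r∈))) (ℕP.m≤n⇒m≤1+n (anti q))
... | no sq≢r | no q≢r = subst₂ _≤_ (sym (rowLen-other r ν (suc q) (addable-≤ ν r∈) sq≢r)) (sym (rowLen-other r ν q (addable-≤ ν r∈) q≢r)) (anti q)

-- A gap of at least two. Contents of distinct addable cells always have it, which shows at once
-- that contents tell the rows apart and that their differences are never `±1`. The literal `2 + w`
-- lets a square equal to `1` be refuted by computation.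
Above : ℤ → ℤ → Set
Above c c′ = Σ ℕ λ w → c ≡ c′ ℤ.+ ℤ.+ (2 ℕ.+ w)

above : ∀ {L r L′ r′} → L′ < L → r < r′ → Above (ℤ.+ L ℤ.- ℤ.+ r) (ℤ.+ L′ ℤ.- ℤ.+ r′)
above {L} {r} {L′} {r′} L′<L r<r′ with ℕP.m≤n⇒∃[o]m+o≡n L′<L | ℕP.m≤n⇒∃[o]m+o≡n r<r′
... | u , refl | v , refl = u ℕ.+ v , ident (ℤ.+ L′) (ℤ.+ u) (ℤ.+ r) (ℤ.+ v)
  where
  ident : ∀ L u r v → (ℤ.+ 1 ℤ.+ (L ℤ.+ u)) ℤ.- r ≡ (L ℤ.- (ℤ.+ 1 ℤ.+ (r ℤ.+ v))) ℤ.+ (ℤ.+ 2 ℤ.+ (u ℤ.+ v))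
  ident = ℤ-solve-∀

above⇒≢ : ∀ {c c′} → Above c c′ → c ≢ c′
above⇒≢ {c} {c′} (w , eq) refl with trans (sym (ident c)) (trans (cong (ℤ._- c) eq) (ident₂ c (ℤ.+ (2 ℕ.+ w))))
  where
  ident : ∀ c → c ℤ.- c ≡ ℤ.+ 0
  ident = ℤ-solve-∀
  ident₂ : ∀ c d → (c ℤ.+ d) ℤ.- c ≡ d
  ident₂ = ℤ-solve-∀
... | ()

above⇒sq≢1 : ∀ {c c′} → Above c c′ ⊎ Above c′ c → (c ℤ.- c′) ℤ.* (c ℤ.- c′) ≢ ℤ.+ 1
above⇒sq≢1 {_} {c′} (inj₁ (w , refl)) h with trans (sym (ident c′ (ℤ.+ (2 ℕ.+ w)))) h
  where
  ident : ∀ c d → ((c ℤ.+ d) ℤ.- c) ℤ.* ((c ℤ.+ d) ℤ.- c) ≡ d ℤ.* d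
  ident = ℤ-solve-∀
... | ()
above⇒sq≢1 {c} (inj₂ (w , refl)) h with trans (sym (ident c (ℤ.+ (2 ℕ.+ w)))) h
  where
  ident : ∀ c d → (c ℤ.- (c ℤ.+ d)) ℤ.* (c ℤ.- (c ℤ.+ d)) ≡ d ℤ.* d
  ident = ℤ-solve-∀
... | ()

-- An addable row is strictly shorter than the row directly above it, so passing down to it from `r`
-- both lowers the column and raises the row.
addable-above : ∀ ν → Antitone ν → ∀ {r r′} → r < r′ → r′ ∈ addableRows ν → Above (addContent ν r) (addContent ν r′)
addable-above ν anti {r} {suc q} (s≤s r≤q) r′∈ =
  above (ℕP.<-≤-trans (addable⁻ ν r′∈) (antitone-≤ ν anti r≤q)) (s≤s r≤q)

addable-compare : ∀ ν → Antitone ν → ∀ {r r′} → r ∈ addableRows ν → r′ ∈ addableRows ν → r ≢ r′ →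
                  Above (addContent ν r) (addContent ν r′) ⊎ Above (addContent ν r′) (addContent ν r)
addable-compare ν anti {r} {r′} r∈ r′∈ r≢r′ with ℕP.<-cmp r r′
... | tri< r<r′ _ _ = inj₁ (addable-above ν anti r<r′ r′∈)
... | tri≈ _ r≡r′ _ = ⊥-elim (r≢r′ r≡r′)
... | tri> _ _ r′<r = inj₂ (addable-above ν anti r′<r r∈)

addContent-injective : ∀ ν → Antitone ν → ∀ {r r′} → r ∈ addableRows ν → r′ ∈ addableRows ν →
                       addContent ν r ≡ addContent ν r′ → r ≡ r′
addContent-injective ν anti {r} {r′} r∈ r′∈ eq with r ℕP.≟ r′
... | yes r≡r′ = r≡r′
... | no r≢r′ with addable-compare ν anti r∈ r′∈ r≢r′
...   | inj₁ a = ⊥-elim (above⇒≢ a eq)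
...   | inj₂ a = ⊥-elim (above⇒≢ a (sym eq))

-- Standard tableaux with k cells, seen through their shape and their list of contents.
data Tab : ℕ → List ℕ → List ℤ → Set where
  nil  : Tab 0 [] []
  snoc : ∀ {k ν cs r} → Tab k ν cs → r ∈ addableRows ν → Tab (suc k) (addToRow r ν) (cs ++ [ addContent ν r ])

Tab-antitone : ∀ {k ν cs} → Tab k ν cs → Antitone ν
Tab-antitone nil         r = z≤n
Tab-antitone (snoc {ν = ν} t r∈) = antitone-add ν (Tab-antitone t) r∈

Tab-length : ∀ {k ν cs} → Tab k ν cs → length cs ≡ k
Tab-length nil                     = refl
Tab-length (snoc {cs = cs} t r∈) = trans (LP.length-++ cs) (trans (ℕP.+-comm (length cs) 1) (cong suc (Tab-length t)))

module Spectrum {I : Set} {n : ℕ} {X S : ℕ → Vect {I} → Vect} (jm : JucysMurphy n X S) where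
  open JM jm
  open Lagrange jm

  -- Swapping eigenvalues moves the content of a removable corner to the last place.
  corner : ∀ {k ν cs} → Tab k ν cs → ∀ q L → rowLen ν q ≡ suc L → rowLen ν (suc q) ≤ L →
           Σ (List ℤ) λ α → ∀ β → Vanishes (α ++ (ℤ.+ L ℤ.- ℤ.+ q) ∷ β) → Vanishes (cs ++ β)
  corner (snoc {ν = ν} {cs} {r} t r∈) q L eq le with q ℕP.≟ r
  ... | yes refl = cs , λ β van → subst Vanishes (trans (cong (λ l → cs ++ (ℤ.+ l ℤ.- ℤ.+ q) ∷ β) (sym L≡)) (sym (LP.++-assoc cs _ β))) van
    where
    L≡ : rowLen ν q ≡ L
    L≡ = ℕP.suc-injective (trans (sym (rowLen-add r ν (addable-≤ ν r∈))) eq)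
  ... | no q≢r = α ++ [ c ] , λ β van →
          subst Vanishes (sym (LP.++-assoc cs [ c ] β))
            (move (c ∷ β) (Vanishes-swap α (above⇒sq≢1 cmp) (subst Vanishes (LP.++-assoc α [ c ] _) van)))
    where
    c = addContent ν r
    b = ℤ.+ L ℤ.- ℤ.+ q
    anti = Tab-antitone t
    eq′ : rowLen ν q ≡ suc L
    eq′ = trans (sym (rowLen-other r ν q (addable-≤ ν r∈) q≢r)) eq
    le′ : rowLen ν (suc q) ≤ L
    le′ with suc q ℕP.≟ r
    ... | yes refl = ℕP.<⇒≤ (subst (_≤ L) (rowLen-add r ν (addable-≤ ν r∈)) le)
    ... | no sq≢r  = subst (_≤ L) (rowLen-other r ν (suc q) (addable-≤ ν r∈) sq≢r) le
    ih = corner t q L eq′ le′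
    α = proj₁ ih
    move = proj₂ ih
    -- Both cells are corners of `addToRow r ν` in different rows, so the lower one also lies
    -- strictly further left and the contents differ by at least two.
    cmp : Above b c ⊎ Above c b
    cmp with ℕP.<-cmp q r
    ... | tri≈ _ q≡r _ = ⊥-elim (q≢r q≡r)
    ... | tri< q<r _ _ = inj₁ (above (subst (_≤ L) (rowLen-add r ν (addable-≤ ν r∈)) (ℕP.≤-trans (antitone-≤ (addToRow r ν) (antitone-add ν anti r∈) q<r) le)) q<r)
    ... | tri> _ _ r<q = inj₂ (above (subst (_≤ rowLen ν r) eq′ (antitone-≤ ν anti (ℕP.<⇒≤ r<q))) r<q)

  AddContent : List ℕ → ℤ → Set
  AddContent ν c = Σ ℕ λ r → r ∈ addableRows ν × c ≡ addContent ν r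

  module _ {k ν cs r} (t : Tab k ν cs) (r∈ : r ∈ addableRows ν) where
    private
      L = rowLen ν r
      a = addContent ν r
      anti = Tab-antitone t
      ν′ = addToRow r ν
      r≤ = addable-≤ ν r∈

    corner-vanishes : ∀ q l → rowLen ν q ≡ suc l → rowLen ν (suc q) ≤ l →
                      ((ℤ.+ l ℤ.- ℤ.+ q) ℤ.- a) ℤ.* ((ℤ.+ l ℤ.- ℤ.+ q) ℤ.- a) ≡ ℤ.+ 1 →
                      Vanishes ((cs ++ [ a ]) ++ [ ℤ.+ l ℤ.- ℤ.+ q ])
    corner-vanishes q l eq le sq≡1 with corner t q l eq le
    ... | α , move = subst Vanishes (sym (LP.++-assoc cs [ a ] _)) (move _ (Vanishes-braid α sq≡1))

    -- Adding a cell to row `r` keeps any other addable row addable: its own length is unchanged and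
    -- the row above it can only grow.
    next-far : ∀ {r′} → r′ ∈ addableRows ν → r′ ≢ r → AddContent ν′ (addContent ν r′)
    next-far {r′} r′∈ r′≢r = r′ , addable r′ r′∈ r′≢r , cong (λ l → ℤ.+ l ℤ.- ℤ.+ r′) (sym (rowLen-other r ν r′ r≤ r′≢r))
      where
      addable : ∀ r′ → r′ ∈ addableRows ν → r′ ≢ r → r′ ∈ addableRows ν′
      addable zero    _   _    = addable-zero ν′
      addable (suc q) q∈ sq≢r = addable⁺ ν′ (ℕP.≤-trans (ℕP.≤-reflexive (cong suc (rowLen-other r ν (suc q) r≤ sq≢r)))
                                               (ℕP.≤-trans (addable⁻ ν q∈) grow))
        where
        grow : rowLen ν q ≤ rowLen ν′ q
        grow with q ℕP.≟ r
        ... | yes refl = ℕP.≤-trans (ℕP.n≤1+n _) (ℕP.≤-reflexive (sym (rowLen-add r ν r≤)))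
        ... | no q≢r   = ℕP.≤-reflexive (sym (rowLen-other r ν q r≤ q≢r))

    -- `a + 1` belongs to the cell to the right of the new one. If that cell is not addable, the row
    -- above is exactly one longer than row `r` of `ν`; its last cell is then a corner of `ν`, and
    -- it has content `a + 1`.
    next-right : AddContent ν′ (a ℤ.+ ℤ.+ 1) ⊎ Vanishes ((cs ++ [ a ]) ++ [ a ℤ.+ ℤ.+ 1 ])
    next-right = go r refl
      where
      right : ∀ L r → (L ℤ.- r) ℤ.+ ℤ.+ 1 ≡ (ℤ.+ 1 ℤ.+ L) ℤ.- r
      right = ℤ-solve-∀
      content : a ℤ.+ ℤ.+ 1 ≡ addContent ν′ r
      content = trans (right (ℤ.+ L) (ℤ.+ r)) (cong (λ l → ℤ.+ l ℤ.- ℤ.+ r) (sym (rowLen-add r ν r≤)))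
      go : ∀ r₀ → r₀ ≡ r → AddContent ν′ (a ℤ.+ ℤ.+ 1) ⊎ Vanishes ((cs ++ [ a ]) ++ [ a ℤ.+ ℤ.+ 1 ])
      go zero refl = inj₁ (0 , addable-zero ν′ , content)
      go (suc q) refl with suc (suc L) ℕP.≤? rowLen ν q
      ... | yes h = inj₁ (r , addable⁺ ν′ (subst₂ _<_ (sym (rowLen-add r ν r≤)) (sym (rowLen-other r ν q r≤ (ℕP.<⇒≢ (ℕP.n<1+n q)))) h) , content)
      ... | no h  = inj₂ (subst (λ c → Vanishes ((cs ++ [ a ]) ++ [ c ])) (up (ℤ.+ L) (ℤ.+ q))
                           (corner-vanishes q L (ℕP.≤-antisym (ℕP.≤-pred (ℕP.≰⇒> h)) (addable⁻ ν r∈)) ℕP.≤-refl (sq (ℤ.+ L) (ℤ.+ q))))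
        where
        up : ∀ L q → L ℤ.- q ≡ (L ℤ.- (ℤ.+ 1 ℤ.+ q)) ℤ.+ ℤ.+ 1
        up = ℤ-solve-∀
        sq : ∀ L q → ((L ℤ.- q) ℤ.- (L ℤ.- (ℤ.+ 1 ℤ.+ q))) ℤ.* ((L ℤ.- q) ℤ.- (L ℤ.- (ℤ.+ 1 ℤ.+ q))) ≡ ℤ.+ 1
        sq = ℤ-solve-∀

    -- `a − 1` belongs to the cell below the new one. If row `suc r` is shorter than row `r` of `ν`,
    -- the last cell of row `r` is a corner of `ν`, and it has content `a − 1`.
    next-below : AddContent ν′ (a ℤ.- ℤ.+ 1) ⊎ Vanishes ((cs ++ [ a ]) ++ [ a ℤ.- ℤ.+ 1 ])
    next-below with rowLen ν (suc r) ℕP.≟ L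
    ... | yes eq = inj₁ (suc r , addable⁺ ν′ (ℕP.≤-trans (s≤s (ℕP.≤-reflexive (trans other eq))) (ℕP.≤-reflexive (sym (rowLen-add r ν r≤)))) ,
                         trans (down (ℤ.+ L) (ℤ.+ r)) (cong (λ l → ℤ.+ l ℤ.- ℤ.+ suc r) (sym (trans other eq))))
      where
      other : rowLen ν′ (suc r) ≡ rowLen ν (suc r)
      other = rowLen-other r ν (suc r) r≤ (λ e → ℕP.<⇒≢ (ℕP.n<1+n r) (sym e))
      down : ∀ L r → (L ℤ.- r) ℤ.- ℤ.+ 1 ≡ L ℤ.- (ℤ.+ 1 ℤ.+ r)
      down = ℤ-solve-∀
    ... | no neq = go L refl (ℕP.≤∧≢⇒< (anti r) neq)
      where
      go : ∀ l → l ≡ L → rowLen ν (suc r) < l → AddContent ν′ (a ℤ.- ℤ.+ 1) ⊎ Vanishes ((cs ++ [ a ]) ++ [ a ℤ.- ℤ.+ 1 ])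
      go (suc l) eq (s≤s h) = inj₂ (subst (λ c → Vanishes ((cs ++ [ a ]) ++ [ c ])) a-1
                                (corner-vanishes r l (sym eq) h (trans (cong (λ x → (x ℤ.- a) ℤ.* (x ℤ.- a)) a-1) (sq a))))
        where
        pred′ : ∀ l r → l ℤ.- r ≡ ((ℤ.+ 1 ℤ.+ l) ℤ.- r) ℤ.- ℤ.+ 1
        pred′ = ℤ-solve-∀
        a-1 : ℤ.+ l ℤ.- ℤ.+ r ≡ a ℤ.- ℤ.+ 1
        a-1 = trans (pred′ (ℤ.+ l) (ℤ.+ r)) (cong (λ x → (ℤ.+ x ℤ.- ℤ.+ r) ℤ.- ℤ.+ 1) eq)
        sq : ∀ a → ((a ℤ.- ℤ.+ 1) ℤ.- a) ℤ.* ((a ℤ.- ℤ.+ 1) ℤ.- a) ≡ ℤ.+ 1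
        sq = ℤ-solve-∀

  module At (ν : List ℕ) (anti : Antitone ν) = Nodes (addableRows ν) (addContent ν) (addable-unique ν) (addContent-injective ν anti)

  decompose : ∀ {k ν cs} → Tab k ν cs → k < n → ∀ z → JE 0 cs z → Splits k cs (AddContent ν) z
  -- `X 0` is zero, and `0` is the content of the only cell addable to the empty shape.
  decompose nil k<n z _ =
    more {c = ℤ.+ 0} (0 , here refl , refl) [] (eig λ π → trans (X-zero z π) (sym (ℚP.*-zeroˡ (z π)))) (none {v = λ _ → 0ℚ} (λ _ → refl)) (λ π → sym (ℚP.+-identityʳ (z π)))
  decompose {ν = ν′} (snoc {k} {ν} {cs} {r} t r∈) k<n z es =
    Splits-refine refine (Tab-length (snoc t r∈)) k<n
      (At.Step.decompose-next ν anti (Tab-length t) k<n r r∈ (λ r′∈ r′≢r → above⇒sq≢1 (addable-compare ν anti r′∈ r∈ r′≢r))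
        (decompose t (ℕP.<-trans (ℕP.n<1+n k) k<n)) z es)
    where
    anti = Tab-antitone t
    a = addContent ν r
    refine : ∀ {c} → (Σ ℕ λ r′ → r′ ∈ addableRows ν × r′ ≢ r × c ≡ addContent ν r′) ⊎ (c ≡ a ℤ.+ ℤ.+ 1) ⊎ (c ≡ a ℤ.- ℤ.+ 1) →
             AddContent ν′ c ⊎ Vanishes ((cs ++ [ a ]) ++ [ c ])
    refine (inj₁ (r′ , r′∈ , r′≢r , refl)) = inj₁ (next-far t r∈ r′∈ r′≢r)
    refine (inj₂ (inj₁ refl)) = next-right t r∈
    refine (inj₂ (inj₂ refl)) = next-below t r∈

-- Tableaux as words and Murphy's products as operators

addRows : List ℕ → List ℕ → List ℕ
addRows = foldl (λ ν r → addToRow r ν)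

shapeOf-snoc : ∀ w r → shapeOf (w ++ [ r ]) ≡ addToRow r (shapeOf w)
shapeOf-snoc w r = LP.foldl-++ (λ ν r → addToRow r ν) [] w [ r ]

lastRow-snoc : ∀ w r → lastRow (w ++ [ r ]) ≡ r
lastRow-snoc []          r = refl
lastRow-snoc (_ ∷ [])    r = refl
lastRow-snoc (_ ∷ x ∷ w) r = lastRow-snoc (x ∷ w) r

SYTs-snoc⁻ : ∀ k {w} → w ∈ SYTs (suc k) →
             Σ (List ℕ) λ w₀ → Σ ℕ λ r → w₀ ∈ SYTs k × r ∈ addableRows (shapeOf w₀) × w ≡ w₀ ++ [ r ]
SYTs-snoc⁻ k w∈ with find (∈-concatMap⁻ (λ w → map (λ r → w ++ [ r ]) (addableRows (shapeOf w))) {xs = SYTs k} w∈)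
... | w₀ , w₀∈ , w∈′ with ∈-map⁻ (λ r → w₀ ++ [ r ]) w∈′
...   | r , r∈ , eq = w₀ , r , w₀∈ , r∈ , eq

SYTs-length : ∀ k {w} → w ∈ SYTs k → length w ≡ k
SYTs-length zero (here refl) = refl
SYTs-length (suc k) w∈ with SYTs-snoc⁻ k w∈
... | w₀ , r , w₀∈ , _ , refl = trans (LP.length-++ w₀) (trans (ℕP.+-comm (length w₀) 1) (cong suc (SYTs-length k w₀∈)))

-- Column minus row with both counted from one, the form that `cont` has.
lastContent : List ℕ → ℤ
lastContent w = ℤ.+ rowLen (shapeOf w) (lastRow w) ℤ.- ℤ.+ suc (lastRow w)

lastContent-snoc : ∀ w r → r ∈ addableRows (shapeOf w) → lastContent (w ++ [ r ]) ≡ addContent (shapeOf w) r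
lastContent-snoc w r r∈ rewrite shapeOf-snoc w r | lastRow-snoc w r | rowLen-add r (shapeOf w) (addable-≤ (shapeOf w) r∈) =
  ident (ℤ.+ rowLen (shapeOf w) r) (ℤ.+ r)
  where
  ident : ∀ L r → (ℤ.+ 1 ℤ.+ L) ℤ.- (ℤ.+ 1 ℤ.+ r) ≡ L ℤ.- r
  ident = ℤ-solve-∀

otherContents : List ℕ → ℕ → List ℤ
otherContents ν r = map (addContent ν) (filterᵇ (λ r′ → not (r′ ≡ᵇ r)) (addableRows ν))

module YoungBasis {I : Set} {n : ℕ} {X S : ℕ → Vect {I} → Vect} (jm : JucysMurphy n X S) where
  open JM jm
  open Lagrange jm
  open Spectrum jm

  factorOp : ℕ → List ℕ → ℕ → Vect → Vect
  factorOp k ν r = lag k (addContent ν r) (otherContents ν r)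

  factorOp-linear : ∀ k ν r → Linear (factorOp k ν r)
  factorOp-linear k ν r = lag-linear k (addContent ν r) (otherContents ν r)

  factorOp-X : ∀ {k j} ν r → k < n → j < n → ∀ v → factorOp k ν r (X j v) ≈ X j (factorOp k ν r v)
  factorOp-X {k} {j} ν r k<n j<n v π = sym (lag-comm k (addContent ν r) (otherContents ν r) (X-linear j) (X-X j<n k<n) v π)

  young : ℕ → List ℕ → List ℕ → Vect → Vect
  young k ν []       u = u
  young k ν (r ∷ rs) u = factorOp k ν r (young (suc k) (addToRow r ν) rs u)

  -- `young` reads a word from the front, whereas tableaux grow at the back. The factors commute, so
  -- the newest one can be brought outside.
  young-snoc : ∀ k ν rs r u → k ℕ.+ length rs < n →
               young k ν (rs ++ [ r ]) u ≈ factorOp (k ℕ.+ length rs) (addRows ν rs) r (young k ν rs u)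
  young-snoc k ν [] r u k<n π = cong (λ j → factorOp j ν r u π) (sym (ℕP.+-identityʳ k))
  young-snoc k ν (r₀ ∷ rs) r u k<n π = begin
    factorOp k ν r₀ (young (suc k) ν₀ (rs ++ [ r ]) u) π
      ≡⟨ respects (factorOp-linear k ν r₀) (young-snoc (suc k) ν₀ rs r u k+<n) π ⟩
    factorOp k ν r₀ (factorOp (suc k ℕ.+ length rs) μ r y) π
      ≡⟨ lag-comm (suc k ℕ.+ length rs) (addContent μ r) (otherContents μ r) (factorOp-linear k ν r₀)
           (factorOp-X ν r₀ (ℕP.≤-trans (s≤s (ℕP.m≤m+n k _)) k<n) k+<n) y π ⟩
    factorOp (suc k ℕ.+ length rs) μ r (factorOp k ν r₀ y) π
      ≡⟨ cong (λ j → factorOp j μ r (factorOp k ν r₀ y) π) (ℕP.+-suc k (length rs)) ⟨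
    factorOp (k ℕ.+ suc (length rs)) μ r (factorOp k ν r₀ y) π ∎
    where
    open ≡-Reasoning
    ν₀ = addToRow r₀ ν
    μ = addRows ν₀ rs
    y = young (suc k) ν₀ rs u
    k+<n : suc k ℕ.+ length rs < n
    k+<n = subst (_< n) (ℕP.+-suc k (length rs)) k<n

  Xpow : ℕ → ℕ → Vect → Vect
  Xpow k zero    v = v
  Xpow k (suc p) v = X k (Xpow k p v)

  module _ (u : Vect {I}) where

    e : List ℕ → Vect
    e w = young 0 [] w u

    e-snoc : ∀ {k w} r → w ∈ SYTs k → k < n → e (w ++ [ r ]) ≈ factorOp k (shapeOf w) r (e w)
    e-snoc {k} {w} r w∈ k<n π with SYTs-length k w∈
    ... | refl = young-snoc 0 [] w r u k<n π

    -- Mutual with `e-Eig`. Since `e w` splits by `decompose`, the next factor acts on it as a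
    -- projection and supplies the eigenvalue in the new place; the older eigenvalues survive
    -- because that factor commutes with the earlier `X j`.
    e-Tab : ∀ k {w} → k ≤ n → w ∈ SYTs k → Σ (List ℤ) λ cs → Tab k (shapeOf w) cs × JE 0 cs (e w)

    e-Eig : ∀ k {w r} → k < n → w ∈ SYTs k → r ∈ addableRows (shapeOf w) →
            Eig k (addContent (shapeOf w) r) (e (w ++ [ r ]))
    e-Eig k {w} {r} k<n w∈ r∈ with e-Tab k (ℕP.<⇒≤ k<n) w∈
    ... | cs , t , es = Eig-resp (λ π → sym (e-snoc r w∈ k<n π))
                          (At.proj-Eig (shapeOf w) (Tab-antitone t) k<n r∈ (decompose t k<n (e w) es))

    e-Tab zero    k≤n (here refl) = [] , nil , []
    e-Tab (suc k) k<n w∈ with SYTs-snoc⁻ k w∈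
    ... | w₀ , r , w₀∈ , r∈ , refl with e-Tab k (ℕP.<⇒≤ k<n) w₀∈
    ...   | cs , t , es =
      cs ++ [ c ] ,
      subst (λ μ → Tab (suc k) μ (cs ++ [ c ])) (sym (shapeOf-snoc w₀ r)) (snoc t r∈) ,
      JE-++⁺ cs (JE-resp cs (λ π → sym (e-snoc r w₀∈ k<n π))
                  (JE-op cs (factorOp-linear k (shapeOf w₀) r)
                    (λ j _ j< → factorOp-X (shapeOf w₀) r k<n (ℕP.<-trans (subst (j <_) (Tab-length t) j<) k<n)) es))
                (subst (λ l → Eig l c (e (w₀ ++ [ r ]))) (sym (Tab-length t)) (e-Eig k k<n w₀∈ r∈) ∷ [])
      where c = addContent (shapeOf w₀) r

    -- The factors for the addable rows of `shapeOf w` are complementary projections on `e w`, so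
    -- the one-cell extensions of `w` add back up to `e w`.
    ∑-e : ∀ k → k ≤ n → ∀ π → ∑ (SYTs k) (λ w → e w π) ≡ u π
    ∑-e zero    k≤n π = ℚP.+-identityʳ (u π)
    ∑-e (suc k) k<n π = begin
      ∑ (SYTs (suc k)) (λ w → e w π)                                             ≡⟨ ∑-concatMap _ (SYTs k) (λ w → e w π) ⟩
      ∑ (SYTs k) (λ w → ∑ (map (λ r → w ++ [ r ]) (addableRows (shapeOf w))) (λ w → e w π)) ≡⟨ ∑-cong (SYTs k) inner ⟩
      ∑ (SYTs k) (λ w → e w π)                                                   ≡⟨ ∑-e k (ℕP.<⇒≤ k<n) π ⟩
      u π                                                                        ∎
      where
      open ≡-Reasoning
      inner : ∀ {w} → w ∈ SYTs k → ∑ (map (λ r → w ++ [ r ]) (addableRows (shapeOf w))) (λ w → e w π) ≡ e w π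
      inner {w} w∈ with e-Tab k (ℕP.<⇒≤ k<n) w∈
      ... | cs , t , es = begin
        ∑ (map (λ r → w ++ [ r ]) (addableRows (shapeOf w))) (λ w → e w π)        ≡⟨ ∑-map (λ r → w ++ [ r ]) (addableRows (shapeOf w)) (λ w → e w π) ⟩
        ∑ (addableRows (shapeOf w)) (λ r → e (w ++ [ r ]) π)                      ≡⟨ ∑-cong (addableRows (shapeOf w)) (λ {r} _ → e-snoc r w∈ k<n π) ⟩
        ∑ (addableRows (shapeOf w)) (λ r → factorOp k (shapeOf w) r (e w) π)      ≡⟨ At.∑-proj (shapeOf w) (Tab-antitone t) k<n (decompose t k<n (e w) es) π ⟩
        e w π                                                                     ∎

    Xpow-spectral : ∀ k → k < n → ∀ p π →
      Xpow k p u π ≡ ∑ (SYTs (suc k)) (λ w → (fromℤℚ (lastContent w) ^ℚ p) * e w π)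
    Xpow-spectral k k<n zero π = trans (sym (∑-e (suc k) k<n π)) (∑-cong (SYTs (suc k)) (λ {w} _ → sym (ℚP.*-identityˡ (e w π))))
    Xpow-spectral k k<n (suc p) π = begin
      X k (Xpow k p u) π                                                  ≡⟨ respects (X-linear k) (Xpow-spectral k k<n p) π ⟩
      X k (λ ρ → ∑ (SYTs (suc k)) (λ w → (c w ^ℚ p) * e w ρ)) π           ≡⟨ on-∑ (X-linear k) (SYTs (suc k)) (λ w ρ → (c w ^ℚ p) * e w ρ) π ⟩
      ∑ (SYTs (suc k)) (λ w → X k (λ ρ → (c w ^ℚ p) * e w ρ) π)           ≡⟨ ∑-cong (SYTs (suc k)) step ⟩
      ∑ (SYTs (suc k)) (λ w → (c w ^ℚ suc p) * e w π)                     ∎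
      where
      open ≡-Reasoning
      c : List ℕ → ℚ
      c w = fromℤℚ (lastContent w)
      eigen : ∀ {w} → w ∈ SYTs (suc k) → ∀ ρ → X k (e w) ρ ≡ c w * e w ρ
      eigen w∈ ρ with SYTs-snoc⁻ k w∈
      ... | w₀ , r , w₀∈ , r∈ , refl = trans (at (e-Eig k k<n w₀∈ r∈) ρ) (cong (λ z → fromℤℚ z * e (w₀ ++ [ r ]) ρ) (sym (lastContent-snoc w₀ r r∈)))
      step : ∀ {w} → w ∈ SYTs (suc k) → X k (λ ρ → (c w ^ℚ p) * e w ρ) π ≡ (c w ^ℚ suc p) * e w π
      step {w} w∈ = begin
        X k (λ ρ → (c w ^ℚ p) * e w ρ) π    ≡⟨ on-scalar (X-linear k) (c w ^ℚ p) (e w) (λ _ → refl) π ⟩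
        (c w ^ℚ p) * X k (e w) π            ≡⟨ cong ((c w ^ℚ p) *_) (eigen w∈ π) ⟩
        (c w ^ℚ p) * (c w * e w π)          ≡⟨ ℚP.*-assoc (c w ^ℚ p) (c w) (e w π) ⟨
        ((c w ^ℚ p) * c w) * e w π          ≡⟨ cong (_* e w π) (ℚP.*-comm (c w ^ℚ p) (c w)) ⟩
        (c w ^ℚ suc p) * e w π              ∎

unique-↭ : ∀ {A : Set} {xs ys : List A} → Unique xs → Unique ys →
           (∀ {x} → x ∈ xs → x ∈ ys) → (∀ {x} → x ∈ ys → x ∈ xs) → xs ↭ ys
unique-↭ u v f g = ∼bag⇒↭ (unique∧set⇒bag u v (mk⇔ f g))

-- Transpositions acting on one-line notation

sw : ∀ {n} → Fin n → Fin n → Fin n → Fin n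
sw a b x = if does (x Fin.≟ a) then b else (if does (x Fin.≟ b) then a else x)

module _ {n : ℕ} where

  sw-left : ∀ (a b : Fin n) → sw a b a ≡ b
  sw-left a b rewrite dec-true (a Fin.≟ a) refl = refl

  sw-right : ∀ (a b : Fin n) → sw a b b ≡ a
  sw-right a b with b Fin.≟ a
  ... | yes b≡a = b≡a
  ... | no _ rewrite dec-true (b Fin.≟ b) refl = refl

  sw-fix : ∀ (a b x : Fin n) → x ≢ a → x ≢ b → sw a b x ≡ x
  sw-fix a b x x≢a x≢b rewrite dec-false (x Fin.≟ a) x≢a | dec-false (x Fin.≟ b) x≢b = refl

  sw-conj : ∀ (f : Fin n → Fin n) → (∀ {x y} → f x ≡ f y → x ≡ y) → ∀ a b x →
            f (sw a b x) ≡ sw (f a) (f b) (f x)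
  sw-conj f inj a b x with x Fin.≟ a
  ... | yes refl = sym (sw-left (f x) (f b))
  ... | no x≢a with x Fin.≟ b
  ...   | yes refl = sym (sw-right (f a) (f x))
  ...   | no x≢b   = sym (sw-fix (f a) (f b) (f x) (x≢a ∘ inj) (x≢b ∘ inj))

  sw-involutive : ∀ (a b x : Fin n) → sw a b (sw a b x) ≡ x
  sw-involutive a b x with x Fin.≟ a
  ... | yes refl = sw-right x b
  ... | no x≢a with x Fin.≟ b
  ...   | yes refl = sw-left a x
  ...   | no x≢b   = sw-fix a b x x≢a x≢b

  involutive⇒injective : ∀ {f : Fin n → Fin n} → (∀ x → f (f x) ≡ x) → ∀ {x y} → f x ≡ f y → x ≡ y
  involutive⇒injective {f} inv {x} {y} eq = trans (sym (inv x)) (trans (cong f eq) (inv y))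

  sw-sw : ∀ (a b c d x : Fin n) → sw a b (sw c d x) ≡ sw (sw a b c) (sw a b d) (sw a b x)
  sw-sw a b = sw-conj (sw a b) (involutive⇒injective (sw-involutive a b))

  -- Left multiplication by `f`: values are relabelled and positions stay.
  act : (Fin n → Fin n) → Perm n → Perm n
  act f π = Vec.map f π

  act-cong : ∀ {f g h k : Fin n → Fin n} → (∀ x → f (g x) ≡ h (k x)) → ∀ π → act f (act g π) ≡ act h (act k π)
  act-cong {f} {g} {h} {k} eq π =
    trans (sym (VecP.map-∘ f g π)) (trans (VecP.map-cong eq π) (VecP.map-∘ h k π))

  act-involutive : ∀ {f : Fin n → Fin n} → (∀ x → f (f x) ≡ x) → ∀ π → act f (act f π) ≡ π
  act-involutive {f} inv π = trans (sym (VecP.map-∘ f f π)) (trans (VecP.map-cong inv π) (VecP.map-id π))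

  lookup-transp : ∀ (a b x : Fin n) → Vec.lookup (transp a b) x ≡ sw a b x
  lookup-transp a b x = VecP.lookup∘tabulate (sw a b) x

  transp-∘ : ∀ (a b : Fin n) π → transp a b ∘ᴾ π ≡ act (sw a b) π
  transp-∘ a b π = trans (VecP.tabulate-cong (λ x → lookup-transp a b (Vec.lookup π x)))
                         (trans (VecP.tabulate-∘ (sw a b) (Vec.lookup π)) (cong (Vec.map (sw a b)) (VecP.tabulate∘lookup π)))

-- Jucys–Murphy operators

-- Saturates at the last point, so that the operators can be indexed by all of `ℕ`; `toℕ-el` gives
-- its meaning in range.
el : ∀ {m} → ℕ → Fin (suc m)
el zero            = Fin.zero
el {zero}  (suc k) = Fin.zero
el {suc m} (suc k) = Fin.suc (el k)

toℕ-el : ∀ {m k} → k < suc m → toℕ (el {m} k) ≡ k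
toℕ-el {m}     {zero}  _       = refl
toℕ-el {suc m} {suc k} (s≤s h) = cong suc (toℕ-el h)

below : ∀ n → ℕ → List (Fin n)
below n k = filterᵇ (λ j → toℕ j <ᵇ k) (allFin n)

module _ {n : ℕ} where
  below-unique : ∀ k → Unique (below n k)
  below-unique k = Unique.filter⁺ (λ j → T? (toℕ j <ᵇ k)) (Unique.allFin⁺ n)

  ∈-below⁺ : ∀ {j : Fin n} {k} → toℕ j < k → j ∈ below n k
  ∈-below⁺ {j} {k} j<k = ∈-filterᵇ⁺ (λ j → toℕ j <ᵇ k) (∈-allFin j) (ℕP.<⇒<ᵇ j<k)

  ∈-below⁻ : ∀ {j : Fin n} {k} → j ∈ below n k → toℕ j < k
  ∈-below⁻ {j} {k} j∈ = ℕP.<ᵇ⇒< (toℕ j) k (proj₂ (∈-filterᵇ⁻ (λ j → toℕ j <ᵇ k) (allFin n) j∈))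

∑-involution : ∀ {A : Set} {xs : List A} (f : A → A) → Unique xs → (∀ x → f (f x) ≡ x) →
               (∀ {x} → x ∈ xs → f x ∈ xs) → ∀ (h : A → ℚ) → ∑ xs (h ∘ f) ≡ ∑ xs h
∑-involution {xs = xs} f u inv stable h =
  trans (sym (∑-map f xs h))
        (∑-↭ h (unique-↭ (Unique.map⁺ (λ {x} {y} eq → trans (sym (inv x)) (trans (cong f eq) (inv y))) u) u to from))
  where
  to : ∀ {x} → x ∈ map f xs → x ∈ xs
  to x∈ with ∈-map⁻ f x∈
  ... | y , y∈ , refl = stable y∈
  from : ∀ {x} → x ∈ xs → x ∈ map f xs
  from {x} x∈ = subst (_∈ map f xs) (inv x) (∈-map⁺ f (stable x∈))

∈-allVecs : ∀ {n k} (v : Vec (Fin n) k) → v ∈ allVecs k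
∈-allVecs []      = here refl
∈-allVecs (x ∷ v) = ∈-concatMap⁺ _ (lose (∈-allFin x) (∈-map⁺ (x ∷_) (∈-allVecs v)))

-- The coordinates range independently, so the relabelling is a reindexing of one coordinate at a
-- time. It makes every transposition self-adjoint.
∑-allVecs-involution : ∀ {n} (f : Fin n → Fin n) → (∀ x → f (f x) ≡ x) → ∀ k (h : Vec (Fin n) k → ℚ) →
                       ∑ (allVecs k) (h ∘ Vec.map f) ≡ ∑ (allVecs k) h
∑-allVecs-involution f inv zero    h = refl
∑-allVecs-involution {n} f inv (suc k) h = begin
  ∑ (allVecs (suc k)) (h ∘ Vec.map f)                                 ≡⟨ expand (h ∘ Vec.map f) ⟩
  ∑ (allFin n) (λ x → ∑ (allVecs k) (λ v → h (f x ∷ Vec.map f v)))    ≡⟨ ∑-cong (allFin n) (λ {x} _ → ∑-allVecs-involution f inv k (λ v → h (f x ∷ v))) ⟩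
  ∑ (allFin n) (λ x → ∑ (allVecs k) (λ v → h (f x ∷ v)))              ≡⟨ ∑-involution f (Unique.allFin⁺ n) inv (λ {x} _ → ∈-allFin (f x)) (λ x → ∑ (allVecs k) (λ v → h (x ∷ v))) ⟩
  ∑ (allFin n) (λ x → ∑ (allVecs k) (λ v → h (x ∷ v)))                ≡⟨ expand h ⟨
  ∑ (allVecs (suc k)) h                                               ∎
  where
  open ≡-Reasoning
  expand : ∀ (h : Vec (Fin n) (suc k) → ℚ) → ∑ (allVecs (suc k)) h ≡ ∑ (allFin n) (λ x → ∑ (allVecs k) (λ v → h (x ∷ v)))
  expand h = trans (∑-concatMap _ (allFin n) h) (∑-cong (allFin n) (λ {x} _ → ∑-map (x ∷_) (allVecs k) h))

square-nonNeg : ∀ p → 0ℚ ℚ.≤ p * p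
square-nonNeg p with ℚP.≤-total 0ℚ p
... | inj₁ 0≤p = ℚP.nonNegative⁻¹ (p * p) {{ℚP.nonNeg*nonNeg⇒nonNeg p {{ℚ.nonNegative 0≤p}} p {{ℚ.nonNegative 0≤p}}}}
... | inj₂ p≤0 = ℚP.nonNegative⁻¹ (p * p) {{ℚP.nonPos*nonPos⇒nonPos p {{ℚ.nonPositive p≤0}} p {{ℚ.nonPositive p≤0}}}}

∑-squares-nonNeg : ∀ {A : Set} (xs : List A) (w : A → ℚ) → 0ℚ ℚ.≤ ∑ xs (λ x → w x * w x)
∑-squares-nonNeg []       w = ℚP.≤-refl
∑-squares-nonNeg (x ∷ xs) w = ℚP.+-mono-≤ (square-nonNeg (w x)) (∑-squares-nonNeg xs w)

∑-squares≡0 : ∀ {A : Set} {xs : List A} (w : A → ℚ) → ∑ xs (λ x → w x * w x) ≡ 0ℚ → ∀ {x} → x ∈ xs → w x ≡ 0ℚ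
∑-squares≡0 {xs = y ∷ xs} w eq = λ where
    (here refl) → square≡0 (ℚP.≤-antisym (ℚP.≤-trans head≤ (ℚP.≤-reflexive eq)) (square-nonNeg (w y)))
    (there x∈)  → ∑-squares≡0 w (ℚP.≤-antisym (ℚP.≤-trans tail≤ (ℚP.≤-reflexive eq)) (∑-squares-nonNeg xs w)) x∈
  where
  head≤ : w y * w y ℚ.≤ w y * w y + ∑ xs (λ x → w x * w x)
  head≤ = subst (ℚ._≤ w y * w y + ∑ xs (λ x → w x * w x)) (ℚP.+-identityʳ (w y * w y)) (ℚP.+-monoʳ-≤ (w y * w y) (∑-squares-nonNeg xs w))
  tail≤ : ∑ xs (λ x → w x * w x) ℚ.≤ w y * w y + ∑ xs (λ x → w x * w x)
  tail≤ = subst (ℚ._≤ w y * w y + ∑ xs (λ x → w x * w x)) (ℚP.+-identityˡ _) (ℚP.+-monoˡ-≤ (∑ xs (λ x → w x * w x)) (square-nonNeg (w y)))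
  square≡0 : ∀ {p} → p * p ≡ 0ℚ → p ≡ 0ℚ
  square≡0 {p} h with p ℚ.≟ 0ℚ
  ... | yes p≡0 = p≡0
  ... | no p≢0  = q*p≡0⇒p≡0 p p p≢0 h

module Operators (m : ℕ) where
  private
    n = suc m

    V : List (Perm n)
    V = allVecs n

  T′ : Fin n → Fin n → Vect → Vect
  T′ a b u π = u (act (sw a b) π)

  X S : ℕ → Vect → Vect
  X k u π = ∑ (below n k) (λ j → u (act (sw j (el k)) π))
  S k = T′ (el k) (el (suc k))

  X-linear : ∀ k → Linear (X k)
  X-linear k = record
    { respects = λ eq π → ∑-cong (below n k) (λ {j} _ → eq (act (sw j (el k)) π))
    ; on-lin   = λ a u b v π → trans (∑-+ (below n k) _ _) (cong₂ _+_ (∑-*ˡ (below n k) a _) (∑-*ˡ (below n k) b _)) }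

  S-linear : ∀ k → Linear (S k)
  S-linear k = record { respects = λ eq π → eq _ ; on-lin = λ a u b v π → refl }

  el≢ : ∀ {i j} → i < n → j < n → i ≢ j → el {m} i ≢ el j
  el≢ i<n j<n i≢j eq = i≢j (trans (sym (toℕ-el i<n)) (trans (cong toℕ eq) (toℕ-el j<n)))

  below≢ : ∀ {k j} {i : Fin n} → i ∈ below n k → k ≤ j → j < n → i ≢ el j
  below≢ i∈ k≤j j<n refl = ℕP.<⇒≱ (∈-below⁻ i∈) (subst (_ ≤_) (sym (toℕ-el j<n)) k≤j)

  X-zero : ∀ u π → X 0 u π ≡ 0ℚ
  X-zero u π = ∑-zero (below n 0) (λ {j} j∈ → ⊥-elim (ℕP.n≮0 (∈-below⁻ j∈)))

  S-S : ∀ {k} → suc k < n → ∀ u → S k (S k u) ≈ u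
  S-S {k} _ u π = cong u (act-involutive (sw-involutive (el k) (el (suc k))) π)

  -- The summand of `X (suc k)` at `el k` is the transposition `S k` itself and cancels against it,
  -- leaving `u`. Conjugation by `S k` turns the other summands into those of `X k`.
  X-S : ∀ {k} → suc k < n → ∀ u π → X (suc k) (S k u) π ≡ S k (X k u) π + u π
  X-S {k} k< u π = begin
    ∑ (below n (suc k)) f                     ≡⟨ ∑-↭ f perm ⟩
    f (el k) + ∑ (below n k) f                ≡⟨ cong₂ _+_ (S-S k< u π) (∑-cong (below n k) term) ⟩
    u π + S k (X k u) π                       ≡⟨ ℚP.+-comm (u π) _ ⟩
    S k (X k u) π + u π                       ∎
    where
    open ≡-Reasoning
    k<n : k < n
    k<n = ℕP.<-trans (ℕP.n<1+n k) k<
    s = sw (el {m} k) (el (suc k))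
    f : Fin n → ℚ
    f j = S k u (act (sw j (el (suc k))) π)
    perm : below n (suc k) ↭ el k ∷ below n k
    perm = unique-↭ (below-unique (suc k)) (All.tabulate (λ {j} j∈ eq → below≢ j∈ ℕP.≤-refl k<n (sym eq)) ∷ below-unique k) to from
      where
      to : ∀ {j} → j ∈ below n (suc k) → j ∈ el k ∷ below n k
      to {j} j∈ with ℕP.m≤n⇒m<n∨m≡n (ℕP.≤-pred (∈-below⁻ j∈))
      ... | inj₁ j<k = there (∈-below⁺ j<k)
      ... | inj₂ j≡k = here (FinP.toℕ-injective (trans j≡k (sym (toℕ-el k<n))))
      from : ∀ {j} → j ∈ el k ∷ below n k → j ∈ below n (suc k)
      from (here refl) = ∈-below⁺ (subst (_< suc k) (sym (toℕ-el k<n)) (ℕP.n<1+n k))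
      from (there j∈)  = ∈-below⁺ (ℕP.<-trans (∈-below⁻ j∈) (ℕP.n<1+n k))
    term : ∀ {j} → j ∈ below n k → f j ≡ u (act (sw j (el k)) (act s π))
    term {j} j∈ = cong u (act-cong swap′ π)
      where
      swap′ : ∀ x → s (sw j (el (suc k)) x) ≡ sw j (el k) (s x)
      swap′ x = trans (sw-sw (el k) (el (suc k)) j (el (suc k)) x)
                      (cong₂ (λ a b → sw a b (s x)) (sw-fix (el k) (el (suc k)) j (below≢ j∈ ℕP.≤-refl k<n) (below≢ j∈ (ℕP.n≤1+n k) k<)) (sw-right (el k) (el (suc k))))

  -- Conjugation by `s` fixes `el j` and permutes the points below `j`, because the two exchanged
  -- points lie both below `j` or both above it.
  S-X : ∀ {k j} → suc k < n → j < n → j ≢ k → j ≢ suc k → ∀ u → S k (X j u) ≈ X j (S k u)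
  S-X {k} {j} k< j<n j≢k j≢sk u π = begin
    ∑ (below n j) (λ i → u (act (sw i (el j)) (act s π)))        ≡⟨ ∑-involution s (below-unique j) (sw-involutive (el k) (el (suc k))) stable (λ i → u (act (sw i (el j)) (act s π))) ⟨
    ∑ (below n j) (λ i → u (act (sw (s i) (el j)) (act s π)))    ≡⟨ ∑-cong (below n j) (λ {i} _ → cong u (act-cong (swap′ i) π)) ⟨
    ∑ (below n j) (λ i → u (act s (act (sw i (el j)) π)))        ∎
    where
    open ≡-Reasoning
    k<n : k < n
    k<n = ℕP.<-trans (ℕP.n<1+n k) k<
    s = sw (el {m} k) (el (suc k))
    swap′ : ∀ i x → s (sw i (el j) x) ≡ sw (s i) (el j) (s x)
    swap′ i x = trans (sw-sw (el k) (el (suc k)) i (el j) x)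
                      (cong (λ b → sw (s i) b (s x)) (sw-fix (el k) (el (suc k)) (el j) (el≢ j<n k<n j≢k) (el≢ j<n k< j≢sk)))
    stable : ∀ {i} → i ∈ below n j → s i ∈ below n j
    stable {i} i∈ with i Fin.≟ el k
    ... | yes refl = ∈-below⁺ (subst (_< j) (sym (toℕ-el k<)) (ℕP.≤∧≢⇒< (subst (_< j) (toℕ-el k<n) (∈-below⁻ i∈)) (j≢sk ∘ sym)))
    ... | no i≢k with i Fin.≟ el (suc k)
    ...   | yes refl = ∈-below⁺ (subst (_< j) (sym (toℕ-el k<n)) (ℕP.<-trans (ℕP.n<1+n k) (subst (_< j) (toℕ-el k<) (∈-below⁻ i∈))))
    ...   | no i≢sk  = i∈

  -- Both sides are the action of one transposition `t`, that of the two outer points.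
  braid : ∀ {k} → suc (suc k) < n → ∀ u → S k (S (suc k) (S k u)) ≈ S (suc k) (S k (S (suc k) u))
  braid {k} k<< u π = cong u (begin
    act s₁ (act s₂ (act s₁ π))    ≡⟨ act-cong {h = t} {k = s₁} e₁ (act s₁ π) ⟩
    act t (act s₁ (act s₁ π))     ≡⟨ cong (act t) (act-involutive (sw-involutive (el k) (el (suc k))) π) ⟩
    act t π                       ≡⟨ cong (act t) (act-involutive (sw-involutive (el (suc k)) (el (suc (suc k)))) π) ⟨
    act t (act s₂ (act s₂ π))     ≡⟨ act-cong {h = t} {k = s₂} e₂ (act s₂ π) ⟨
    act s₂ (act s₁ (act s₂ π))    ∎)
    where
    open ≡-Reasoning
    k< : suc k < n
    k< = ℕP.<-trans (ℕP.n<1+n _) k<<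
    k<n : k < n
    k<n = ℕP.<-trans (ℕP.n<1+n _) k<
    s₁ = sw (el {m} k) (el (suc k))
    s₂ = sw (el {m} (suc k)) (el (suc (suc k)))
    t = sw (el {m} k) (el (suc (suc k)))
    e₁ : ∀ x → s₁ (s₂ x) ≡ t (s₁ x)
    e₁ x = trans (sw-sw (el k) (el (suc k)) (el (suc k)) (el (suc (suc k))) x)
                 (cong₂ (λ a b → sw a b (s₁ x)) (sw-right (el k) (el (suc k)))
                        (sw-fix (el k) (el (suc k)) (el (suc (suc k))) (el≢ k<< k<n (λ ())) (el≢ k<< k< (λ ()))))
    e₂ : ∀ x → s₂ (s₁ x) ≡ t (s₂ x)
    e₂ x = trans (sw-sw (el (suc k)) (el (suc (suc k))) (el k) (el (suc k)) x)
                 (cong₂ (λ a b → sw a b (s₂ x))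
                        (sw-fix (el (suc k)) (el (suc (suc k))) (el k) (el≢ k<n k< (λ ())) (el≢ k<n k<< (λ ())))
                        (sw-left (el (suc k)) (el (suc (suc k)))))

  ⟨_,_⟩ : Vect → Vect → ℚ
  ⟨ u , v ⟩ = ∑ V (λ π → u π * v π)

  X-adjoint : ∀ k u v → ⟨ X k u , v ⟩ ≡ ⟨ u , X k v ⟩
  X-adjoint k u v = begin
    ∑ V (λ π → X k u π * v π)                                   ≡⟨ ∑-cong V (λ {π} _ → sym (∑-*ʳ (below n k) (λ j → u (t j π)) (v π))) ⟩
    ∑ V (λ π → ∑ (below n k) (λ j → u (t j π) * v π))           ≡⟨ ∑-swap V (below n k) _ ⟩
    ∑ (below n k) (λ j → ∑ V (λ π → u (t j π) * v π))           ≡⟨ ∑-cong (below n k) (λ {j} _ → term j) ⟩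
    ∑ (below n k) (λ j → ∑ V (λ π → u π * v (t j π)))           ≡⟨ ∑-swap V (below n k) _ ⟨
    ∑ V (λ π → ∑ (below n k) (λ j → u π * v (t j π)))           ≡⟨ ∑-cong V (λ {π} _ → ∑-*ˡ (below n k) (u π) (λ j → v (t j π))) ⟩
    ∑ V (λ π → u π * X k v π)                                   ∎
    where
    open ≡-Reasoning
    t : Fin n → Perm n → Perm n
    t j = act (sw j (el k))
    term : ∀ j → ∑ V (λ π → u (t j π) * v π) ≡ ∑ V (λ π → u π * v (t j π))
    term j = trans (∑-cong V (λ {π} _ → cong (λ ρ → u (t j π) * v ρ) (sym (act-involutive (sw-involutive j (el k)) π))))
                   (∑-allVecs-involution (sw j (el k)) (sw-involutive j (el k)) n (λ π → u π * v (t j π)))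

  -- For `w = X_k u − b u`, self-adjointness gives `⟨w , w⟩ = ⟨u , X_k w⟩ − b ⟨u , w⟩ = 0`, and a
  -- sum of rational squares vanishes only if each term does.
  semisimple : ∀ {k} → k < n → ∀ b u → X k (lin 1ℚ (X k u) (- b) u) ≈ (λ π → b * lin 1ℚ (X k u) (- b) u π) →
               ∀ π → X k u π ≡ b * u π
  semisimple {k} _ b u h π = begin
    X k u π                ≡⟨ i₁ (X k u π) b (u π) ⟩
    w π + b * u π          ≡⟨ cong (_+ b * u π) (∑-squares≡0 w ww≡0 (∈-allVecs π)) ⟩
    0ℚ + b * u π           ≡⟨ ℚP.+-identityˡ _ ⟩
    b * u π                ∎
    where
    open ≡-Reasoning
    w : Vect
    w = lin 1ℚ (X k u) (- b) u
    i₁ : ∀ x b u → x ≡ (1ℚ * x + (- b) * u) + b * u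
    i₁ = solve-∀ ℚ-ring
    i₂ : ∀ x b u w → (1ℚ * x + (- b) * u) * w ≡ x * w + (- b) * (u * w)
    i₂ = solve-∀ ℚ-ring
    i₃ : ∀ b u w → u * (b * w) ≡ b * (u * w)
    i₃ = solve-∀ ℚ-ring
    i₄ : ∀ b x → b * x + (- b) * x ≡ 0ℚ
    i₄ = solve-∀ ℚ-ring
    ww≡0 : ∑ V (λ π → w π * w π) ≡ 0ℚ
    ww≡0 = begin
      ∑ V (λ π → w π * w π)                                      ≡⟨ ∑-cong V (λ {π} _ → i₂ (X k u π) b (u π) (w π)) ⟩
      ∑ V (λ π → X k u π * w π + (- b) * (u π * w π))            ≡⟨ ∑-+ V (λ π → X k u π * w π) (λ π → (- b) * (u π * w π)) ⟩
      ⟨ X k u , w ⟩ + ∑ V (λ π → (- b) * (u π * w π))            ≡⟨ cong₂ _+_ (X-adjoint k u w) (∑-*ˡ V (- b) (λ π → u π * w π)) ⟩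
      ⟨ u , X k w ⟩ + (- b) * ⟨ u , w ⟩                          ≡⟨ cong (_+ (- b) * ⟨ u , w ⟩) (trans (∑-cong V (λ {π} _ → trans (cong (u π *_) (h π)) (i₃ b (u π) (w π)))) (∑-*ˡ V b (λ π → u π * w π))) ⟩
      b * ⟨ u , w ⟩ + (- b) * ⟨ u , w ⟩                          ≡⟨ i₄ b ⟨ u , w ⟩ ⟩
      0ℚ                                                         ∎

  jucysMurphy : JucysMurphy n X S
  jucysMurphy = record
    { X-linear = X-linear ; S-linear = S-linear ; X-zero = X-zero ; S-S = S-S ; X-S = X-S ; S-X = S-X
    ; braid = braid ; semisimple = semisimple }

-- The group algebra

concatMap-unique : ∀ {A B : Set} (f : A → List B) {xs} → Unique xs → (∀ x → Unique (f x)) →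
                   (∀ {x y z} → z ∈ f x → z ∈ f y → x ≡ y) → Unique (concatMap f xs)
concatMap-unique f []       uf disj = []
concatMap-unique f {x ∷ xs} (x∉ ∷ u) uf disj =
  Unique.++⁺ (uf x) (concatMap-unique f u uf disj) λ (z∈ , z∈′) →
    let y , y∈ , z∈y = find (∈-concatMap⁻ f {xs = xs} z∈′) in All.lookup x∉ y∈ (disj z∈ z∈y)

allVecs-unique : ∀ {n} k → Unique (allVecs {n} k)
allVecs-unique zero        = [] ∷ []
allVecs-unique {n} (suc k) = concatMap-unique _ (Unique.allFin⁺ n)
  (λ x → Unique.map⁺ VecP.∷-injectiveʳ (allVecs-unique k)) disj
  where
  disj : ∀ {x y z} → z ∈ map (x ∷_) (allVecs k) → z ∈ map (y ∷_) (allVecs k) → x ≡ y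
  disj {x} {y} z∈ z∈′ with ∈-map⁻ (x ∷_) z∈ | ∈-map⁻ (y ∷_) z∈′
  ... | _ , _ , refl | _ , _ , eq = VecP.∷-injectiveˡ eq

allPerms-unique : ∀ n → Unique (allPerms n)
allPerms-unique n = Unique.filter⁺ (λ σ → T? (uniqueᵇ (Vec.toList σ))) (allVecs-unique n)

module _ {n : ℕ} where

  allᵇ⁻ : ∀ (x : Fin n) xs → T (allᵇ (λ y → not (does (x Fin.≟ y))) xs) → All (x ≢_) xs
  allᵇ⁻ x []       _ = []
  allᵇ⁻ x (y ∷ xs) t with x Fin.≟ y
  ... | no x≢y = x≢y ∷ allᵇ⁻ x xs t

  allᵇ⁺ : ∀ (x : Fin n) xs → All (x ≢_) xs → T (allᵇ (λ y → not (does (x Fin.≟ y))) xs)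
  allᵇ⁺ x []       []         = tt
  allᵇ⁺ x (y ∷ xs) (x≢y ∷ al) rewrite dec-false (x Fin.≟ y) x≢y = allᵇ⁺ x xs al

  uniqueᵇ⁻ : ∀ (xs : List (Fin n)) → T (uniqueᵇ xs) → Unique xs
  uniqueᵇ⁻ []       _ = []
  uniqueᵇ⁻ (x ∷ xs) t with allᵇ (λ y → not (does (x Fin.≟ y))) xs in eq
  ... | true = allᵇ⁻ x xs (subst T (sym eq) tt) ∷ uniqueᵇ⁻ xs t

  uniqueᵇ⁺ : ∀ {xs : List (Fin n)} → Unique xs → T (uniqueᵇ xs)
  uniqueᵇ⁺ []               = tt
  uniqueᵇ⁺ {x ∷ xs} (al ∷ u) with allᵇ (λ y → not (does (x Fin.≟ y))) xs | allᵇ⁺ x xs al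
  ... | true | _ = uniqueᵇ⁺ u

  ∈-allPerms⁺ : ∀ {π : Perm n} → IsPerm π → π ∈ allPerms n
  ∈-allPerms⁺ {π} p = ∈-filterᵇ⁺ (λ σ → uniqueᵇ (Vec.toList σ)) (∈-allVecs π) (uniqueᵇ⁺ p)

  ∈-allPerms⁻ : ∀ {π : Perm n} → π ∈ allPerms n → IsPerm π
  ∈-allPerms⁻ {π} π∈ = uniqueᵇ⁻ (Vec.toList π) (proj₂ (∈-filterᵇ⁻ (λ σ → uniqueᵇ (Vec.toList σ)) (allVecs n) π∈))

lookup-injective : ∀ {A : Set} {k} (v : Vec A k) → Unique (Vec.toList v) → ∀ {i j} → lookup v i ≡ lookup v j → i ≡ j
lookup-injective (x ∷ v) (x∉ ∷ u) {Fin.zero}  {Fin.zero}  _  = refl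
lookup-injective (x ∷ v) (x∉ ∷ u) {Fin.zero}  {Fin.suc j} eq = ⊥-elim (All.lookup x∉ (VM.∈-toList⁺ (VM.∈-lookup j v)) eq)
lookup-injective (x ∷ v) (x∉ ∷ u) {Fin.suc i} {Fin.zero}  eq = ⊥-elim (All.lookup x∉ (VM.∈-toList⁺ (VM.∈-lookup i v)) (sym eq))
lookup-injective (x ∷ v) (x∉ ∷ u) {Fin.suc i} {Fin.suc j} eq = cong Fin.suc (lookup-injective v u eq)

toList-tabulate : ∀ {A : Set} {k} (f : Fin k → A) → Vec.toList (tabulate f) ≡ List.tabulate f
toList-tabulate {k = zero}  f = refl
toList-tabulate {k = suc k} f = cong (f Fin.zero ∷_) (toList-tabulate (f ∘ Fin.suc))

tabulate-unique : ∀ {A : Set} {k} (f : Fin k → A) → (∀ {i j} → f i ≡ f j → i ≡ j) → Unique (Vec.toList (tabulate f))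
tabulate-unique f inj = subst Unique (sym (toList-tabulate f)) (Unique.tabulate⁺ inj)

module _ {n : ℕ} where

  perm-∘ : ∀ {σ ρ : Perm n} → IsPerm σ → IsPerm ρ → IsPerm (σ ∘ᴾ ρ)
  perm-∘ {σ} {ρ} pσ pρ = tabulate-unique _ (lookup-injective ρ pρ ∘ lookup-injective σ pσ)

  perm-id : IsPerm (idᴾ {n})
  perm-id = tabulate-unique _ (λ eq → eq)

  perm-transp : ∀ (a b : Fin n) → IsPerm (transp a b)
  perm-transp a b = tabulate-unique _ (involutive⇒injective (sw-involutive a b))

  ∘-assoc : ∀ (σ ρ τ : Perm n) → (σ ∘ᴾ ρ) ∘ᴾ τ ≡ σ ∘ᴾ (ρ ∘ᴾ τ)
  ∘-assoc σ ρ τ = VecP.tabulate-cong λ x →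
    trans (VecP.lookup∘tabulate _ (lookup τ x)) (cong (lookup σ) (sym (VecP.lookup∘tabulate _ x)))

  id-∘ : ∀ (σ : Perm n) → idᴾ ∘ᴾ σ ≡ σ
  id-∘ σ = trans (VecP.tabulate-cong (λ x → VecP.lookup∘tabulate (λ i → i) (lookup σ x))) (VecP.tabulate∘lookup σ)

  transp-involutive : ∀ (a b : Fin n) π → transp a b ∘ᴾ (transp a b ∘ᴾ π) ≡ π
  transp-involutive a b π = trans (transp-∘ a b _) (trans (cong (act (sw a b)) (transp-∘ a b π)) (act-involutive (sw-involutive a b) π))

  ≟ᴾ-true : ∀ (σ τ : Perm n) → σ ≡ τ → (σ ≟ᴾ τ) ≡ true
  ≟ᴾ-true σ τ = dec-true (VecP.≡-dec Fin._≟_ σ τ)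

  ≟ᴾ-false : ∀ (σ τ : Perm n) → σ ≢ τ → (σ ≟ᴾ τ) ≡ false
  ≟ᴾ-false σ τ = dec-false (VecP.≡-dec Fin._≟_ σ τ)

  private
    P : List (Perm n)
    P = allPerms n

  [_↦_] : Bool → ℚ → ℚ
  [ b ↦ q ] = if b then q else 0ℚ

  if-* : ∀ b p q → [ b ↦ p ] * q ≡ [ b ↦ p * q ]
  if-* true  p q = refl
  if-* false p q = ℚP.*-zeroˡ q

  *-if : ∀ b p q → p * [ b ↦ q ] ≡ [ b ↦ p * q ]
  *-if true  p q = refl
  *-if false p q = ℚP.*-zeroʳ p

  if-+ : ∀ b p q → [ b ↦ p + q ] ≡ [ b ↦ p ] + [ b ↦ q ]
  if-+ true  p q = refl
  if-+ false p q = refl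

  ∑-at : ∀ {τ} (k : Perm n → ℚ) → IsPerm τ → ∑ P (λ σ → [ τ ≟ᴾ σ ↦ k σ ]) ≡ k τ
  ∑-at {τ} k pτ = trans (∑-single _ (allPerms-unique n) (∈-allPerms⁺ pτ)
                          (λ {σ} _ σ≢τ → cong (λ b → [ b ↦ k σ ]) (≟ᴾ-false τ σ (σ≢τ ∘ sym))))
                        (cong (λ b → [ b ↦ k τ ]) (≟ᴾ-true τ τ refl))

  *ᴬ-∑ : ∀ (f g : GA n) π → (f *ᴬ g) π ≡ ∑ P (λ σ → ∑ P (λ ρ → [ (σ ∘ᴾ ρ) ≟ᴾ π ↦ f σ * g ρ ]))
  *ᴬ-∑ f g π = Σℚ-concatMap (λ _ → P) (λ σ ρ → [ (σ ∘ᴾ ρ) ≟ᴾ π ↦ f σ * g ρ ]) P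

  -- Pairing with a test function `k` removes the comparison `(α ∘ᴾ β) ≟ᴾ σ` from the product.
  -- Associativity follows by using it on either side.
  *ᴬ-pairing : ∀ (f g : GA n) (k : Perm n → ℚ) →
               ∑ P (λ σ → (f *ᴬ g) σ * k σ) ≡ ∑ P (λ α → ∑ P (λ β → (f α * g β) * k (α ∘ᴾ β)))
  *ᴬ-pairing f g k = begin
    ∑ P (λ σ → (f *ᴬ g) σ * k σ)
      ≡⟨ ∑-cong P (λ {σ} _ → trans (cong (_* k σ) (*ᴬ-∑ f g σ)) (trans (sym (∑-*ʳ P _ (k σ))) (∑-cong P (λ {α} _ → sym (∑-*ʳ P _ (k σ)))))) ⟩
    ∑ P (λ σ → ∑ P (λ α → ∑ P (λ β → [ (α ∘ᴾ β) ≟ᴾ σ ↦ f α * g β ] * k σ)))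
      ≡⟨ ∑-swap P P _ ⟩
    ∑ P (λ α → ∑ P (λ σ → ∑ P (λ β → [ (α ∘ᴾ β) ≟ᴾ σ ↦ f α * g β ] * k σ)))
      ≡⟨ ∑-cong P (λ _ → ∑-swap P P _) ⟩
    ∑ P (λ α → ∑ P (λ β → ∑ P (λ σ → [ (α ∘ᴾ β) ≟ᴾ σ ↦ f α * g β ] * k σ)))
      ≡⟨ ∑-cong P (λ {α} α∈ → ∑-cong P (λ {β} β∈ →
           trans (∑-cong P (λ {σ} _ → if-* ((α ∘ᴾ β) ≟ᴾ σ) (f α * g β) (k σ)))
                 (∑-at (λ σ → (f α * g β) * k σ) (perm-∘ (∈-allPerms⁻ α∈) (∈-allPerms⁻ β∈))))) ⟩
    ∑ P (λ α → ∑ P (λ β → (f α * g β) * k (α ∘ᴾ β))) ∎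
    where open ≡-Reasoning

  *ᴬ-assoc : ∀ (f g h : GA n) π → ((f *ᴬ g) *ᴬ h) π ≡ (f *ᴬ (g *ᴬ h)) π
  *ᴬ-assoc f g h π = begin
    ((f *ᴬ g) *ᴬ h) π                                                ≡⟨ *ᴬ-∑ (f *ᴬ g) h π ⟩
    ∑ P (λ σ → ∑ P (λ ρ → [ (σ ∘ᴾ ρ) ≟ᴾ π ↦ (f *ᴬ g) σ * h ρ ]))     ≡⟨ ∑-cong P (λ {σ} _ → trans (∑-cong P (λ {ρ} _ → sym (*-if ((σ ∘ᴾ ρ) ≟ᴾ π) ((f *ᴬ g) σ) (h ρ)))) (∑-*ˡ P ((f *ᴬ g) σ) _)) ⟩
    ∑ P (λ σ → (f *ᴬ g) σ * ∑ P (λ ρ → [ (σ ∘ᴾ ρ) ≟ᴾ π ↦ h ρ ]))     ≡⟨ *ᴬ-pairing f g _ ⟩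
    ∑ P (λ α → ∑ P (λ β → (f α * g β) * ∑ P (λ ρ → [ ((α ∘ᴾ β) ∘ᴾ ρ) ≟ᴾ π ↦ h ρ ])))
      ≡⟨ ∑-cong P (λ {α} _ → trans (∑-cong P (λ {β} _ → inner α β)) (∑-*ˡ P (f α) _)) ⟩
    ∑ P (λ α → f α * ∑ P (λ β → ∑ P (λ ρ → (g β * h ρ) * [ (α ∘ᴾ (β ∘ᴾ ρ)) ≟ᴾ π ↦ 1ℚ ])))
      ≡⟨ ∑-cong P (λ {α} _ → cong (f α *_) (sym (*ᴬ-pairing g h (λ τ → [ (α ∘ᴾ τ) ≟ᴾ π ↦ 1ℚ ])))) ⟩
    ∑ P (λ α → f α * ∑ P (λ τ → (g *ᴬ h) τ * [ (α ∘ᴾ τ) ≟ᴾ π ↦ 1ℚ ]))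
      ≡⟨ ∑-cong P (λ {α} _ → trans (sym (∑-*ˡ P (f α) _)) (∑-cong P (λ {τ} _ → outer α τ))) ⟩
    ∑ P (λ α → ∑ P (λ τ → [ (α ∘ᴾ τ) ≟ᴾ π ↦ f α * (g *ᴬ h) τ ]))     ≡⟨ *ᴬ-∑ f (g *ᴬ h) π ⟨
    (f *ᴬ (g *ᴬ h)) π                                                ∎
    where
    open ≡-Reasoning
    unit : ∀ b p → [ b ↦ p ] ≡ p * [ b ↦ 1ℚ ]
    unit true  p = sym (ℚP.*-identityʳ p)
    unit false p = sym (ℚP.*-zeroʳ p)
    rearrange : ∀ a b c d → (a * b) * (c * d) ≡ a * ((b * c) * d)
    rearrange = solve-∀ ℚ-ring
    inner : ∀ α β → (f α * g β) * ∑ P (λ ρ → [ ((α ∘ᴾ β) ∘ᴾ ρ) ≟ᴾ π ↦ h ρ ])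
                    ≡ f α * ∑ P (λ ρ → (g β * h ρ) * [ (α ∘ᴾ (β ∘ᴾ ρ)) ≟ᴾ π ↦ 1ℚ ])
    inner α β = trans (sym (∑-*ˡ P (f α * g β) _)) (trans (∑-cong P (λ {ρ} _ →
      trans (cong ((f α * g β) *_) (trans (cong (λ τ → [ τ ≟ᴾ π ↦ h ρ ]) (∘-assoc α β ρ)) (unit ((α ∘ᴾ (β ∘ᴾ ρ)) ≟ᴾ π) (h ρ))))
            (rearrange (f α) (g β) (h ρ) [ (α ∘ᴾ (β ∘ᴾ ρ)) ≟ᴾ π ↦ 1ℚ ]))) (∑-*ˡ P (f α) _))
    outer : ∀ α τ → f α * ((g *ᴬ h) τ * [ (α ∘ᴾ τ) ≟ᴾ π ↦ 1ℚ ]) ≡ [ (α ∘ᴾ τ) ≟ᴾ π ↦ f α * (g *ᴬ h) τ ]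
    outer α τ = trans (sym (ℚP.*-assoc (f α) ((g *ᴬ h) τ) _)) (sym (unit ((α ∘ᴾ τ) ≟ᴾ π) (f α * (g *ᴬ h) τ)))

  -- The product reads its right factor on permutations only. Identities valid just there can thus
  -- be used under a further multiplication.
  *ᴬ-congʳ : ∀ (f : GA n) {g h : GA n} → (∀ {ρ} → IsPerm ρ → g ρ ≡ h ρ) → ∀ π → (f *ᴬ g) π ≡ (f *ᴬ h) π
  *ᴬ-congʳ f {g} {h} eq π = trans (*ᴬ-∑ f g π) (trans
    (∑-cong P (λ {σ} _ → ∑-cong P (λ {ρ} ρ∈ → cong (λ q → [ (σ ∘ᴾ ρ) ≟ᴾ π ↦ f σ * q ]) (eq (∈-allPerms⁻ ρ∈)))))
    (sym (*ᴬ-∑ f h π)))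

  *ᴬ-+ : ∀ (f g h : GA n) π → ((f +ᴬ g) *ᴬ h) π ≡ (f *ᴬ h) π + (g *ᴬ h) π
  *ᴬ-+ f g h π = begin
    ((f +ᴬ g) *ᴬ h) π                  ≡⟨ *ᴬ-∑ (f +ᴬ g) h π ⟩
    _                                  ≡⟨ ∑-cong P (λ {σ} _ → trans (∑-cong P (λ {ρ} _ →
                                            trans (cong (λ q → [ (σ ∘ᴾ ρ) ≟ᴾ π ↦ q ]) (ℚP.*-distribʳ-+ (h ρ) (f σ) (g σ))) (if-+ ((σ ∘ᴾ ρ) ≟ᴾ π) (f σ * h ρ) (g σ * h ρ)))) (∑-+ P _ _)) ⟩
    _                                  ≡⟨ ∑-+ P _ _ ⟩
    _                                  ≡⟨ cong₂ _+_ (*ᴬ-∑ f h π) (*ᴬ-∑ g h π) ⟨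
    (f *ᴬ h) π + (g *ᴬ h) π            ∎
    where open ≡-Reasoning

  *ᴬ-· : ∀ q (f h : GA n) π → ((q ·ᴬ f) *ᴬ h) π ≡ q * (f *ᴬ h) π
  *ᴬ-· q f h π = begin
    ((q ·ᴬ f) *ᴬ h) π                  ≡⟨ *ᴬ-∑ (q ·ᴬ f) h π ⟩
    _                                  ≡⟨ ∑-cong P (λ {σ} _ → trans (∑-cong P (λ {ρ} _ →
                                            trans (cong (λ x → [ (σ ∘ᴾ ρ) ≟ᴾ π ↦ x ]) (ℚP.*-assoc q (f σ) (h ρ))) (sym (*-if ((σ ∘ᴾ ρ) ≟ᴾ π) q (f σ * h ρ))))) (∑-*ˡ P q _)) ⟩
    _                                  ≡⟨ ∑-*ˡ P q _ ⟩
    _                                  ≡⟨ cong (q *_) (*ᴬ-∑ f h π) ⟨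
    q * (f *ᴬ h) π                     ∎
    where open ≡-Reasoning

  *ᴬ-0 : ∀ (h : GA n) π → (0ᴬ *ᴬ h) π ≡ 0ℚ
  *ᴬ-0 h π = trans (*ᴬ-∑ 0ᴬ h π) (∑-zero P (λ {σ} _ → ∑-zero P (λ {ρ} _ → z ((σ ∘ᴾ ρ) ≟ᴾ π) (h ρ))))
    where
    z : ∀ b q → [ b ↦ 0ℚ * q ] ≡ 0ℚ
    z true  q = ℚP.*-zeroˡ q
    z false q = refl

  *ᴬ-ΣA : ∀ (fs : List (GA n)) (h : GA n) π → (ΣA fs *ᴬ h) π ≡ ∑ fs (λ f → (f *ᴬ h) π)
  *ᴬ-ΣA []       h π = *ᴬ-0 h π
  *ᴬ-ΣA (f ∷ fs) h π = trans (*ᴬ-+ f (ΣA fs) h π) (cong ((f *ᴬ h) π +_) (*ᴬ-ΣA fs h π))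

  -- `τ′` acts as the inverse of `τ`: the only `ρ` with `τ ∘ᴾ ρ ≡ π` is `τ′ ∘ᴾ π`, so one term of
  -- the double sum remains.
  *ᴬ-δ : ∀ (τ τ′ : Perm n) (h : GA n) {π} → IsPerm τ → IsPerm (τ′ ∘ᴾ π) → (∀ ρ → τ′ ∘ᴾ (τ ∘ᴾ ρ) ≡ ρ) → τ ∘ᴾ (τ′ ∘ᴾ π) ≡ π →
         (δ τ *ᴬ h) π ≡ h (τ′ ∘ᴾ π)
  *ᴬ-δ τ τ′ h {π} pτ pτ′π left right = begin
    (δ τ *ᴬ h) π                                                  ≡⟨ *ᴬ-∑ (δ τ) h π ⟩
    ∑ P (λ σ → ∑ P (λ ρ → [ (σ ∘ᴾ ρ) ≟ᴾ π ↦ δ τ σ * h ρ ]))       ≡⟨ ∑-cong P (λ {σ} _ → trans (∑-cong P (λ {ρ} _ → pull σ ρ)) (∑-*ˡ P [ τ ≟ᴾ σ ↦ 1ℚ ] _)) ⟩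
    ∑ P (λ σ → [ τ ≟ᴾ σ ↦ 1ℚ ] * ∑ P (λ ρ → [ (σ ∘ᴾ ρ) ≟ᴾ π ↦ h ρ ])) ≡⟨ ∑-cong P (λ {σ} _ → trans (if-* (τ ≟ᴾ σ) 1ℚ (∑ P (λ ρ → [ (σ ∘ᴾ ρ) ≟ᴾ π ↦ h ρ ]))) (cong (λ q → [ τ ≟ᴾ σ ↦ q ]) (ℚP.*-identityˡ _))) ⟩
    ∑ P (λ σ → [ τ ≟ᴾ σ ↦ ∑ P (λ ρ → [ (σ ∘ᴾ ρ) ≟ᴾ π ↦ h ρ ]) ])  ≡⟨ ∑-at (λ σ → ∑ P (λ ρ → [ (σ ∘ᴾ ρ) ≟ᴾ π ↦ h ρ ])) pτ ⟩
    ∑ P (λ ρ → [ (τ ∘ᴾ ρ) ≟ᴾ π ↦ h ρ ])                           ≡⟨ ∑-single _ (allPerms-unique n) (∈-allPerms⁺ pτ′π) (λ {ρ} _ ρ≢ → cong (λ b → [ b ↦ h ρ ]) (≟ᴾ-false (τ ∘ᴾ ρ) π (λ eq → ρ≢ (trans (sym (left ρ)) (cong (τ′ ∘ᴾ_) eq))))) ⟩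
    [ (τ ∘ᴾ (τ′ ∘ᴾ π)) ≟ᴾ π ↦ h (τ′ ∘ᴾ π) ]                       ≡⟨ cong (λ b → [ b ↦ h (τ′ ∘ᴾ π) ]) (≟ᴾ-true (τ ∘ᴾ (τ′ ∘ᴾ π)) π right) ⟩
    h (τ′ ∘ᴾ π)                                                   ∎
    where
    open ≡-Reasoning
    pull : ∀ σ ρ → [ (σ ∘ᴾ ρ) ≟ᴾ π ↦ δ τ σ * h ρ ] ≡ [ τ ≟ᴾ σ ↦ 1ℚ ] * [ (σ ∘ᴾ ρ) ≟ᴾ π ↦ h ρ ]
    pull σ ρ = sym (*-if ((σ ∘ᴾ ρ) ≟ᴾ π) [ τ ≟ᴾ σ ↦ 1ℚ ] (h ρ))

  *ᴬ-1 : ∀ (h : GA n) {π} → IsPerm π → (1ᴬ *ᴬ h) π ≡ h π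
  *ᴬ-1 h {π} pπ = trans (*ᴬ-δ idᴾ idᴾ h perm-id (perm-∘ perm-id pπ) (λ ρ → trans (id-∘ _) (id-∘ ρ)) (trans (id-∘ _) (id-∘ π))) (cong h (id-∘ π))

  *ᴬ-transp : ∀ a b (h : GA n) {π} → IsPerm π → (δ (transp a b) *ᴬ h) π ≡ h (act (sw a b) π)
  *ᴬ-transp a b h {π} pπ = trans
    (*ᴬ-δ (transp a b) (transp a b) h (perm-transp a b) (perm-∘ (perm-transp a b) pπ) (transp-involutive a b) (transp-involutive a b π))
    (cong h (transp-∘ a b π))

-- Murphy's formula and the powers of the last Jucys-Murphy element as operators

factor : ∀ {n} → ℕ → List ℕ → ℕ → GA n
factor k ν r = ΠA (map (λ r′ → invℤ (addContent ν r ℤ.- addContent ν r′) ·ᴬ (JMℕ k +ᴬ (fromℤℚ (ℤ.- addContent ν r′) ·ᴬ 1ᴬ)))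
                       (filterᵇ (λ r′ → not (r′ ≡ᵇ r)) (addableRows ν)))

-- Likewise, seminormalFrom w is the local function go of seminormal w.
mutual
  seminormalTail : ∀ {n} → ℕ → List ℕ → GA n
  seminormalTail = _

  seminormal-∷ : ∀ {n} r rs → seminormal {n} (r ∷ rs) ≡ factor 0 [] r *ᴬ seminormalTail r rs
  seminormal-∷ r rs = refl

mutual
  seminormalFrom : ∀ {n} → List ℕ → ℕ → List ℕ → List ℕ → GA n
  seminormalFrom = _

  seminormalTail≡ : ∀ {n} r rs → seminormalTail {n} r rs ≡ seminormalFrom (r ∷ rs) 1 (addToRow r []) rs
  seminormalTail≡ r rs with r ∷ rs | 1 | addToRow r []
  ... | w | k | ν = refl

module Convolution (m : ℕ) where
  private n = suc m
  open Operators m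
  open Lagrange jucysMurphy
  open YoungBasis jucysMurphy

  JMℕ-* : ∀ {k} → k < n → ∀ (h : GA n) {π} → IsPerm π → (JMℕ k *ᴬ h) π ≡ X k h π
  JMℕ-* {k} k<n h {π} pπ = begin
    (JMℕ k *ᴬ h) π                                        ≡⟨ *ᴬ-ΣA (concatMap terms (allFin n)) h π ⟩
    ∑ (concatMap terms (allFin n)) (λ f → (f *ᴬ h) π)     ≡⟨ ∑-concatMap terms (allFin n) _ ⟩
    ∑ (allFin n) (λ b → ∑ (terms b) (λ f → (f *ᴬ h) π))   ≡⟨ ∑-single _ (Unique.allFin⁺ n) (∈-allFin (el k)) (λ {b} _ → off b) ⟩
    ∑ (terms (el k)) (λ f → (f *ᴬ h) π)                   ≡⟨ on ⟩
    X k h π                                               ∎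
    where
    open ≡-Reasoning
    terms : Fin n → List (GA n)
    terms b = if toℕ b ≡ᵇ k then map (λ j → δ (transp j b)) (below n k) else []
    off : ∀ b → b ≢ el k → ∑ (terms b) (λ f → (f *ᴬ h) π) ≡ 0ℚ
    off b b≢ with toℕ b ≡ᵇ k in eq
    ... | false = refl
    ... | true  = ⊥-elim (b≢ (FinP.toℕ-injective (trans (ℕP.≡ᵇ⇒≡ (toℕ b) k (subst T (sym eq) tt)) (sym (toℕ-el k<n)))))
    on : ∑ (terms (el k)) (λ f → (f *ᴬ h) π) ≡ X k h π
    on with toℕ (el {m} k) ≡ᵇ k | ℕP.≡⇒≡ᵇ (toℕ (el {m} k)) k (toℕ-el k<n)
    ... | true | _ = trans (∑-map (λ j → δ (transp j (el k))) (below n k) (λ f → (f *ᴬ h) π)) (∑-cong (below n k) (λ {j} _ → *ᴬ-transp j (el k) h pπ))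

  factor-* : ∀ {k} → k < n → ∀ ν r (h : GA n) {π} → IsPerm π → (factor k ν r *ᴬ h) π ≡ factorOp k ν r h π
  factor-* {k} k<n ν r h = go (filterᵇ (λ r′ → not (r′ ≡ᵇ r)) (addableRows ν))
    where
    open ≡-Reasoning
    F : ℕ → GA n
    F r′ = invℤ (addContent ν r ℤ.- addContent ν r′) ·ᴬ (JMℕ k +ᴬ (fromℤℚ (ℤ.- addContent ν r′) ·ᴬ 1ᴬ))
    go : ∀ rows {π} → IsPerm π → (ΠA (map F rows) *ᴬ h) π ≡ lag k (addContent ν r) (map (addContent ν) rows) h π
    go []          pπ = *ᴬ-1 h pπ
    go (r′ ∷ rows) {π} pπ = begin
      ((F r′ *ᴬ ΠA (map F rows)) *ᴬ h) π                       ≡⟨ *ᴬ-assoc (F r′) (ΠA (map F rows)) h π ⟩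
      (F r′ *ᴬ (ΠA (map F rows) *ᴬ h)) π                       ≡⟨ *ᴬ-congʳ (F r′) (go rows) π ⟩
      (F r′ *ᴬ w) π                                            ≡⟨ *ᴬ-· κ (JMℕ k +ᴬ (fromℤℚ (ℤ.- c′) ·ᴬ 1ᴬ)) w π ⟩
      κ * ((JMℕ k +ᴬ (fromℤℚ (ℤ.- c′) ·ᴬ 1ᴬ)) *ᴬ w) π          ≡⟨ cong (κ *_) (*ᴬ-+ (JMℕ k) (fromℤℚ (ℤ.- c′) ·ᴬ 1ᴬ) w π) ⟩
      κ * ((JMℕ k *ᴬ w) π + ((fromℤℚ (ℤ.- c′) ·ᴬ 1ᴬ) *ᴬ w) π)  ≡⟨ cong₂ (λ x y → κ * (x + y)) (JMℕ-* k<n w pπ) (trans (*ᴬ-· (fromℤℚ (ℤ.- c′)) 1ᴬ w π) (cong₂ _*_ (fromℤℚ-neg c′) (*ᴬ-1 w pπ))) ⟩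
      κ * (X k w π + (- fromℤℚ c′) * w π)                      ≡⟨ distrib κ (X k w π) (- fromℤℚ c′) (w π) ⟩
      κ * X k w π + κ * (- fromℤℚ c′) * w π                    ∎
      where
      c′ = addContent ν r′
      κ = invℤ (addContent ν r ℤ.- c′)
      w = lag k (addContent ν r) (map (addContent ν) rows) h
      distrib : ∀ κ x c w → κ * (x + c * w) ≡ κ * x + κ * c * w
      distrib = solve-∀ ℚ-ring

  seminormal≡e : ∀ w {π} → length w ≤ n → IsPerm π → seminormal w π ≡ e 1ᴬ w π
  seminormal≡e w len pπ = go 0 [] w len pπ
    where
    go : ∀ k ν rs {π} → k ℕ.+ length rs ≤ n → IsPerm π → seminormalFrom w k ν rs π ≡ young k ν rs 1ᴬ π
    go k ν []       len pπ = refl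
    go k ν (r ∷ rs) {π} len pπ = trans
      (*ᴬ-congʳ (factor k ν r) (go (suc k) (addToRow r ν) rs len′) π)
      (factor-* (ℕP.≤-trans (s≤s (ℕP.m≤m+n k (length rs))) len′) ν r (young (suc k) (addToRow r ν) rs 1ᴬ) pπ)
      where
      len′ : suc k ℕ.+ length rs ≤ n
      len′ = subst (_≤ n) (ℕP.+-suc k (length rs)) len

  Jn-* : ∀ (h : GA n) {π} → IsPerm π → (Jn m *ᴬ h) π ≡ X m h π
  Jn-* h {π} pπ = begin
    (Jn m *ᴬ h) π                                                          ≡⟨ *ᴬ-ΣA (map (λ j → δ (transp j (fromℕ m))) (below n (toℕ (fromℕ m)))) h π ⟩
    ∑ (map (λ j → δ (transp j (fromℕ m))) (below n (toℕ (fromℕ m)))) (λ f → (f *ᴬ h) π) ≡⟨ ∑-map (λ j → δ (transp j (fromℕ m))) (below n (toℕ (fromℕ m))) _ ⟩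
    ∑ (below n (toℕ (fromℕ m))) (λ j → (δ (transp j (fromℕ m)) *ᴬ h) π)    ≡⟨ ∑-cong (below n (toℕ (fromℕ m))) (λ {j} _ → *ᴬ-transp j (fromℕ m) h pπ) ⟩
    ∑ (below n (toℕ (fromℕ m))) (λ j → h (act (sw j (fromℕ m)) π))         ≡⟨ cong₂ (λ k b → ∑ (below n k) (λ j → h (act (sw j b) π))) (FinP.toℕ-fromℕ m) (FinP.toℕ-injective (trans (FinP.toℕ-fromℕ m) (sym (toℕ-el (ℕP.n<1+n m))))) ⟩
    X m h π                                                                ∎
    where open ≡-Reasoning

  Jn-^ : ∀ r {π} → IsPerm π → (Jn m ^ᴬ r) π ≡ Xpow m r 1ᴬ π
  Jn-^ zero    pπ = refl
  Jn-^ (suc r) {π} pπ = trans (*ᴬ-congʳ (Jn m) (Jn-^ r) π) (Jn-* (Xpow m r 1ᴬ) pπ)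

  Jn-^-spectral : ∀ r {π} → IsPerm π →
    (Jn m ^ᴬ r) π ≡ ∑ (SYTs n) (λ w → (fromℤℚ (lastContent w) ^ℚ r) * seminormal w π)
  Jn-^-spectral r {π} pπ = trans (Jn-^ r pπ) (trans (Xpow-spectral 1ᴬ m (ℕP.n<1+n m) r π)
    (∑-cong (SYTs n) (λ {w} w∈ → cong ((fromℤℚ (lastContent w) ^ℚ r) *_) (sym (seminormal≡e w (ℕP.≤-reflexive (SYTs-length n w∈)) pπ)))))

-- Partitions

data Desc : ℕ → List ℕ → Set where
  []   : ∀ {k} → Desc k []
  _∷_  : ∀ {k p ps} → 1 ≤ p × p ≤ k → Desc p ps → Desc k (p ∷ ps)

-- `f` is the fuel of `partsB`. Each step removes a part of size at least one, so fuel `sum μ` is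
-- enough.
∈-partsB : ∀ f k {μ} → sum μ ≤ f → Desc k μ → μ ∈ partsB f (sum μ) k
∈-partsB f       k {[]} _ [] = here refl
∈-partsB (suc f) k {suc p ∷ ps} (s≤s le) ((_ , p≤k) ∷ d) =
  ∈-concatMap⁺ _ (lose (∈-map⁺ suc (∈-upTo⁺ (ℕP.⊓-glb p≤k (s≤s (ℕP.m≤m+n p (sum ps))))))
    (∈-map⁺ (suc p ∷_) (subst (λ s → ps ∈ partsB f s (suc p)) (sym (ℕP.m+n∸m≡n p (sum ps)))
      (∈-partsB f (suc p) (ℕP.≤-trans (ℕP.m≤n+m (sum ps) p) le) d))))

partsB-unique : ∀ f n k → Unique (partsB f n k)
partsB-unique f       zero    k = [] ∷ []
partsB-unique zero    (suc n) k = []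
partsB-unique (suc f) (suc n) k = concatMap-unique _ (Unique.map⁺ ℕP.suc-injective (Unique.upTo⁺ (k ⊓ suc n)))
  (λ p → Unique.map⁺ LP.∷-injectiveʳ (partsB-unique f (suc n ∸ p) p)) disj
  where
  disj : ∀ {p q μ} → μ ∈ map (p ∷_) (partsB f (suc n ∸ p) p) → μ ∈ map (q ∷_) (partsB f (suc n ∸ q) q) → p ≡ q
  disj {p} {q} μ∈ μ∈′ with ∈-map⁻ (p ∷_) μ∈ | ∈-map⁻ (q ∷_) μ∈′
  ... | _ , _ , refl | _ , _ , eq = LP.∷-injectiveˡ eq

desc : ∀ {k} ν → rowLen ν 0 ≤ k → Antitone ν → All (1 ≤_) ν → Desc k ν
desc []      _  _    []         = []
desc (a ∷ ν) le anti (1≤a ∷ al) = (1≤a , le) ∷ desc ν (anti 0) (anti ∘ suc) al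

sum-addToRow : ∀ r ν → sum (addToRow r ν) ≡ suc (sum ν)
sum-addToRow zero    []      = refl
sum-addToRow zero    (a ∷ ν) = refl
sum-addToRow (suc r) []      = refl
sum-addToRow (suc r) (a ∷ ν) = trans (cong (a ℕ.+_) (sum-addToRow r ν)) (ℕP.+-suc a (sum ν))

positive-addToRow : ∀ r {ν} → All (1 ≤_) ν → All (1 ≤_) (addToRow r ν)
positive-addToRow zero    []        = s≤s z≤n ∷ []
positive-addToRow zero    (_ ∷ al)  = s≤s z≤n ∷ al
positive-addToRow (suc r) []        = s≤s z≤n ∷ []
positive-addToRow (suc r) (p ∷ al)  = p ∷ positive-addToRow r al

rowLen-∈ : ∀ ν r {l} → l < rowLen ν r → rowLen ν r ∈ ν
rowLen-∈ (a ∷ ν) zero    _  = here refl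
rowLen-∈ (a ∷ ν) (suc r) l< = there (rowLen-∈ ν r l<)

∈-rowLen : ∀ {p ν} → p ∈ ν → Σ ℕ λ r → p ≡ rowLen ν r
∈-rowLen (here refl) = 0 , refl
∈-rowLen (there p∈) with ∈-rowLen p∈
... | r , eq = suc r , eq

∈⇒≤sum : ∀ {p μ} → p ∈ μ → p ≤ sum μ
∈⇒≤sum {μ = p ∷ μ} (here refl) = ℕP.m≤m+n p (sum μ)
∈⇒≤sum {μ = q ∷ μ} (there p∈)  = ℕP.≤-trans (∈⇒≤sum p∈) (ℕP.m≤n+m (sum μ) q)

SYT-shape : ∀ k {w} → w ∈ SYTs k → Antitone (shapeOf w) × All (1 ≤_) (shapeOf w) × sum (shapeOf w) ≡ k
SYT-shape zero    (here refl) = (λ _ → z≤n) , [] , refl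
SYT-shape (suc k) w∈ with SYTs-snoc⁻ k w∈
... | w₀ , r , w₀∈ , r∈ , refl with SYT-shape k w₀∈
...   | anti , pos , sum≡ rewrite shapeOf-snoc w₀ r =
  antitone-add (shapeOf w₀) anti r∈ , positive-addToRow r pos , trans (sum-addToRow r (shapeOf w₀)) (cong suc sum≡)

shape-∈-partitions : ∀ k {w} → w ∈ SYTs k → shapeOf w ∈ partitions k
shape-∈-partitions k {w} w∈ with SYT-shape k w∈
... | anti , pos , refl = ∈-partsB (sum μ) (sum μ) ℕP.≤-refl (desc μ (head≤ μ) anti pos)
  where
  μ = shapeOf w
  head≤ : ∀ ν → rowLen ν 0 ≤ sum ν
  head≤ []      = z≤n
  head≤ (a ∷ ν) = ℕP.m≤m+n a (sum ν)

-- Contents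

-- The contribution of one part `p` to the multiplicities summed over `L`.
count : ℕ → List ℕ → ℕ
count p L = sum (map (λ k → if p ≡ᵇ k then 1 else 0) L)

count-∉ : ∀ p L → p ∉ L → count p L ≡ 0
count-∉ p []      _  = refl
count-∉ p (k ∷ L) p∉ with p ≡ᵇ k in eq
... | true  = ⊥-elim (p∉ (here (ℕP.≡ᵇ⇒≡ p k (subst T (sym eq) tt))))
... | false = count-∉ p L (p∉ ∘ there)

count-∈ : ∀ p {L} → Unique L → p ∈ L → count p L ≡ 1
count-∈ p {k ∷ L} (k∉ ∷ u) p∈ with p ≡ᵇ k in eq | p∈
... | true  | _          = cong suc (count-∉ p L (λ p∈L → All.lookup k∉ p∈L (sym (ℕP.≡ᵇ⇒≡ p k (subst T (sym eq) tt)))))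
... | false | there p∈L  = count-∈ p u p∈L
... | false | here refl  = ⊥-elim (subst T eq (ℕP.≡⇒≡ᵇ p p refl))

sum-mult-∷ : ∀ p ps L → sum (map (λ k → mult k (p ∷ ps)) L) ≡ count p L ℕ.+ sum (map (λ k → mult k ps) L)
sum-mult-∷ p ps []      = refl
sum-mult-∷ p ps (k ∷ L) with p ≡ᵇ k | trans (cong (mult k ps ℕ.+_) (sum-mult-∷ p ps L)) (x∙yz≈y∙xz ℕP.+-commutativeSemigroup (mult k ps) (count p L) _)
... | true  | eq = cong suc eq
... | false | eq = eq

module _ (n j : ℕ) where
  private
    L : List ℕ
    L = map (j ℕ.+_) (upTo (suc n ∸ j))

    L-unique : Unique L
    L-unique = Unique.map⁺ (ℕP.+-cancelˡ-≡ j _ _) (Unique.upTo⁺ (suc n ∸ j))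

    ∈-L : ∀ {p} → j ≤ p → p ≤ n → p ∈ L
    ∈-L {p} j≤p p≤n = subst (_∈ L) (ℕP.m+[n∸m]≡n j≤p) (∈-map⁺ (j ℕ.+_) (∈-upTo⁺ (ℕP.∸-monoˡ-< (s≤s p≤n) j≤p)))

    ∉-L : ∀ {p} → p < j → p ∉ L
    ∉-L p<j p∈ with ∈-map⁻ (j ℕ.+_) p∈
    ... | i , _ , refl = ℕP.m+n≮m j i p<j

  sum-mult-small : ∀ μ → (∀ {p} → p ∈ μ → p < j) → sum (map (λ k → mult k μ) L) ≡ 0
  sum-mult-small []       _  = zeros L
    where
    zeros : ∀ L → sum (map (λ k → mult k []) L) ≡ 0
    zeros []      = refl
    zeros (_ ∷ L) = zeros L
  sum-mult-small (p ∷ ps) lt = trans (sum-mult-∷ p ps L)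
    (cong₂ ℕ._+_ (count-∉ p L (∉-L (lt (here refl)))) (sum-mult-small ps (lt ∘ there)))

  -- Each part of size at least `j` is counted once and each smaller part not at all; since the list
  -- decreases weakly, the large parts are the rows `0` to `q`.
  sum-mult : ∀ μ q → Antitone μ → (∀ {p} → p ∈ μ → p ≤ n) → 1 ≤ j → j ≤ rowLen μ q → rowLen μ (suc q) < j →
             sum (map (λ k → mult k μ) L) ≡ suc q
  sum-mult []       q       _    _   1≤j j≤ _  = ⊥-elim (ℕP.<⇒≱ 1≤j j≤)
  sum-mult (p ∷ ps) zero    anti bnd 1≤j j≤ <j = trans (sum-mult-∷ p ps L)
    (cong₂ ℕ._+_ (count-∈ p L-unique (∈-L j≤ (bnd (here refl)))) (sum-mult-small ps (λ x∈ → small x∈)))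
    where
    small : ∀ {x} → x ∈ ps → x < j
    small x∈ with ∈-rowLen x∈
    ... | r , refl = ℕP.≤-<-trans (antitone-≤ ps (anti ∘ suc) z≤n) <j
  sum-mult (p ∷ ps) (suc q) anti bnd 1≤j j≤ <j = trans (sum-mult-∷ p ps L)
    (cong₂ ℕ._+_ (count-∈ p L-unique (∈-L (ℕP.≤-trans j≤ (antitone-≤ (p ∷ ps) anti {0} {suc q} z≤n)) (bnd (here refl))))
                 (sum-mult ps q (anti ∘ suc) (bnd ∘ there) 1≤j j≤ <j))

lastRow-pos : ∀ k {w} → w ∈ SYTs (suc k) → 1 ≤ rowLen (shapeOf w) (lastRow w)
lastRow-pos k w∈ with SYTs-snoc⁻ k w∈
... | w₀ , r , w₀∈ , r∈ , refl rewrite shapeOf-snoc w₀ r | lastRow-snoc w₀ r | rowLen-add r (shapeOf w₀) (addable-≤ (shapeOf w₀) r∈) = s≤s z≤n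

-- Before its last cell was added, the row was already at least as long as the next one.
lastRow-corner : ∀ k {w} → w ∈ SYTs (suc k) → rowLen (shapeOf w) (suc (lastRow w)) < rowLen (shapeOf w) (lastRow w)
lastRow-corner k w∈ with SYTs-snoc⁻ k w∈
... | w₀ , r , w₀∈ , r∈ , refl rewrite shapeOf-snoc w₀ r | lastRow-snoc w₀ r
      | rowLen-add r (shapeOf w₀) (addable-≤ (shapeOf w₀) r∈)
      | rowLen-other r (shapeOf w₀) (suc r) (addable-≤ (shapeOf w₀) r∈) (λ e → ℕP.<⇒≢ (ℕP.n<1+n r) (sym e))
      = s≤s (proj₁ (SYT-shape k w₀∈) r)

cont-SYT : ∀ k {w} → w ∈ SYTs (suc k) → cont (suc k) (shapeOf w) (rowLen (shapeOf w) (lastRow w)) ≡ lastContent w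
cont-SYT k {w} w∈ with SYT-shape (suc k) w∈
... | anti , _ , sum≡ = cong (λ s → ℤ.+ rowLen μ q ℤ.- ℤ.+ s)
    (sum-mult (suc k) (rowLen μ q) μ q anti (λ p∈ → subst (_ ≤_) sum≡ (∈⇒≤sum p∈)) (lastRow-pos k w∈) ℕP.≤-refl (lastRow-corner k w∈))
  where
  μ = shapeOf w
  q = lastRow w

≟Lᵇ-refl : ∀ as → (as ≟Lᵇ as) ≡ true
≟Lᵇ-refl []       = refl
≟Lᵇ-refl (a ∷ as) with a ≡ᵇ a | ℕP.≡⇒≡ᵇ a a refl
... | true | _ = ≟Lᵇ-refl as

≟Lᵇ-sound : ∀ as bs → (as ≟Lᵇ bs) ≡ true → as ≡ bs
≟Lᵇ-sound []       []       _  = refl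
≟Lᵇ-sound (a ∷ as) (b ∷ bs) eq with a ≡ᵇ b in ab
... | true = cong₂ _∷_ (ℕP.≡ᵇ⇒≡ a b (subst T (sym ab) tt)) (≟Lᵇ-sound as bs eq)

-- Characters

ΣA-∑ : ∀ {n} {A : Set} (f : A → GA n) xs π → ΣA (map f xs) π ≡ ∑ xs (λ x → 1ℚ * f x π)
ΣA-∑ f []       π = refl
ΣA-∑ f (x ∷ xs) π = cong₂ _+_ (sym (ℚP.*-identityˡ (f x π))) (ΣA-∑ f xs π)

!≢0 : ∀ k → ℤ.+ (k !) ≢ ℤ.+ 0
!≢0 k eq = ℕP.<⇒≢ (pos k) (sym (ℤP.+-injective eq))
  where
  pos : ∀ k → 0 < k !
  pos zero    = s≤s z≤n
  pos (suc k) = ℕP.≤-trans (pos k) (ℕP.m≤m+n (k !) (k ℕ.* (k !)))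

-- For `d = 0` the convention `invℤ 0 = 0` makes the left side zero, whence the last hypothesis.
-- When `k` is the coefficient of `Γ μ j` it holds because the sum defining `Γ μ j` is then empty.
rescale : ∀ d N k → ℤ.+ N ≢ ℤ.+ 0 → (d ≡ 0 → k ≡ 0ℚ) →
          (fromℕℚ d * invℤ (ℤ.+ N)) * ((fromℕℚ N * invℤ (ℤ.+ d)) * k) ≡ k
rescale zero N k _ k≡0 rewrite k≡0 refl = vanish (fromℕℚ 0 * invℤ (ℤ.+ N)) (fromℕℚ N * invℤ (ℤ.+ 0))
  where
  vanish : ∀ a b → a * (b * 0ℚ) ≡ 0ℚ
  vanish = solve-∀ ℚ-ring
rescale (suc d) N k N≢0 _ = begin
  (fromℕℚ (suc d) * invℤ (ℤ.+ N)) * ((fromℕℚ N * invℤ (ℤ.+ suc d)) * k)    ≡⟨ shuffle (fromℕℚ (suc d)) (invℤ (ℤ.+ N)) (fromℕℚ N) (invℤ (ℤ.+ suc d)) k ⟩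
  ((invℤ (ℤ.+ N) * fromℕℚ N) * (invℤ (ℤ.+ suc d) * fromℕℚ (suc d))) * k    ≡⟨ cong₂ (λ x y → (x * y) * k) (invℤ-inverse (ℤ.+ N) N≢0) (invℤ-inverse (ℤ.+ suc d) (λ ())) ⟩
  (1ℚ * 1ℚ) * k                                                            ≡⟨ ℚP.*-identityˡ k ⟩
  k                                                                        ∎
  where
  open ≡-Reasoning
  shuffle : ∀ d n′ n d′ k → (d * n′) * ((n * d′) * k) ≡ ((n′ * n) * (d′ * d)) * k
  shuffle = solve-∀ ℚ-ring

module _ (m : ℕ) (lam : List ℕ) (i : ℕ) where
  private
    n = suc m
    C = Cset m lam i
    K = coeffK m lam i
    κ = invℤ (ℤ.+ length C)

  coeffK-cong : ∀ {f g : GA n} → (∀ {π} → IsPerm π → f π ≡ g π) → K f ≡ K g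
  coeffK-cong eq = cong (_* κ) (∑-cong C (λ π∈ → eq (∈-allPerms⁻ (proj₁ (∈-filterᵇ⁻ (inC m lam i) (allPerms n) π∈)))))

  coeffK-∑ : ∀ {A : Set} (xs : List A) (q : A → ℚ) (f : A → GA n) →
             K (λ π → ∑ xs (λ x → q x * f x π)) ≡ ∑ xs (λ x → q x * K (f x))
  coeffK-∑ xs q f = begin
    ∑ C (λ π → ∑ xs (λ x → q x * f x π)) * κ       ≡⟨ cong (_* κ) (∑-swap C xs (λ π x → q x * f x π)) ⟩
    ∑ xs (λ x → ∑ C (λ π → q x * f x π)) * κ       ≡⟨ cong (_* κ) (∑-cong xs (λ {x} _ → ∑-*ˡ C (q x) (f x))) ⟩
    ∑ xs (λ x → q x * ∑ C (f x)) * κ               ≡⟨ ∑-*ʳ xs (λ x → q x * ∑ C (f x)) κ ⟨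
    ∑ xs (λ x → q x * ∑ C (f x) * κ)               ≡⟨ ∑-cong xs (λ {x} _ → ℚP.*-assoc (q x) (∑ C (f x)) κ) ⟩
    ∑ xs (λ x → q x * K (f x))                     ∎
    where open ≡-Reasoning

  coeffK-Γ : ∀ μ j → K (Γ μ j) ≡ ∑ (SYTshapeRow n μ j) (λ w → K (seminormal w))
  coeffK-Γ μ j = trans (coeffK-cong (λ {π} _ → ΣA-∑ seminormal (SYTshapeRow n μ j) π))
    (trans (coeffK-∑ (SYTshapeRow n μ j) (λ _ → 1ℚ) seminormal) (∑-cong (SYTshapeRow n μ j) (λ _ → ℚP.*-identityˡ _)))

  dim-γ : ∀ μ j → (fromℕℚ (dim n μ) * invℤ (ℤ.+ (n !))) * γ m μ j lam i ≡ K (Γ μ j)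
  dim-γ μ j = rescale (dim n μ) (n !) (K (Γ μ j)) (!≢0 n) λ d≡0 →
    trans (coeffK-Γ μ j) (cong (λ ws → ∑ (filterᵇ (λ w → rowLen μ (lastRow w) ≡ᵇ j) ws) (λ w → K (seminormal w))) (empty (SYTshape n μ) d≡0))
    where
    empty : ∀ (ws : List (List ℕ)) → length ws ≡ 0 → ws ≡ []
    empty [] _ = refl

  Jn-^-characters : ∀ r → K (Jn m ^ᴬ r) ≡ characterSum m lam i r
  Jn-^-characters r = begin
    K (Jn m ^ᴬ r)                                                         ≡⟨ coeffK-cong (Convolution.Jn-^-spectral m r) ⟩
    K (λ π → ∑ (SYTs n) (λ w → (fromℤℚ (lastContent w) ^ℚ r) * seminormal w π)) ≡⟨ coeffK-∑ (SYTs n) (λ w → fromℤℚ (lastContent w) ^ℚ r) seminormal ⟩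
    ∑ (SYTs n) (λ w → (fromℤℚ (lastContent w) ^ℚ r) * Kw w)               ≡⟨ ∑-cong (SYTs n) byShape ⟩
    ∑ (SYTs n) (λ w → ∑ (partitions n) (λ μ → ∑ (distinctParts μ) (λ j → term w μ j))) ≡⟨ ∑-swap (SYTs n) (partitions n) _ ⟩
    ∑ (partitions n) (λ μ → ∑ (SYTs n) (λ w → ∑ (distinctParts μ) (λ j → term w μ j))) ≡⟨ ∑-cong (partitions n) (λ {μ} _ → ∑-swap (SYTs n) (distinctParts μ) _) ⟩
    ∑ (partitions n) (λ μ → ∑ (distinctParts μ) (λ j → ∑ (SYTs n) (λ w → term w μ j))) ≡⟨ ∑-cong (partitions n) (λ {μ} _ → ∑-cong (distinctParts μ) (λ {j} _ → gather μ j)) ⟩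
    ∑ (partitions n) (λ μ → ∑ (distinctParts μ) (λ j → K (Γ μ j) * c μ j)) ≡⟨ ∑-cong (partitions n) (λ {μ} _ → ∑-cong (distinctParts μ) (λ {j} _ → cong (_* c μ j) (dim-γ μ j))) ⟨
    ∑ (partitions n) (λ μ → ∑ (distinctParts μ) (λ j → ((fromℕℚ (dim n μ) * invℤ (ℤ.+ (n !))) * γ m μ j lam i) * c μ j)) ≡⟨ Σℚ-concatMap distinctParts _ (partitions n) ⟨
    characterSum m lam i r                                                ∎
    where
    open ≡-Reasoning
    Kw : List ℕ → ℚ
    Kw w = K (seminormal w)
    c : List ℕ → ℕ → ℚ
    c μ j = fromℤℚ (cont n μ j) ^ℚ r
    -- The nested tests mirror the filters `SYTshape` and `SYTshapeRow`. A tableau passes them for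
    -- exactly one pair `μ`, `j`, so summing `term` over all pairs returns its own contribution.
    term : List ℕ → List ℕ → ℕ → ℚ
    term w μ j = if shapeOf w ≟Lᵇ μ then (if rowLen μ (lastRow w) ≡ᵇ j then Kw w else 0ℚ) * c μ j else 0ℚ
    gather : ∀ μ j → ∑ (SYTs n) (λ w → term w μ j) ≡ K (Γ μ j) * c μ j
    gather μ j = begin
      ∑ (SYTs n) (λ w → term w μ j)                                                       ≡⟨ ∑-filterᵇ (λ w → shapeOf w ≟Lᵇ μ) (SYTs n) (λ w → inner w * c μ j) ⟨
      ∑ (SYTshape n μ) (λ w → inner w * c μ j)                                            ≡⟨ ∑-*ʳ (SYTshape n μ) inner (c μ j) ⟩
      ∑ (SYTshape n μ) inner * c μ j                                                      ≡⟨ cong (_* c μ j) (∑-filterᵇ (λ w → rowLen μ (lastRow w) ≡ᵇ j) (SYTshape n μ) Kw) ⟨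
      ∑ (SYTshapeRow n μ j) Kw * c μ j                                                    ≡⟨ cong (_* c μ j) (coeffK-Γ μ j) ⟨
      K (Γ μ j) * c μ j                                                                   ∎
      where
      inner : List ℕ → ℚ
      inner w = if rowLen μ (lastRow w) ≡ᵇ j then Kw w else 0ℚ
    byShape : ∀ {w} → w ∈ SYTs n → (fromℤℚ (lastContent w) ^ℚ r) * Kw w ≡ ∑ (partitions n) (λ μ → ∑ (distinctParts μ) (λ j → term w μ j))
    byShape {w} w∈ = sym (begin
      ∑ (partitions n) (λ μ → ∑ (distinctParts μ) (λ j → term w μ j))
        ≡⟨ ∑-single _ (partsB-unique n n n) (shape-∈-partitions n w∈) (λ {μ} _ μ≢ → ∑-zero (distinctParts μ) (λ {j} _ → off μ j μ≢)) ⟩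
      ∑ (distinctParts μ) (λ j → term w μ j)
        ≡⟨ ∑-single _ (deduplicate-! ℕP._≟_ μ) (∈-deduplicate⁺ ℕP._≟_ (rowLen-∈ μ (lastRow w) (lastRow-pos m w∈))) (λ {j′} _ → off′ j′) ⟩
      term w μ j
        ≡⟨ on ⟩
      Kw w * c μ j
        ≡⟨ ℚP.*-comm (Kw w) (c μ j) ⟩
      c μ j * Kw w
        ≡⟨ cong (λ z → (fromℤℚ z ^ℚ r) * Kw w) (cont-SYT m w∈) ⟩
      (fromℤℚ (lastContent w) ^ℚ r) * Kw w ∎)
      where
      μ = shapeOf w
      j = rowLen μ (lastRow w)
      off : ∀ μ′ j → μ′ ≢ μ → term w μ′ j ≡ 0ℚ
      off μ′ j μ′≢ with shapeOf w ≟Lᵇ μ′ in eq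
      ... | true  = ⊥-elim (μ′≢ (sym (≟Lᵇ-sound μ μ′ eq)))
      ... | false = refl
      off′ : ∀ j′ → j′ ≢ j → term w μ j′ ≡ 0ℚ
      off′ j′ j′≢ rewrite ≟Lᵇ-refl (shapeOf w) with rowLen (shapeOf w) (lastRow w) ≡ᵇ j′ in eq
      ... | true  = ⊥-elim (j′≢ (sym (ℕP.≡ᵇ⇒≡ j j′ (subst T (sym eq) tt))))
      ... | false = ℚP.*-zeroˡ (c μ j′)
      on : term w μ j ≡ Kw w * c μ j
      on rewrite ≟Lᵇ-refl (shapeOf w) with rowLen (shapeOf w) (lastRow w) ≡ᵇ j | ℕP.≡⇒≡ᵇ j j refl
      ... | true | _ = refl

-- Cycles

-- Again local functions of Defs: go of cycleLength and _≟L_ of inC.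
mutual
  cycleLengthIn : ∀ {n} → Perm n → Fin n → List ℕ → ℕ
  cycleLengthIn = _

  cycleLength≡ : ∀ {n} (σ : Perm n) x → cycleLength σ x ≡ cycleLengthIn σ x (map ℕ.suc (upTo n))
  cycleLength≡ {n} σ x with map ℕ.suc (upTo n)
  ... | ks = refl

mutual
  cycleTypeIs : (m : ℕ) → List ℕ → ℕ → Perm (suc m) → List ℕ → List ℕ → Bool
  cycleTypeIs = _

  inC≡ : ∀ m a as b bs i π → cycleType π ≡ a ∷ as →
         inC m (b ∷ bs) i π ≡ ((a ≡ᵇ b) ∧ cycleTypeIs m (b ∷ bs) i π as bs) ∧ (cycleLength π (fromℕ m) ≡ᵇ i)
  inC≡ m a as b bs i π eq with cycleType π
  inC≡ m a as b bs i π refl | .(a ∷ as) with b ∷ bs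
  ... | lam = refl

allᵇ-lookup : ∀ {A : Set} (p : A → Bool) xs → T (allᵇ p xs) → ∀ {k} → k ∈ xs → T (p k)
allᵇ-lookup p (x ∷ xs) t k∈ with p x in eq | k∈
... | true | here refl = subst T (sym eq) tt
... | true | there k∈′ = allᵇ-lookup p xs t k∈′

allᵇ-fails : ∀ {A : Set} (p : A → Bool) xs → allᵇ p xs ≡ false → Σ A λ k → p k ≡ false
allᵇ-fails p (x ∷ xs) eq with p x in px
... | true  = allᵇ-fails p xs eq
... | false = x , px

module Cycle {n : ℕ} (σ : Perm n) (pσ : IsPerm σ) where

  iter-+ : ∀ a b x → iter σ (a ℕ.+ b) x ≡ iter σ a (iter σ b x)
  iter-+ zero    b x = refl
  iter-+ (suc a) b x = cong (lookup σ) (iter-+ a b x)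

  iter-comm : ∀ a b x → iter σ a (iter σ b x) ≡ iter σ b (iter σ a x)
  iter-comm a b x = trans (sym (iter-+ a b x)) (trans (cong (λ k → iter σ k x) (ℕP.+-comm a b)) (iter-+ b a x))

  iter-injective : ∀ k {x y} → iter σ k x ≡ iter σ k y → x ≡ y
  iter-injective zero    eq = eq
  iter-injective (suc k) eq = iter-injective k (lookup-injective σ pσ eq)

  iter-* : ∀ {x L} → iter σ L x ≡ x → ∀ q → iter σ (q ℕ.* L) x ≡ x
  iter-* eq zero    = refl
  iter-* {x} {L} eq (suc q) = trans (iter-+ L (q ℕ.* L) x) (trans (cong (iter σ L) (iter-* eq q)) eq)

  -- Two of the first `n + 1` iterates coincide, and injectivity cancels the smaller exponent.
  returns : ∀ x → Σ ℕ λ k → k < n × iter σ (suc k) x ≡ x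
  returns x with FinP.pigeonhole (ℕP.n<1+n n) (λ (i : Fin (suc n)) → iter σ (toℕ i) x)
  ... | i , j , i<j , eq with ℕP.m≤n⇒∃[o]m+o≡n i<j
  ...   | d , i+d≡j = d , d<n , sym (iter-injective (toℕ i) (trans eq (trans (cong (λ k → iter σ k x) (trans (sym i+d≡j) (sym (ℕP.+-suc (toℕ i) d)))) (iter-+ (toℕ i) (suc d) x))))
    where
    d<n : d < n
    d<n = ℕP.≤-trans (s≤s (ℕP.m≤n+m d (toℕ i))) (ℕP.≤-trans (ℕP.≤-reflexive i+d≡j) (ℕP.≤-pred (FinP.toℕ<n j)))

  len : Fin n → ℕ
  len = cycleLength σ

  first-return : ∀ x ks {k} → AllPairs _<_ ks → k ∈ ks → iter σ k x ≡ x →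
                 cycleLengthIn σ x ks ∈ ks × iter σ (cycleLengthIn σ x ks) x ≡ x × cycleLengthIn σ x ks ≤ k
  first-return x (k₀ ∷ ks) (lt ∷ ap) k∈ eq with iter σ k₀ x Fin.≟ x | k∈
  ... | yes eq₀ | here refl = here refl , eq₀ , ℕP.≤-refl
  ... | yes eq₀ | there k∈′ = here refl , eq₀ , ℕP.<⇒≤ (All.lookup lt k∈′)
  ... | no neq  | here refl = ⊥-elim (neq eq)
  ... | no neq  | there k∈′ = let a , b , c = first-return x ks ap k∈′ eq in there a , b , c

  module _ (x : Fin n) where
    private
      range : List ℕ
      range = map ℕ.suc (upTo n)

      range-sorted : AllPairs _<_ range
      range-sorted = AllPairs.map⁺ (AllPairs.applyUpTo⁺₁ (λ i → i) n (λ i<j _ → s≤s i<j))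

      spec : ∀ {k} → k < n → iter σ (suc k) x ≡ x → len x ∈ range × iter σ (len x) x ≡ x × len x ≤ suc k
      spec k<n eq = first-return x range range-sorted (∈-map⁺ suc (∈-upTo⁺ k<n)) eq

      base = let k , k<n , eq = returns x in spec k<n eq

    iter-len : iter σ (len x) x ≡ x
    iter-len = proj₁ (proj₂ base)

    len-bounds : 1 ≤ len x × len x ≤ n
    len-bounds with ∈-map⁻ suc (proj₁ base)
    ... | k , k∈ , eq = subst (λ l → 1 ≤ l × l ≤ n) (sym eq) (s≤s z≤n , ∈-upTo⁻ k∈)

    len-minimal : ∀ k → iter σ (suc k) x ≡ x → len x ≤ suc k
    len-minimal k eq with k ℕP.<? n
    ... | yes k<n = proj₂ (proj₂ (spec k<n eq))
    ... | no k≮n  = ℕP.≤-trans (proj₂ len-bounds) (ℕP.≤-trans (ℕP.≮⇒≥ k≮n) (ℕP.n≤1+n k))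

    instance
      len-nonZero : NonZero (len x)
      len-nonZero = ℕ.>-nonZero (proj₁ len-bounds)

    iter-% : ∀ k → iter σ k x ≡ iter σ (k % len x) x
    iter-% k = trans (cong (λ j → iter σ j x) (m≡m%n+[m/n]*n k (len x)))
                     (trans (iter-+ (k % len x) (k / len x ℕ.* len x) x) (cong (iter σ (k % len x)) (iter-* iter-len (k / len x))))

    abstract
      period : ∀ d → iter σ d x ≡ x → Σ ℕ λ q → d ≡ q ℕ.* len x
      period d eq = go (d % len x) refl
        where
        go : ∀ r → d % len x ≡ r → Σ ℕ λ q → d ≡ q ℕ.* len x
        go zero    r≡ = d / len x , trans (m≡m%n+[m/n]*n d (len x)) (cong (ℕ._+ d / len x ℕ.* len x) r≡)
        go (suc r) r≡ = ⊥-elim (ℕP.<⇒≱ (subst (_< len x) r≡ (m%n<n d (len x)))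
                           (len-minimal r (trans (cong (λ j → iter σ j x) (sym r≡)) (trans (sym (iter-% d)) eq))))

      orbit-sym : ∀ k → Σ ℕ λ c → iter σ c (iter σ k x) ≡ x
      -- After `k` steps, `k` times `len x − 1` further ones complete `k` full rounds of the cycle.
      orbit-sym k = k ℕ.* ℕ.pred (len x) , trans (sym (iter-+ (k ℕ.* ℕ.pred (len x)) k x)) (trans (cong (λ j → iter σ j x) total) (iter-* iter-len k))
        where
        total : k ℕ.* ℕ.pred (len x) ℕ.+ k ≡ k ℕ.* len x
        total = trans (ℕP.+-comm _ k) (trans (sym (ℕP.*-suc k (ℕ.pred (len x)))) (cong (k ℕ.*_) (ℕP.suc-pred (len x))))

  len-iter-≤ : ∀ k x → len (iter σ k x) ≤ len x
  len-iter-≤ k x = go (len x) (iter-len x) (proj₁ (len-bounds x))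
    where
    go : ∀ l → iter σ l x ≡ x → 1 ≤ l → len (iter σ k x) ≤ l
    go (suc l) eq _ = len-minimal (iter σ k x) l (trans (iter-comm (suc l) k x) (cong (iter σ k) eq))

  len-iter : ∀ k x → len (iter σ k x) ≡ len x
  len-iter k x with orbit-sym x k
  ... | c , eq = ℕP.≤-antisym (len-iter-≤ k x) (subst (λ y → len y ≤ len (iter σ k x)) eq (len-iter-≤ c (iter σ k x)))

  -- `isCycleRep` tests the exponents below `n`; any exponent reduces to one of these modulo the
  -- cycle length, which is at most `n`.
  rep-minimal : ∀ {x} → T (isCycleRep σ x) → ∀ k → toℕ x ≤ toℕ (iter σ k x)
  rep-minimal {x} rep k = subst (λ y → toℕ x ≤ toℕ y) (sym (iter-% x k))
    (ℕP.≤ᵇ⇒≤ _ _ (allᵇ-lookup _ (upTo n) rep (∈-upTo⁺ (ℕP.<-≤-trans (m%n<n k (len x)) (proj₂ (len-bounds x))))))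
    where instance _ = len-nonZero x

  -- Descent on `toℕ`: a point that fails the test has a smaller point in its cycle, and `orbit-sym`
  -- leads back from there.
  has-rep : ∀ x → Acc _<_ (toℕ x) → Σ (Fin n) λ p → T (isCycleRep σ p) × Σ ℕ λ k → iter σ k p ≡ x
  has-rep x (acc rec) with isCycleRep σ x in eq
  ... | true  = x , subst T (sym eq) tt , 0 , refl
  ... | false with allᵇ-fails _ (upTo n) eq
  ...   | k , fails with has-rep (iter σ k x) (rec (ℕP.≰⇒> (λ le → subst T fails (ℕP.≤⇒≤ᵇ le))))
  ...     | p , rep , l , lp≡ with orbit-sym x k
  ...       | c , c≡ = p , rep , c ℕ.+ l , trans (iter-+ c l p) (trans (cong (iter σ c) lp≡) c≡)

  -- A transversal of the cycles. It is kept more general than the minimal points `reps` so that a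
  -- representative can be moved along its cycle.
  record Base (B : List (Fin n)) : Set where
    field
      unique : Unique B
      covers : ∀ x → Σ (Fin n) λ b → b ∈ B × Σ ℕ λ k → iter σ k b ≡ x
      apart  : ∀ {b b′} → b ∈ B → b′ ∈ B → ∀ k l → iter σ k b ≡ iter σ l b′ → b ≡ b′

  reps : List (Fin n)
  reps = filterᵇ (isCycleRep σ) (allFin n)

  reps-base : Base reps
  reps-base = record
    { unique = Unique.filter⁺ (λ x → T? (isCycleRep σ x)) (Unique.allFin⁺ n)
    ; covers = λ x → let p , rep , k , eq = has-rep x (<-wellFounded (toℕ x)) in
                     p , ∈-filterᵇ⁺ (isCycleRep σ) (∈-allFin p) rep , k , eq
    ; apart = λ {b} {b′} b∈ b′∈ k l eq → FinP.toℕ-injective (ℕP.≤-antisym (below′ b∈ k l eq) (below′ b′∈ l k (sym eq))) }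
    where
    below′ : ∀ {b b′} → b ∈ reps → ∀ k l → iter σ k b ≡ iter σ l b′ → toℕ b ≤ toℕ b′
    below′ {b} {b′} b∈ k l eq with orbit-sym b′ l
    ... | c , c≡ = subst (λ y → toℕ b ≤ toℕ y) (trans (iter-+ c k b) (trans (cong (iter σ c) eq) c≡))
                         (rep-minimal (proj₂ (∈-filterᵇ⁻ (isCycleRep σ) (allFin n) b∈)) (c ℕ.+ k))

  Base-↭ : ∀ {B B′} → B ↭ B′ → Base B → Base B′
  Base-↭ p base = record
    { unique = SetoidPerm.Unique-resp-↭ (≡.setoid (Fin n)) (↭⇒↭ₛ p) (Base.unique base)
    ; covers = λ x → let b , b∈ , r = Base.covers base x in b , ∈-resp-↭ p b∈ , r
    ; apart = λ b∈ b′∈ → Base.apart base (∈-resp-↭ (↭-sym p) b∈) (∈-resp-↭ (↭-sym p) b′∈) }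

  Base-move : ∀ k {b B} → Base (b ∷ B) → Base (iter σ k b ∷ B)
  Base-move k {b} {B} base = record
    { unique = All.tabulate (λ {b′} b′∈ eq → fresh b′∈ k 0 eq) ∷ uB ; covers = covers′ ; apart = apart′ }
    where
    x = iter σ k b
    uB : Unique B
    uB with Base.unique base
    ... | _ ∷ u = u
    fresh : ∀ {b′} → b′ ∈ B → ∀ k l → iter σ k b ≢ iter σ l b′
    fresh b′∈ k l eq with Base.unique base
    ... | b∉ ∷ _ = All.lookup b∉ b′∈ (Base.apart base (here refl) (there b′∈) k l eq)
    covers′ : ∀ y → Σ (Fin n) λ b′ → b′ ∈ x ∷ B × Σ ℕ λ l → iter σ l b′ ≡ y
    covers′ y with Base.covers base y
    ... | b′ , there b′∈ , r = b′ , there b′∈ , r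
    ... | _ , here refl , l , eq with orbit-sym b k
    ...   | c , c≡ = x , here refl , l ℕ.+ c , trans (iter-+ l c x) (trans (cong (iter σ l) c≡) eq)
    apart′ : ∀ {b₁ b₂} → b₁ ∈ x ∷ B → b₂ ∈ x ∷ B → ∀ l₁ l₂ → iter σ l₁ b₁ ≡ iter σ l₂ b₂ → b₁ ≡ b₂
    apart′ (here refl) (here refl) _  _  _  = refl
    apart′ (here refl) (there b∈)  l₁ l₂ eq = ⊥-elim (fresh b∈ (l₁ ℕ.+ k) l₂ (trans (iter-+ l₁ k b) eq))
    apart′ (there b∈)  (here refl) l₁ l₂ eq = ⊥-elim (fresh b∈ (l₂ ℕ.+ k) l₁ (trans (iter-+ l₂ k b) (sym eq)))
    apart′ (there b₁∈) (there b₂∈) l₁ l₂ eq = Base.apart base (there b₁∈) (there b₂∈) l₁ l₂ eq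

  -- The conjugating map has to fix a given point, so that point must itself represent its cycle;
  -- the lengths of the other cycles are kept for the matching.
  base-through : ∀ x → Σ (List (Fin n)) λ B → Base (x ∷ B) × map len reps ↭ len x ∷ map len B
  base-through x with Base.covers reps-base x
  ... | b , b∈ , k , refl with ∈-∃++ b∈
  ...   | ys , zs , eq = ys ++ zs , Base-move k (Base-↭ p reps-base) ,
            subst (λ l → map len reps ↭ l ∷ map len (ys ++ zs)) (sym (len-iter k b)) (map⁺ len p)
    where
    p : reps ↭ b ∷ ys ++ zs
    p = subst (_↭ b ∷ ys ++ zs) (sym eq) (shift b ys zs)

  period-iter : ∀ {x k l} → k ≤ l → iter σ k x ≡ iter σ l x → Σ ℕ λ q → l ≡ k ℕ.+ q ℕ.* len x
  period-iter {x} {k} k≤l eq with ℕP.m≤n⇒∃[o]m+o≡n k≤l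
  ... | d , refl with period x d (sym (iter-injective k (trans eq (iter-+ k d x))))
  ...   | q , refl = q , refl

insertDesc-↭ : ∀ a bs → insertDesc a bs ↭ a ∷ bs
insertDesc-↭ a []       = ↭-refl
insertDesc-↭ a (b ∷ bs) with b ≤ᵇ a
... | true  = ↭-refl
... | false = ↭-trans (↭.prep b (insertDesc-↭ a bs)) (↭.swap b a ↭-refl)

sortDesc-↭ : ∀ as → sortDesc as ↭ as
sortDesc-↭ []       = ↭-refl
sortDesc-↭ (a ∷ as) = ↭-trans (insertDesc-↭ a (sortDesc as)) (↭.prep a (sortDesc-↭ as))

unique-map : ∀ {A B : Set} (f : A → B) {xs} → Unique (map f xs) → ∀ {x y} → x ∈ xs → y ∈ xs → f x ≡ f y → x ≡ y
unique-map f (_ ∷ u)  (here refl) (here refl) _  = refl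
unique-map f (x∉ ∷ u) (here refl) (there y∈)  eq = ⊥-elim (All.lookup x∉ (∈-map⁺ f y∈) eq)
unique-map f (x∉ ∷ u) (there x∈)  (here refl) eq = ⊥-elim (All.lookup x∉ (∈-map⁺ f x∈) (sym eq))
unique-map f (_ ∷ u)  (there x∈)  (there y∈)  eq = unique-map f u x∈ y∈ eq

pair-up : ∀ {A B C : Set} (f : A → C) (g : B → C) xs ys → map f xs ≡ map g ys →
          Σ (List (A × B)) λ W → map proj₁ W ≡ xs × map proj₂ W ≡ ys × (∀ {a b} → (a , b) ∈ W → f a ≡ g b)
pair-up f g []       []       _  = [] , refl , refl , λ ()
pair-up f g (x ∷ xs) (y ∷ ys) eq with pair-up f g xs ys (LP.∷-injectiveʳ eq)
... | W , refl , refl , h = (x , y) ∷ W , refl , refl , λ { (here refl) → LP.∷-injectiveˡ eq ; (there p) → h p }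

-- Conjugacy

module Matching {n : ℕ} {σ π : Perm n} (pσ : IsPerm σ) (pπ : IsPerm π) (W : List (Fin n × Fin n))
                (base : Cycle.Base σ pσ (map proj₁ W)) (lens : ∀ {a b} → (a , b) ∈ W → cycleLength σ a ≡ cycleLength π b) where
  private
    module σ = Cycle σ pσ
    module π = Cycle π pπ

  -- The graph of the conjugating map: equally many steps from paired representatives.
  data Rel (x y : Fin n) : Set where
    rel : ∀ {a b} → (a , b) ∈ W → ∀ k → iter σ k a ≡ x → iter π k b ≡ y → Rel x y

  Rel-total : ∀ x → Σ (Fin n) (Rel x)
  Rel-total x with σ.Base.covers base x
  ... | a , a∈ , k , eq with ∈-map⁻ proj₁ a∈
  ...   | (_ , b) , ab∈ , refl = iter π k b , rel ab∈ k eq refl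

  Rel-step : ∀ {x y} → Rel x y → Rel (lookup σ x) (lookup π y)
  Rel-step (rel ab∈ k refl refl) = rel ab∈ (suc k) refl refl

  same-period : ∀ {a b} → (a , b) ∈ W → ∀ {k l} → k ≤ l → iter σ k a ≡ iter σ l a → iter π k b ≡ iter π l b
  same-period {a} {b} ab∈ {k} k≤l eq with σ.period-iter k≤l eq
  ... | q , refl = sym (trans (π.iter-+ k (q ℕ.* cycleLength σ a) b)
                              (cong (iter π k) (trans (cong (λ L → iter π (q ℕ.* L) b) (lens ab∈)) (π.iter-* (π.iter-len b) q))))

  -- Two descriptions of the same `x` start from the same representative, and their exponents differ
  -- by a multiple of its cycle length. The partner in `π` has that same cycle length, so the images
  -- agree.
  Rel-functional : ∀ {x y y′} → Rel x y → Rel x y′ → y ≡ y′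
  Rel-functional (rel ab∈ k eq refl) (rel ab′∈ l eq′ refl)
    with unique-map proj₁ (σ.Base.unique base) ab∈ ab′∈
           (σ.Base.apart base (∈-map⁺ proj₁ ab∈) (∈-map⁺ proj₁ ab′∈) k l (trans eq (sym eq′)))
  ... | refl with ℕP.≤-total k l
  ...   | inj₁ k≤l = same-period ab∈ k≤l (trans eq (sym eq′))
  ...   | inj₂ l≤k = sym (same-period ab∈ l≤k (trans eq′ (sym eq)))

record Conjugator {n : ℕ} (c : Fin n) (σ π : Perm n) : Set where
  field
    g g⁻¹      : Fin n → Fin n
    inverseˡ   : ∀ x → g⁻¹ (g x) ≡ x
    inverseʳ   : ∀ x → g (g⁻¹ x) ≡ x
    fixes      : g c ≡ c
    intertwines : ∀ x → g (lookup σ x) ≡ lookup π (g x)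

-- Removing the cycle of `c` on both sides leaves the same multiset of lengths; the remaining
-- representatives are paired by length and `c` is paired with itself. Exchanging `σ` and `π` in the
-- construction gives the inverse map.
conjugator : ∀ {n} (c : Fin n) {σ π : Perm n} → IsPerm σ → IsPerm π → cycleType σ ≡ cycleType π →
             cycleLength σ c ≡ cycleLength π c → Conjugator c σ π
conjugator {n} c {σ} {π} pσ pπ type≡ len≡ with Cycle.base-through σ pσ c | Cycle.base-through π pπ c
... | B , baseB , permB | B′ , baseB′ , permB′ with ↭-map-inv (cycleLength σ) lens↭
  where
  reps↭ : map (cycleLength σ) (Cycle.reps σ pσ) ↭ map (cycleLength π) (Cycle.reps π pπ)
  reps↭ = ↭-trans (↭-sym (sortDesc-↭ _)) (subst (_↭ _) (sym type≡) (sortDesc-↭ _))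
  lens↭ : map (cycleLength σ) B ↭ map (cycleLength π) B′
  lens↭ = drop-∷ (subst (λ l → cycleLength σ c ∷ map (cycleLength σ) B ↭ l ∷ map (cycleLength π) B′) (sym len≡)
            (↭-trans (↭-sym permB) (↭-trans reps↭ permB′)))
... | B₁ , eq₁ , B↭B₁ with pair-up (cycleLength σ) (cycleLength π) B₁ B′ (sym eq₁)
...   | W , refl , refl , lens = record
  { g = λ x → proj₁ (M.Rel-total x)
  ; g⁻¹ = λ y → proj₁ (M′.Rel-total y)
  ; inverseˡ = λ x → M′.Rel-functional (proj₂ (M′.Rel-total _)) (flip (proj₂ (M.Rel-total x)))
  ; inverseʳ = λ y → M.Rel-functional (proj₂ (M.Rel-total _)) (flip′ (proj₂ (M′.Rel-total y)))
  ; fixes = M.Rel-functional (proj₂ (M.Rel-total c)) (M.rel (here refl) 0 refl refl)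
  ; intertwines = λ x → M.Rel-functional (proj₂ (M.Rel-total _)) (M.Rel-step (proj₂ (M.Rel-total x)))
  }
  where
  W⁺ : List (Fin n × Fin n)
  W⁺ = (c , c) ∷ W
  sw× : Fin n × Fin n → Fin n × Fin n
  sw× (a , b) = b , a
  lens⁺ : ∀ {a b} → (a , b) ∈ W⁺ → cycleLength σ a ≡ cycleLength π b
  lens⁺ (here refl) = len≡
  lens⁺ (there ab∈) = lens ab∈
  W⁻ : List (Fin n × Fin n)
  W⁻ = map sw× W⁺
  proj-W⁻ : ∀ (W : List (Fin n × Fin n)) → map proj₂ W ≡ map proj₁ (map sw× W)
  proj-W⁻ []      = refl
  proj-W⁻ (_ ∷ W) = cong (_ ∷_) (proj-W⁻ W)
  unswap : ∀ {a b W} → (b , a) ∈ map sw× W → (a , b) ∈ W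
  unswap ba∈ with ∈-map⁻ sw× ba∈
  ... | _ , ab∈ , refl = ab∈
  module M = Matching pσ pπ W⁺ (Cycle.Base-↭ σ pσ (↭.prep c B↭B₁) baseB) lens⁺
  module M′ = Matching pπ pσ W⁻ (subst (Cycle.Base π pπ) (proj-W⁻ W⁺) baseB′) (λ ba∈ → sym (lens⁺ (unswap {W = W⁺} ba∈)))
  flip : ∀ {x y} → M.Rel x y → M′.Rel y x
  flip (M.rel ab∈ k eq eq′) = M′.rel (∈-map⁺ sw× ab∈) k eq′ eq
  flip′ : ∀ {x y} → M′.Rel y x → M.Rel x y
  flip′ (M′.rel ba∈ k eq eq′) = M.rel (unswap {W = W⁺} ba∈) k eq′ eq

-- Star factorizations

fromℕℚ-length-filterᵇ : ∀ {A : Set} (p : A → Bool) xs → fromℕℚ (length (filterᵇ p xs)) ≡ ∑ xs (λ x → if p x then 1ℚ else 0ℚ)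
fromℕℚ-length-filterᵇ p []       = refl
fromℕℚ-length-filterᵇ p (x ∷ xs) with p x
... | true  = trans (fromℤℚ-+ (ℤ.+ 1) (ℤ.+ length (filterᵇ p xs))) (cong (1ℚ +_) (fromℕℚ-length-filterᵇ p xs))
... | false = trans (fromℕℚ-length-filterᵇ p xs) (sym (ℚP.+-identityˡ _))

∑-const : ∀ {A : Set} (xs : List A) q → ∑ xs (λ _ → q) ≡ fromℕℚ (length xs) * q
∑-const []       q = sym (ℚP.*-zeroˡ q)
∑-const (x ∷ xs) q = trans (cong (q +_) (∑-const xs q)) (trans (cong (_+ fromℕℚ (length xs) * q) (sym (ℚP.*-identityˡ q)))
  (trans (sym (ℚP.*-distribʳ-+ q 1ℚ (fromℕℚ (length xs)))) (cong (_* q) (sym (fromℤℚ-+ (ℤ.+ 1) (ℤ.+ length xs))))))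

cycleTypeIs-sound : ∀ m μ i π as bs → T (cycleTypeIs m μ i π as bs) → as ≡ bs
cycleTypeIs-sound m μ i π []       []       _ = refl
cycleTypeIs-sound m μ i π (a ∷ as) (b ∷ bs) t with a ≡ᵇ b in eq
... | true = cong₂ _∷_ (ℕP.≡ᵇ⇒≡ a b (subst T (sym eq) tt)) (cycleTypeIs-sound m μ i π as bs t)

cycleTypeIs-refl : ∀ m μ i π as → T (cycleTypeIs m μ i π as as)
cycleTypeIs-refl m μ i π []       = tt
cycleTypeIs-refl m μ i π (a ∷ as) with a ≡ᵇ a | ℕP.≡⇒≡ᵇ a a refl
... | true | _ = cycleTypeIs-refl m μ i π as

module _ (m : ℕ) where
  private n = suc m
  open Operators m
  open Convolution m
  open YoungBasis jucysMurphy using (Xpow)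

  last : Fin n
  last = fromℕ m

  el-last : el m ≡ last
  el-last = FinP.toℕ-injective (trans (toℕ-el (ℕP.n<1+n m)) (sym (FinP.toℕ-fromℕ m)))

  below≢last : ∀ {j : Fin n} → j ∈ below n m → j ≢ last
  below≢last j∈ refl = ℕP.<⇒≢ (∈-below⁻ j∈) (FinP.toℕ-fromℕ m)

  ≢last⇒below : ∀ {j : Fin n} → j ≢ last → j ∈ below n m
  ≢last⇒below {j} j≢ = ∈-below⁺ (ℕP.≤∧≢⇒< (ℕP.≤-pred (FinP.toℕ<n j)) (λ eq → j≢ (FinP.toℕ-injective (trans eq (sym (FinP.toℕ-fromℕ m))))))

  ∑-star : ∀ (f : Fin n → ℚ) → ∑ (allFin m) (f ∘ inject₁) ≡ ∑ (below n m) f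
  ∑-star f = trans (sym (∑-map inject₁ (allFin m) f))
    (∑-↭ f (unique-↭ (Unique.map⁺ FinP.inject₁-injective (Unique.allFin⁺ m)) (below-unique m) to from))
    where
    to : ∀ {j} → j ∈ map inject₁ (allFin m) → j ∈ below n m
    to j∈ with ∈-map⁻ inject₁ j∈
    ... | i , _ , refl = ∈-below⁺ (subst (_< m) (sym (FinP.toℕ-inject₁ i)) (FinP.toℕ<n i))
    from : ∀ {j} → j ∈ below n m → j ∈ map inject₁ (allFin m)
    from {j} j∈ = subst (_∈ map inject₁ (allFin m)) (FinP.inject₁-lower₁ j ≢m) (∈-map⁺ inject₁ (∈-allFin (Fin.lower₁ j ≢m)))
      where
      ≢m : m ≢ toℕ j
      ≢m eq = ℕP.<⇒≢ (∈-below⁻ j∈) (sym eq)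

  transp-≟ᴾ : ∀ a b (ρ π : Perm n) → ((transp a b ∘ᴾ ρ) ≟ᴾ π) ≡ (ρ ≟ᴾ act (sw a b) π)
  transp-≟ᴾ a b ρ π with VecP.≡-dec Fin._≟_ ρ (act (sw a b) π)
  ... | yes refl = ≟ᴾ-true (transp a b ∘ᴾ act (sw a b) π) π (trans (transp-∘ a b _) (act-involutive (sw-involutive a b) π))
  ... | no ρ≢    = ≟ᴾ-false (transp a b ∘ᴾ ρ) π (λ eq → ρ≢ (trans (sym (transp-involutive a b ρ)) (trans (cong (transp a b ∘ᴾ_) eq) (transp-∘ a b π))))

  -- The first transposition of a factorization, being an involution, can be moved over to `π`.
  -- Summing over its choices is one application of `X m`.
  #star-Xpow : ∀ r π → fromℕℚ (#starFactorizations m r π) ≡ Xpow m r 1ᴬ π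
  #star-Xpow r π = trans (fromℕℚ-length-filterᵇ (λ s → prodᴾ s ≟ᴾ π) (seqs r stars)) (count-Xpow r π)
    where
    open ≡-Reasoning
    stars : List (Perm n)
    stars = starTranspositions m
    count-Xpow : ∀ r π → ∑ (seqs r stars) (λ s → if prodᴾ s ≟ᴾ π then 1ℚ else 0ℚ) ≡ Xpow m r 1ᴬ π
    count-Xpow zero    π = ℚP.+-identityʳ _
    count-Xpow (suc r) π = begin
      ∑ (seqs (suc r) stars) (λ s → if prodᴾ s ≟ᴾ π then 1ℚ else 0ℚ)
        ≡⟨ ∑-concatMap (λ τ → map (τ ∷_) (seqs r stars)) stars _ ⟩
      ∑ stars (λ τ → ∑ (map (τ ∷_) (seqs r stars)) (λ s → if prodᴾ s ≟ᴾ π then 1ℚ else 0ℚ))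
        ≡⟨ ∑-cong stars (λ {τ} _ → ∑-map (τ ∷_) (seqs r stars) _) ⟩
      ∑ stars (λ τ → ∑ (seqs r stars) (λ s → if (τ ∘ᴾ prodᴾ s) ≟ᴾ π then 1ℚ else 0ℚ))
        ≡⟨ ∑-map (λ j → transp (inject₁ j) last) (allFin m) _ ⟩
      ∑ (allFin m) (λ j → ∑ (seqs r stars) (λ s → if (transp (inject₁ j) last ∘ᴾ prodᴾ s) ≟ᴾ π then 1ℚ else 0ℚ))
        ≡⟨ ∑-cong (allFin m) (λ {j} _ → ∑-cong (seqs r stars) (λ {s} _ → cong (λ b → if b then 1ℚ else 0ℚ) (transp-≟ᴾ (inject₁ j) last (prodᴾ s) π))) ⟩
      ∑ (allFin m) (λ j → ∑ (seqs r stars) (λ s → if prodᴾ s ≟ᴾ act (sw (inject₁ j) last) π then 1ℚ else 0ℚ))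
        ≡⟨ ∑-cong (allFin m) (λ {j} _ → count-Xpow r (act (sw (inject₁ j) last) π)) ⟩
      ∑ (allFin m) (λ j → Xpow m r 1ᴬ (act (sw (inject₁ j) last) π))
        ≡⟨ ∑-star (λ j → Xpow m r 1ᴬ (act (sw j last) π)) ⟩
      ∑ (below n m) (λ j → Xpow m r 1ᴬ (act (sw j last) π))
        ≡⟨ cong (λ b → ∑ (below n m) (λ j → Xpow m r 1ᴬ (act (sw j b) π))) el-last ⟨
      Xpow m (suc r) 1ᴬ π ∎

  -- Because `g` fixes the last point, the same `g` conjugates `(j , last) σ` into `(g j , last) π`,
  -- and it permutes the other points; so the two sums agree after reindexing. For exponent zero,
  -- only the identity is conjugate to the identity.
  Xpow-conj : ∀ r {σ π : Perm n} → Conjugator last σ π → Xpow m r 1ᴬ σ ≡ Xpow m r 1ᴬ π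
  Xpow-conj zero {σ} {π} conj with VecP.≡-dec Fin._≟_ idᴾ σ
  ... | yes refl = sym (cong (λ b → if b then 1ℚ else 0ℚ) (≟ᴾ-true idᴾ π
          (trans (VecP.tabulate-cong π-fixes) (VecP.tabulate∘lookup π))))
    where
    open Conjugator conj
    π-fixes : ∀ x → x ≡ lookup π x
    π-fixes x = trans (sym (inverseʳ x)) (trans (cong g (sym (VecP.lookup∘tabulate (λ i → i) (g⁻¹ x))))
                  (trans (intertwines (g⁻¹ x)) (cong (lookup π) (inverseʳ x))))
  ... | no id≢σ = sym (cong (λ b → if b then 1ℚ else 0ℚ) (≟ᴾ-false idᴾ π
          (λ id≡π → id≢σ (trans (VecP.tabulate-cong (σ-fixes id≡π)) (VecP.tabulate∘lookup σ)))))
    where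
    open Conjugator conj
    σ-fixes : idᴾ ≡ π → ∀ x → x ≡ lookup σ x
    σ-fixes id≡π x = trans (sym (inverseˡ x)) (trans (cong g⁻¹ (sym (trans (intertwines x)
                       (trans (cong (λ ρ → lookup ρ (g x)) (sym id≡π)) (VecP.lookup∘tabulate (λ i → i) (g x)))))) (inverseˡ _))
  Xpow-conj (suc r) {σ} {π} conj = begin
    ∑ (below n m) (λ j → Xpow m r 1ᴬ (act (sw j (el m)) σ))        ≡⟨ ∑-cong (below n m) (λ {j} _ → Xpow-conj r (step j)) ⟩
    ∑ (below n m) (λ j → Xpow m r 1ᴬ (act (sw (g j) (el m)) π))    ≡⟨ ∑-map g (below n m) (λ j → Xpow m r 1ᴬ (act (sw j (el m)) π)) ⟨
    ∑ (map g (below n m)) (λ j → Xpow m r 1ᴬ (act (sw j (el m)) π)) ≡⟨ ∑-↭ _ (unique-↭ (Unique.map⁺ g-injective (below-unique m)) (below-unique m) to from) ⟩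
    ∑ (below n m) (λ j → Xpow m r 1ᴬ (act (sw j (el m)) π))        ∎
    where
    open ≡-Reasoning
    open Conjugator conj
    g-injective : ∀ {x y} → g x ≡ g y → x ≡ y
    g-injective {x} {y} eq = trans (sym (inverseˡ x)) (trans (cong g⁻¹ eq) (inverseˡ y))
    step : ∀ j → Conjugator last (act (sw j (el m)) σ) (act (sw (g j) (el m)) π)
    step j = record
      { g = g ; g⁻¹ = g⁻¹ ; inverseˡ = inverseˡ ; inverseʳ = inverseʳ ; fixes = fixes
      ; intertwines = λ x → begin
          g (lookup (act (sw j (el m)) σ) x)          ≡⟨ cong g (VecP.lookup-map x (sw j (el m)) σ) ⟩
          g (sw j (el m) (lookup σ x))                ≡⟨ sw-conj g g-injective j (el m) (lookup σ x) ⟩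
          sw (g j) (g (el m)) (g (lookup σ x))        ≡⟨ cong₂ (sw (g j)) (trans (cong g el-last) (trans fixes (sym el-last))) (intertwines x) ⟩
          sw (g j) (el m) (lookup π (g x))            ≡⟨ VecP.lookup-map (g x) (sw (g j) (el m)) π ⟨
          lookup (act (sw (g j) (el m)) π) (g x)      ∎ }
    to : ∀ {j} → j ∈ map g (below n m) → j ∈ below n m
    to j∈ with ∈-map⁻ g j∈
    ... | i , i∈ , refl = ≢last⇒below (λ eq → below≢last i∈ (g-injective (trans eq (sym fixes))))
    from : ∀ {j} → j ∈ below n m → j ∈ map g (below n m)
    from {j} j∈ = subst (_∈ map g (below n m)) (inverseʳ j)
      (∈-map⁺ g (≢last⇒below (λ eq → below≢last j∈ (trans (sym (inverseʳ j)) (trans (cong g eq) fixes)))))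

  module _ (lam : List ℕ) (i : ℕ) where

    ∈-Cset⁻ : ∀ {σ} → σ ∈ Cset m lam i → InC m lam i σ
    ∈-Cset⁻ {σ} σ∈ with ∈-filterᵇ⁻ (inC m lam i) (allPerms n) σ∈
    ... | σ∈P , t with Equivalence.to (T-∧ {cycleTypeIs m lam i σ (cycleType σ) lam}) t
    ...   | t₁ , t₂ = ∈-allPerms⁻ σ∈P , cycleTypeIs-sound m lam i σ (cycleType σ) lam t₁ , ℕP.≡ᵇ⇒≡ _ _ t₂

    ∈-Cset⁺ : ∀ {σ} → InC m lam i σ → σ ∈ Cset m lam i
    ∈-Cset⁺ {σ} (pσ , type , len) = ∈-filterᵇ⁺ (inC m lam i) (∈-allPerms⁺ pσ)
      (Equivalence.from (T-∧ {cycleTypeIs m lam i σ (cycleType σ) lam})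
        (subst (λ as → T (cycleTypeIs m lam i σ as lam)) (sym type) (cycleTypeIs-refl m lam i σ lam) , ℕP.≡⇒≡ᵇ _ _ len))

    -- `coeffK` is an average; membership of `π` shows that the class is nonempty, so its size can
    -- be cancelled.
    coeffK-const : ∀ {π} (f : GA n) → π ∈ Cset m lam i → (∀ {σ} → σ ∈ Cset m lam i → f σ ≡ f π) → coeffK m lam i f ≡ f π
    coeffK-const {π} f π∈ const = begin
      ∑ C f * invℤ L                          ≡⟨ cong (_* invℤ L) (trans (∑-cong C const) (∑-const C (f π))) ⟩
      fromℤℚ L * f π * invℤ L                 ≡⟨ ℚP.*-comm (fromℤℚ L * f π) (invℤ L) ⟩
      invℤ L * (fromℤℚ L * f π)               ≡⟨ ℚP.*-assoc (invℤ L) (fromℤℚ L) (f π) ⟨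
      (invℤ L * fromℤℚ L) * f π               ≡⟨ cong (_* f π) (invℤ-inverse L (nonEmpty π∈)) ⟩
      1ℚ * f π                                ≡⟨ ℚP.*-identityˡ (f π) ⟩
      f π                                     ∎
      where
      open ≡-Reasoning
      C = Cset m lam i
      L = ℤ.+ length C
      nonEmpty : ∀ {A : Set} {x : A} {xs} → x ∈ xs → ℤ.+ length xs ≢ ℤ.+ 0
      nonEmpty (here _)  ()
      nonEmpty (there _) ()

    #star-coeffK : ∀ r π → InC m lam i π → fromℕℚ (#starFactorizations m r π) ≡ coeffK m lam i (Jn m ^ᴬ r)
    #star-coeffK r π c@(pπ , typeπ , lenπ) = trans (trans (#star-Xpow r π) (sym (Jn-^ r pπ)))
      (sym (coeffK-const (Jn m ^ᴬ r) (∈-Cset⁺ c) λ {σ} σ∈ →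
        let pσ , typeσ , lenσ = ∈-Cset⁻ σ∈ in
        trans (Jn-^ r pσ) (trans (Xpow-conj r (conjugator last pσ pπ (trans typeσ (sym typeπ)) (trans lenσ (sym lenπ)))) (sym (Jn-^ r pπ)))))

theorem4p1 : (m : ℕ) (lam : List ℕ) → IsPartition (suc m) lam → (i : ℕ) → i ∈ lam →
    (r : ℕ) → 1 ≤ r → (π : Perm (suc m)) → InC m lam i π →
    (fromℕℚ (#starFactorizations m r π) ≡ coeffK m lam i (Jn m ^ᴬ r))
    × (coeffK m lam i (Jn m ^ᴬ r) ≡ characterSum m lam i r)
theorem4p1 m lam _ i _ r _ π c = #star-coeffK m lam i r π c , Jn-^-characters m lam i r
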